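{- In $\mathbb{Z}[t][[u]]$, \[ \sum_{n=1}^\infty P_{W^n}(t) u^n=\frac{u+1}{2 (t u+1) \sqrt{(u-1)^2-4 t u^2}}-\frac{1}{2 (t u+1)}, \] where the square root is the power series in $u$ with constant term $1$.
   Context: For a matroid $M$ let $L(M)$ be its lattice of flats, $\mathrm{rk}\, M$ its rank, $\chi_M(t)$ its characteristic polynomial; for a flat $F$, $M_F$ is the localization (restriction to $F$) and $M^F$ the contraction at $F$. The Kazhdan–Lusztig polynomial is the unique assignment of $P_M(t)\in\mathbb{Z}[t]$ to each loopless matroid $M$ with: $P_M=1$ if $\mathrm{rk}\, M=0$; $\deg P_M<\frac12\mathrm{rk}\, M$ if $\mathrm{rk}\, M>0$; $t^{\mathrm{rk}\, M}P_M(t^{ -1})=\sum_{F\in L(M)}\chi_{M_F}(t)P_{M^F}(t)$. For $n\ge3$ let $W_n$ be the wheel graph (vertices $0,\dots,n$, edges of the cycle $1,2,\dots,n,1$ forming the set $O_n$, and edges $\{0,i\}$), and let the whirl matroid $W^n$ be the matroid on $E(W_n)$ whose independent sets are the edge sets of forests of $W_n$ together with $O_n$. Further, $W^1$ is the graphic matroid of a single edge (the rank-one matroid on one element), and $W^2$ is the matroid obtained from the graphic matroid of the multigraph on $\{0,1,2\}$ with edges $(0,1),(0,2)$ and two parallel edges $e_1,e_2$ between $1$ and $2$ by declaring $\{e_1,e_2\}$ independent; i.e. $W^2$ is the uniform matroid of rank $2$ on $4$ elements. -}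

module Defs where

open import Data.Bool using (Bool; true; false; _∧_; _∨_; not; if_then_else_; T)
open import Data.Nat using (ℕ; zero; suc; _+_; _*_; _∸_; _≤_; _<_; _<ᵇ_; _≡ᵇ_; _⊔_)
open import Data.Nat.DivMod using (_%_; m%n<n)
open import Data.Integer using (ℤ; 0ℤ; 1ℤ; -_) renaming (_+_ to _+ℤ_; _*_ to _*ℤ_)
open import Data.Fin using (Fin; zero; suc; toℕ; fromℕ<; splitAt; _≟_)
open import Data.Vec using (Vec; []; _∷_; replicate; zipWith; lookup; tabulate; map)
open import Data.List using (List; []; _∷_; _++_; foldr; upTo; allFin; filterᵇ; [_]) renaming (map to mapL)
open import Data.Sum using (_⊎_; inj₁; inj₂)
open import Data.Product using (_×_; _,_; ∃)
open import Relation.Nullary.Decidable using (⌊_⌋)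
open import Relation.Binary.PropositionalEquality using (_≡_)

allB : {A : Set} → (A → Bool) → List A → Bool
allB p = foldr (λ x b → p x ∧ b) true

Sub : ℕ → Set
Sub m = Vec Bool m

∅s : ∀ {m} → Sub m
∅s = replicate _ false

fulls : ∀ {m} → Sub m
fulls = replicate _ true

_∪s_ : ∀ {m} → Sub m → Sub m → Sub m
_∪s_ = zipWith _∨_

compl : ∀ {m} → Sub m → Sub m
compl = map not

single : ∀ {m} → Fin m → Sub m
single x = tabulate (λ y → ⌊ x ≟ y ⌋)

card : ∀ {m} → Sub m → ℕ
card [] = 0
card (true ∷ A) = suc (card A)
card (false ∷ A) = card A

_⊆b_ : ∀ {m} → Sub m → Sub m → Bool
[] ⊆b [] = true
(a ∷ A) ⊆b (b ∷ B) = (not a ∨ b) ∧ (A ⊆b B)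

_==s_ : ∀ {m} → Sub m → Sub m → Bool
[] ==s [] = true
(true ∷ A) ==s (true ∷ B) = A ==s B
(false ∷ A) ==s (false ∷ B) = A ==s B
(_ ∷ _) ==s (_ ∷ _) = false

allSubs : (m : ℕ) → List (Sub m)
allSubs zero = [ [] ]
allSubs (suc m) = mapL (false ∷_) (allSubs m) ++ mapL (true ∷_) (allSubs m)

-- a subset of the ground set F (re-indexed as Fin (card F)) viewed as a subset of Fin m
expand : ∀ {m} (F : Sub m) → Sub (card F) → Sub m
expand [] [] = []
expand (true ∷ F) (b ∷ B) = b ∷ expand F B
expand (false ∷ F) B = false ∷ expand F B

record RawMatroid : Set where
  field
    size  : ℕ
    indep : Sub size → Bool
open RawMatroid public

record IsMatroid (M : RawMatroid) : Set where
  field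
    I1 : T (indep M ∅s)
    I2 : ∀ A B → T (A ⊆b B) → T (indep M B) → T (indep M A)
    I3 : ∀ A B → T (indep M A) → T (indep M B) → card A < card B →
         ∃ λ x → T (lookup B x) × T (not (lookup A x)) × T (indep M (A ∪s single x))

rank : (M : RawMatroid) → Sub (size M) → ℕ
rank M A = foldr (λ B acc → if (B ⊆b A) ∧ indep M B then card B ⊔ acc else acc) 0 (allSubs (size M))

rk : RawMatroid → ℕ
rk M = rank M fulls

Loopless : RawMatroid → Set
Loopless M = ∀ (x : Fin (size M)) → T (indep M (single x))

isFlat : (M : RawMatroid) → Sub (size M) → Bool
isFlat M F = allB (λ x → lookup F x ∨ (rank M F <ᵇ rank M (F ∪s single x))) (allFin (size M))

flats : (M : RawMatroid) → List (Sub (size M))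
flats M = filterᵇ (isFlat M) (allSubs (size M))

restrict : (M : RawMatroid) → Sub (size M) → RawMatroid
restrict M F = record { size = card F ; indep = λ B → indep M (expand F B) }

contract : (M : RawMatroid) → Sub (size M) → RawMatroid
contract M F = record
  { size = card (compl F)
  ; indep = λ B → rank M (expand (compl F) B ∪s F) ≡ᵇ (card B + rank M F) }

-- Integer polynomials in t, as coefficient lists (constant term first)

Poly : Set
Poly = List ℤ

coeff : Poly → ℕ → ℤ
coeff [] _ = 0ℤ
coeff (a ∷ p) zero = a
coeff (a ∷ p) (suc i) = coeff p i

_≈P_ : Poly → Poly → Set
p ≈P q = ∀ i → coeff p i ≡ coeff q i

_+P_ : Poly → Poly → Poly
[] +P q = q
(a ∷ p) +P [] = a ∷ p
(a ∷ p) +P (b ∷ q) = (a +ℤ b) ∷ (p +P q)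

scaleP : ℤ → Poly → Poly
scaleP c = mapL (c *ℤ_)

_*P_ : Poly → Poly → Poly
[] *P q = []
(a ∷ p) *P q = scaleP a q +P (0ℤ ∷ (p *P q))

sumP : List Poly → Poly
sumP = foldr _+P_ []

X^ : ℕ → Poly
X^ zero = 1ℤ ∷ []
X^ (suc k) = 0ℤ ∷ X^ k

sgn : ℕ → ℤ
sgn zero = 1ℤ
sgn (suc k) = - sgn k

-- t^r p(t⁻¹) (for deg p ≤ r)
reflect : ℕ → Poly → Poly
reflect r p = mapL (λ i → coeff p (r ∸ i)) (upTo (suc r))

charPoly : RawMatroid → Poly
charPoly M = sumP (mapL (λ A → scaleP (sgn (card A)) (X^ (rk M ∸ rank M A))) (allSubs (size M)))

record IsKL (P : RawMatroid → Poly) : Set where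
  field
    rank-zero  : ∀ M → IsMatroid M → Loopless M → rk M ≡ 0 → P M ≈P (1ℤ ∷ [])
    degree     : ∀ M → IsMatroid M → Loopless M → 0 < rk M →
                 ∀ i → rk M ≤ 2 * i → coeff (P M) i ≡ 0ℤ
    recurrence : ∀ M → IsMatroid M → Loopless M →
                 reflect (rk M) (P M)
                   ≈P sumP (mapL (λ F → charPoly (restrict M F) *P P (contract M F)) (flats M))

record Graph : Set where
  field
    nV nE : ℕ
    ends  : Fin nE → Fin nV × Fin nV
open Graph public

deg : (G : Graph) → Sub (nE G) → Fin (nV G) → ℕ
deg G C v = foldr (λ e acc → if lookup C e then endsAt (ends G e) + acc else acc) 0 (allFin (nE G))
  where
  hit : Fin (nV G) → ℕ
  hit w = if ⌊ v ≟ w ⌋ then 1 else 0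
  endsAt : Fin (nV G) × Fin (nV G) → ℕ
  endsAt (a , b) = hit a + hit b

evenTwo : (G : Graph) → Sub (nE G) → Bool
evenTwo G C = allB (λ v → (deg G C v ≡ᵇ 0) ∨ (deg G C v ≡ᵇ 2)) (allFin (nV G))

-- C is a nonempty edge set that is a disjoint union of cycles (2-regular subgraph)
cycleUnion : (G : Graph) → Sub (nE G) → Bool
cycleUnion G C = not (C ==s ∅s) ∧ evenTwo G C

isForest : (G : Graph) → Sub (nE G) → Bool
isForest G A = allB (λ C → not ((C ⊆b A) ∧ cycleUnion G C)) (allSubs (nE G))

rot : ∀ {k} → Fin (suc k) → Fin (suc k)
rot {k} i = fromℕ< (m%n<n (suc (toℕ i)) (suc k))

-- wheel graph W_n (n = suc k): vertex 0 = hub, vertices 1..n on the rim;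
-- edges 0..n-1 are the spokes {0,i}, edges n..2n-1 the rim edges {i,i+1} (O_n)
wheel : ℕ → Graph
wheel k = record
  { nV = suc (suc k) ; nE = suc k + suc k ; ends = e }
  where
  e : Fin (suc k + suc k) → Fin (suc (suc k)) × Fin (suc (suc k))
  e x with splitAt (suc k) x
  ... | inj₁ i = (zero , suc i)
  ... | inj₂ i = (suc i , suc (rot i))

rimSet : (k : ℕ) → Sub (suc k + suc k)
rimSet k = tabulate (λ x → isRim (splitAt (suc k) x))
  where
  isRim : Fin (suc k) ⊎ Fin (suc k) → Bool
  isRim (inj₁ _) = false
  isRim (inj₂ _) = true

whirl : ℕ → RawMatroid
whirl k = record
  { size = suc k + suc k
  ; indep = λ A → isForest (wheel k) A ∨ (A ==s rimSet k) }

-- W^n for n ≥ 1 (W^0 is an unused dummy).  W^1 is the rank-one matroid on one element;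
-- for n = 2 the construction above is exactly the multigraph description of W^2 (= U_{2,4}).
W : ℕ → RawMatroid
W zero = record { size = 0 ; indep = λ _ → true }
W (suc zero) = record { size = 1 ; indep = λ _ → true }
W (suc (suc k)) = whirl (suc k)

Series : Set
Series = ℕ → Poly

_≈S_ : Series → Series → Set
f ≈S g = ∀ n → f n ≈P g n

_*S_ : Series → Series → Series
(f *S g) n = sumP (mapL (λ i → f i *P g (n ∸ i)) (upTo (suc n)))

_-S_ : Series → Series → Series
(f -S g) n = f n +P scaleP (- 1ℤ) (g n)

-- (u - 1)^2 - 4 t u^2 = 1 - 2u + (1 - 4t) u^2
discr : Series
discr zero = 1ℤ ∷ []
discr (suc zero) = (- (1ℤ +ℤ 1ℤ)) ∷ []
discr (suc (suc zero)) = 1ℤ ∷ (- (1ℤ +ℤ 1ℤ +ℤ 1ℤ +ℤ 1ℤ)) ∷ []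
discr (suc (suc (suc _))) = []

twoTu1 : Series
twoTu1 zero = (1ℤ +ℤ 1ℤ) ∷ []
twoTu1 (suc zero) = 0ℤ ∷ (1ℤ +ℤ 1ℤ) ∷ []
twoTu1 (suc (suc _)) = []

u1 : Series
u1 zero = 1ℤ ∷ []
u1 (suc zero) = 1ℤ ∷ []
u1 (suc (suc _)) = []

klGen : (RawMatroid → Poly) → Series
klGen P zero = []
klGen P (suc n) = P (W (suc n))

{-# OPTIONS --safe #-}
-- For a loopless matroid N, suppose that every flat F is given a polynomial Q F with Q = 1 at the top,
-- of degree less than half the corank of F elsewhere, such that for every flat G the sum Z_G of the
-- t^(rk F - rk G) Q F over the flats F ⊇ G is palindromic of degree the corank of G.  Then P_N = Q ∅:
-- expanding the characteristic polynomials, the right-hand side of the recurrence becomes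
-- Σ_A (-1)^|A| Z_(cl A), and reversing each Z_(cl A) leaves only the term of the empty flat.
--
-- Whirls are bicircular: a set C of edges is independent iff each subset of C is at most as large as
-- the set of rim vertices it meets (spokes counting as loops).  A flat is thus a set of spokes and rim
-- edges subject to local conditions.  Consider the balanced cyclic words of length n in the letters
-- U, D and two flat letters, which peak or dip by half a step.  A word determines a flat: the spokes
-- at the vertices where the path attains its minimum, and the rim edges carrying a peak.  Letting Q F
-- count the words of F by the letters U off the spokes, Z_G counts all words above G, and exchanging
-- the half steps entering and leaving each block of G is an involution proving palindromicity.
--
-- Hence P counts the words without peaks that dip at their minimum.  Cutting at the first such dip
-- turns them into walks on the half line.  With f = u (1 + f + t f²), their generating function K
-- satisfies (1 - t f²)(1 - u t f) K = f, while R = 1 - u - 2 u t f, and the formula follows.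

module Submission where

open import Defs
open import Algebra.Bundles using (CommutativeRing)
import Algebra.Properties.CommutativeMonoid.Sum as MonoidSum
import Algebra.Properties.CommutativeSemigroup
import Algebra.Properties.Group as GroupProperties
import Algebra.Solver.Ring.NaturalCoefficients.Default as SemiringSolver
open import Data.Bool using (Bool; true; false; _∧_; _∨_; _xor_; not; if_then_else_; T)
open import Data.Bool.Properties using (T-≡; ∨-identityʳ; ∨-zeroʳ; not-involutive; ∨-comm; ∨-assoc)
open import Data.Empty using (⊥; ⊥-elim)
open import Data.Fin using (Fin; zero; suc; toℕ; fromℕ; inject₁; splitAt; _↑ˡ_; _↑ʳ_) renaming (_≟_ to _≟F_)
open import Data.Fin.Permutation using (permutation)
open import Data.Fin.Properties using (toℕ-injective; toℕ-fromℕ<; toℕ-fromℕ; toℕ-inject₁; toℕ<n; splitAt-↑ˡ; splitAt-↑ʳ; splitAt⁻¹-↑ˡ; splitAt⁻¹-↑ʳ)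
open import Data.Fin.Relation.Unary.Top using (view; ‵fromℕ; ‵inject₁)
open import Data.Fin.Subset.Properties using (anySubset?)
open import Data.Integer using (ℤ; 0ℤ; 1ℤ; -_) renaming (_+_ to _+ℤ_; _*_ to _*ℤ_)
import Data.Integer.Properties as ℤ
open import Data.List using (List; []; _∷_; _++_; foldr; upTo; applyUpTo; allFin; filterᵇ) renaming (map to mapL; tabulate to tabulateL)
open import Data.List.Membership.Propositional using () renaming (_∈_ to _∈L_)
open import Data.List.Membership.Propositional.Properties using (∈-++⁺ˡ; ∈-++⁺ʳ; ∈-map⁺; ∈-allFin)
open import Data.List.Relation.Unary.Any using (here; there)
open import Data.Nat using (ℕ; zero; suc; _+_; _*_; _∸_; _≤_; _<_; _<ᵇ_; _≤ᵇ_; _≡ᵇ_; _⊔_; z≤n; s≤s)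
open import Data.Nat.DivMod using (_%_; m<n⇒m%n≡m; n%n≡0)
open import Data.Nat.Properties
open import Data.Product using (_×_; _,_; ∃; proj₁; proj₂)
open import Data.Sum using (_⊎_; inj₁; inj₂)
open import Data.Unit using (tt)
import Data.Vec as Vec
open import Data.Vec using ([]; _∷_; zipWith; lookup; tabulate)
open import Data.Vec.Properties using (lookup∘tabulate; tabulate∘lookup; tabulate-cong; lookup-zipWith; lookup-replicate; lookup-map; lookup-++ˡ; lookup-++ʳ)
open import Function using (_∘_; id; Equivalence)
open import Level using (0ℓ)
open import Relation.Binary.Definitions using (tri<; tri≈; tri>)
open import Relation.Binary.PropositionalEquality using (_≡_; _≢_; refl; sym; trans; cong; cong₂; subst; subst₂; module ≡-Reasoning)
import Relation.Binary.Reasoning.Setoid as SetoidReasoning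
open import Relation.Nullary using (¬_; yes; no; Dec)
open import Relation.Nullary.Decidable using (⌊_⌋; _×-dec_)

-- Contractions of a whirl need not be whirls, so the induction behind uniqueness cannot stay inside
-- the family. Giving a polynomial to every flat at once, under conditions inherited by contraction,
-- avoids describing these minors. Half steps make the involution local: the midpoints of the
-- letters outside the flat keep their heights, and only the blocks between them move. On a cycle a
-- height is defined up to a constant, hence the potentials. Differences are mostly avoided by
-- writing sums on both sides. A word without peaks that dips at its minimum, read from vertex zero,
-- is a walk from `j` to `j`, with `j` the depth of the minimum. Read from just after its first dip,
-- it climbs from 0 to `j` without restriction and then descends to the floor with no dip before the
-- end. Here `f` is the first passage to the next lower level, 1/(1 - utf) accounts for the
-- excursions at the floor that avoid dips, and 1/(1 - tf²) is the geometric sum over `j`. So K = f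
-- / ((1 - tf²)(1 - utf)). The quadratic utf² - (1 - u)f + u = 0 has discriminant (1 - u)² - 4tu²,
-- whose root with constant term 1 is R = 1 - u - 2utf.

module ΣN = MonoidSum +-0-commutativeMonoid
open ΣN using () renaming (sum to ∑)

-- Subsets of Fin m

infix 4 _∈_ _∉_ _⊆_
infixl 6 _∩_

_∈_ _∉_ : ∀ {m} → Fin m → Sub m → Set
x ∈ A = lookup A x ≡ true
x ∉ A = lookup A x ≡ false

-- A record rather than a function type, so that A and B can be inferred from a proof.
record _⊆_ {m} (A B : Sub m) : Set where
  constructor mk⊆
  field at : ∀ x → x ∈ A → x ∈ B
open _⊆_ public

_∩_ : ∀ {m} → Sub m → Sub m → Sub m
_∩_ = zipWith _∧_

T⇒≡ : ∀ {b} → T b → b ≡ true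
T⇒≡ = Equivalence.to T-≡

≡⇒T : ∀ {b} → b ≡ true → T b
≡⇒T = Equivalence.from T-≡

true≢false : ∀ {b} → b ≡ true → b ≡ false → ⊥
true≢false refl ()

bool : ∀ b → (b ≡ true) ⊎ (b ≡ false)
bool true = inj₁ refl
bool false = inj₂ refl

¬true⇒false : ∀ {b} → ¬ (b ≡ true) → b ≡ false
¬true⇒false {true} p = ⊥-elim (p refl)
¬true⇒false {false} p = refl

∧-intro : ∀ {a b} → a ≡ true → b ≡ true → a ∧ b ≡ true
∧-intro refl refl = refl

∧-elimˡ : ∀ {a b} → a ∧ b ≡ true → a ≡ true
∧-elimˡ {true} p = refl

∧-elimʳ : ∀ {a b} → a ∧ b ≡ true → b ≡ true
∧-elimʳ {true} p = p

∨-introˡ : ∀ {a b} → a ≡ true → a ∨ b ≡ true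
∨-introˡ refl = refl

∨-introʳ : ∀ a {b} → b ≡ true → a ∨ b ≡ true
∨-introʳ a refl = ∨-zeroʳ a

∨-elim : ∀ {a b} → a ∨ b ≡ true → (a ≡ true) ⊎ (b ≡ true)
∨-elim {true} p = inj₁ refl
∨-elim {false} p = inj₂ p

not-true : ∀ {b} → not b ≡ true → b ≡ false
not-true {false} _ = refl

bool-ext : ∀ {a b} → (a ≡ true → b ≡ true) → (b ≡ true → a ≡ true) → a ≡ b
bool-ext {true} {b} f g = sym (f refl)
bool-ext {false} {true} f g = g refl
bool-ext {false} {false} f g = refl

sub-ext : ∀ {m} {A B : Sub m} → (∀ x → lookup A x ≡ lookup B x) → A ≡ B
sub-ext {A = A} {B} h = trans (sym (tabulate∘lookup A)) (trans (tabulate-cong h) (tabulate∘lookup B))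

⊆-antisym : ∀ {m} {A B : Sub m} → A ⊆ B → B ⊆ A → A ≡ B
⊆-antisym p q = sub-ext λ x → bool-ext (p .at x) (q .at x)

⊆-refl : ∀ {m} {A : Sub m} → A ⊆ A
⊆-refl = mk⊆ λ _ p → p

⊆-trans : ∀ {m} {A B C : Sub m} → A ⊆ B → B ⊆ C → A ⊆ C
⊆-trans p q = mk⊆ λ x → q .at x ∘ p .at x

⊆b⇒⊆ : ∀ {m} (A B : Sub m) → A ⊆b B ≡ true → A ⊆ B
⊆b⇒⊆ A B = λ p → mk⊆ (go A B p)
  where
  go : ∀ {m} (A B : Sub m) → A ⊆b B ≡ true → ∀ x → x ∈ A → x ∈ B
  go (true ∷ A) (true ∷ B) p zero q = refl
  go (a ∷ A) (b ∷ B) p (suc x) q = go A B (∧-elimʳ {not a ∨ b} p) x q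

⊆⇒⊆b : ∀ {m} {A B : Sub m} → A ⊆ B → A ⊆b B ≡ true
⊆⇒⊆b {A = A} {B} p = go A B (p .at)
  where
  go : ∀ {m} (A B : Sub m) → (∀ x → x ∈ A → x ∈ B) → A ⊆b B ≡ true
  go [] [] p = refl
  go (true ∷ A) (b ∷ B) p rewrite p zero refl = go A B (p ∘ suc)
  go (false ∷ A) (b ∷ B) p = go A B (p ∘ suc)

==s⇒≡ : ∀ {m} {A B : Sub m} → A ==s B ≡ true → A ≡ B
==s⇒≡ {A = []} {[]} p = refl
==s⇒≡ {A = true ∷ A} {true ∷ B} p = cong (true ∷_) (==s⇒≡ p)
==s⇒≡ {A = false ∷ A} {false ∷ B} p = cong (false ∷_) (==s⇒≡ p)

==s-refl : ∀ {m} (A : Sub m) → A ==s A ≡ true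
==s-refl [] = refl
==s-refl (true ∷ A) = ==s-refl A
==s-refl (false ∷ A) = ==s-refl A

module _ {m : ℕ} where

  lookup-∪ : ∀ (A B : Sub m) x → lookup (A ∪s B) x ≡ lookup A x ∨ lookup B x
  lookup-∪ A B x = lookup-zipWith _∨_ x A B

  lookup-∩ : ∀ (A B : Sub m) x → lookup (A ∩ B) x ≡ lookup A x ∧ lookup B x
  lookup-∩ A B x = lookup-zipWith _∧_ x A B

  lookup-compl : ∀ (A : Sub m) x → lookup (compl A) x ≡ not (lookup A x)
  lookup-compl A x = lookup-map x not A

  x∉∅ : ∀ x → x ∉ ∅s {m}
  x∉∅ x = lookup-replicate x false

  x∈full : ∀ x → x ∈ fulls {m}
  x∈full x = lookup-replicate x true

  ∅⊆ : ∀ {A : Sub m} → ∅s ⊆ A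
  ∅⊆ = mk⊆ λ x p → ⊥-elim (true≢false p (x∉∅ x))

  ⊆full : ∀ {A : Sub m} → A ⊆ fulls
  ⊆full = mk⊆ λ x _ → x∈full x

  ∪-introˡ : ∀ {A B : Sub m} → A ⊆ A ∪s B
  ∪-introˡ {A} {B} = mk⊆ λ x p → trans (lookup-∪ A B x) (∨-introˡ p)

  ∪-introʳ : ∀ {A B : Sub m} → B ⊆ A ∪s B
  ∪-introʳ {A} {B} = mk⊆ λ x p → trans (lookup-∪ A B x) (∨-introʳ (lookup A x) p)

  ∪-elim : ∀ (A B : Sub m) x → x ∈ A ∪s B → (x ∈ A) ⊎ (x ∈ B)
  ∪-elim A B x p = ∨-elim (trans (sym (lookup-∪ A B x)) p)

  ∪-least : ∀ {A B C : Sub m} → A ⊆ C → B ⊆ C → A ∪s B ⊆ C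
  ∪-least {A} {B} {C} p q = mk⊆ go
    where
    go : ∀ x → x ∈ A ∪s B → x ∈ C
    go x r with ∪-elim A B x r
    ... | inj₁ s = p .at x s
    ... | inj₂ s = q .at x s

  ∪-mono : ∀ {A B C D : Sub m} → A ⊆ C → B ⊆ D → A ∪s B ⊆ C ∪s D
  ∪-mono {A} {B} {C} {D} p q = ∪-least (⊆-trans p (∪-introˡ {C} {D})) (⊆-trans q (∪-introʳ {C} {D}))

  ∩-intro : ∀ (A B : Sub m) {x} → x ∈ A → x ∈ B → x ∈ A ∩ B
  ∩-intro A B {x} p q = trans (lookup-∩ A B x) (∧-intro p q)

  ∩-⊆ˡ : ∀ {A B : Sub m} → A ∩ B ⊆ A
  ∩-⊆ˡ {A} {B} = mk⊆ λ x p → ∧-elimˡ (trans (sym (lookup-∩ A B x)) p)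

  ∩-⊆ʳ : ∀ {A B : Sub m} → A ∩ B ⊆ B
  ∩-⊆ʳ {A} {B} = mk⊆ λ x p → ∧-elimʳ {lookup A x} (trans (sym (lookup-∩ A B x)) p)

  compl-intro : ∀ (A : Sub m) {x} → x ∉ A → x ∈ compl A
  compl-intro A {x} p = trans (lookup-compl A x) (cong not p)

  compl-elim : ∀ (A : Sub m) {x} → x ∈ compl A → x ∉ A
  compl-elim A {x} p = not-true (trans (sym (lookup-compl A x)) p)

  ≟F-diag : (x : Fin m) → ⌊ x ≟F x ⌋ ≡ true
  ≟F-diag x with x ≟F x
  ... | yes _ = refl
  ... | no q = ⊥-elim (q refl)

  ≟F-true : {x y : Fin m} → ⌊ x ≟F y ⌋ ≡ true → x ≡ y
  ≟F-true {x} {y} p with x ≟F y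
  ... | yes q = q

  x∈single : (x : Fin m) → x ∈ single x
  x∈single x = trans (lookup∘tabulate _ x) (≟F-diag x)

  ∈single⇒≡ : {x y : Fin m} → y ∈ single x → x ≡ y
  ∈single⇒≡ {x} {y} p = ≟F-true (trans (sym (lookup∘tabulate _ y)) p)

  single⊆ : ∀ (A : Sub m) {x} → x ∈ A → single x ⊆ A
  single⊆ A {x} p = mk⊆ λ y q → subst (_∈ A) (∈single⇒≡ q) p

-- Cardinality

𝟙 : Bool → ℕ
𝟙 true = 1
𝟙 false = 0

∑-cong : ∀ {n} {f g : Fin n → ℕ} → (∀ i → f i ≡ g i) → ∑ f ≡ ∑ g
∑-cong = ΣN.sum-cong-≗

∑-mono : ∀ {n} {f g : Fin n → ℕ} → (∀ i → f i ≤ g i) → ∑ f ≤ ∑ g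
∑-mono {zero} h = z≤n
∑-mono {suc n} h = +-mono-≤ (h zero) (∑-mono (h ∘ suc))

∑-+ : ∀ {n} (f g : Fin n → ℕ) → ∑ (λ i → f i + g i) ≡ ∑ f + ∑ g
∑-+ = ΣN.∑-distrib-+

∑-const : ∀ n c → ∑ {n} (λ _ → c) ≡ n * c
∑-const zero c = refl
∑-const (suc n) c = cong (c +_) (∑-const n c)

∑-≤-term : ∀ {n} (f : Fin n → ℕ) i → f i ≤ ∑ f
∑-≤-term f zero = m≤m+n _ _
∑-≤-term f (suc i) = ≤-trans (∑-≤-term (f ∘ suc) i) (m≤n+m _ _)

∑-delta : ∀ {n} (j : Fin n) → ∑ (λ i → 𝟙 ⌊ j ≟F i ⌋) ≡ 1
∑-delta {suc n} zero = cong suc (trans (∑-const n 0) (*-zeroʳ n))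
∑-delta {suc n} (suc j) = trans (∑-cong lem) (∑-delta j)
  where
  lem : ∀ i → 𝟙 ⌊ suc j ≟F suc i ⌋ ≡ 𝟙 ⌊ j ≟F i ⌋
  lem i with j ≟F i
  ... | yes _ = refl
  ... | no _ = refl

card≡∑ : ∀ {m} (A : Sub m) → card A ≡ ∑ (λ x → 𝟙 (lookup A x))
card≡∑ [] = refl
card≡∑ (true ∷ A) = cong suc (card≡∑ A)
card≡∑ (false ∷ A) = card≡∑ A

𝟙-mono : ∀ {a b} → (a ≡ true → b ≡ true) → 𝟙 a ≤ 𝟙 b
𝟙-mono {true} p rewrite p refl = ≤-refl
𝟙-mono {false} p = z≤n

𝟙≤1 : ∀ b → 𝟙 b ≤ 1
𝟙≤1 true = ≤-refl
𝟙≤1 false = z≤n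

card-tabulate : ∀ {m} (f : Fin m → Bool) → card (tabulate f) ≡ ∑ (𝟙 ∘ f)
card-tabulate f = trans (card≡∑ (tabulate f)) (∑-cong λ x → cong 𝟙 (lookup∘tabulate f x))

card-mono : ∀ {m} {A B : Sub m} → A ⊆ B → card A ≤ card B
card-mono {A = A} {B} p rewrite card≡∑ A | card≡∑ B = ∑-mono λ x → 𝟙-mono (p .at x)

card≤ : ∀ {m} (A : Sub m) → card A ≤ m
card≤ [] = z≤n
card≤ (true ∷ A) = s≤s (card≤ A)
card≤ (false ∷ A) = m≤n⇒m≤1+n (card≤ A)

card-full : ∀ {m} → card (fulls {m}) ≡ m
card-full {zero} = refl
card-full {suc m} = cong suc card-full

card-∅ : ∀ {m} → card (∅s {m}) ≡ 0
card-∅ {zero} = refl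
card-∅ {suc m} = card-∅ {m}

card-∪∩ : ∀ {m} (A B : Sub m) → card (A ∪s B) + card (A ∩ B) ≡ card A + card B
card-∪∩ [] [] = refl
card-∪∩ (true ∷ A) (true ∷ B) = cong suc (trans (+-suc _ _) (trans (cong suc (card-∪∩ A B)) (sym (+-suc _ _))))
card-∪∩ (true ∷ A) (false ∷ B) = cong suc (card-∪∩ A B)
card-∪∩ (false ∷ A) (true ∷ B) = trans (cong suc (card-∪∩ A B)) (sym (+-suc _ _))
card-∪∩ (false ∷ A) (false ∷ B) = card-∪∩ A B

card-split : ∀ {m} (A B : Sub m) → card (A ∩ B) + card (A ∩ compl B) ≡ card A
card-split [] [] = refl
card-split (true ∷ A) (true ∷ B) = cong suc (card-split A B)
card-split (true ∷ A) (false ∷ B) = trans (+-suc _ _) (cong suc (card-split A B))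
card-split (false ∷ A) (b ∷ B) = card-split A B

⊆∧card⇒≡ : ∀ {m} {A B : Sub m} → A ⊆ B → card B ≤ card A → A ≡ B
⊆∧card⇒≡ {A = A} {B} p = go A B (p .at)
  where
  go : ∀ {m} (A B : Sub m) → (∀ x → x ∈ A → x ∈ B) → card B ≤ card A → A ≡ B
  go [] [] p q = refl
  go (true ∷ A) (true ∷ B) p q = cong (true ∷_) (go A B (p ∘ suc) (≤-pred q))
  go (true ∷ A) (false ∷ B) p q with () ← p zero refl
  go (false ∷ A) (true ∷ B) p q = ⊥-elim (<-irrefl refl (≤-trans q (card-mono {A = A} {B} (mk⊆ (p ∘ suc)))))
  go (false ∷ A) (false ∷ B) p q = cong (false ∷_) (go A B (p ∘ suc) q)

card-single : ∀ {m} (x : Fin m) → card (single x) ≡ 1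
card-single x = trans (card-tabulate (λ y → ⌊ x ≟F y ⌋)) (∑-delta x)

card-insert : ∀ {m} (A : Sub m) x → x ∉ A → card (A ∪s single x) ≡ suc (card A)
card-insert {m} A x p = begin
  card (A ∪s single x)                          ≡⟨ +-identityʳ _ ⟨
  card (A ∪s single x) + 0                      ≡⟨ cong (card (A ∪s single x) +_) disj ⟨
  card (A ∪s single x) + card (A ∩ single x)    ≡⟨ card-∪∩ A (single x) ⟩
  card A + card (single x)                      ≡⟨ cong (card A +_) (card-single x) ⟩
  card A + 1                                    ≡⟨ +-comm _ 1 ⟩
  suc (card A)                                  ∎
  where
  open ≡-Reasoning
  disj : card (A ∩ single x) ≡ 0
  disj = trans (cong card (⊆-antisym {A = A ∩ single x} (mk⊆ λ y q → ⊥-elim (true≢false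
    (subst (_∈ A) (sym (∈single⇒≡ (∩-⊆ʳ {A = A} {single x} .at y q))) (∩-⊆ˡ {A = A} {single x} .at y q)) p)) ∅⊆))
    (card-∅ {m})

∈allSubs : ∀ {m} (A : Sub m) → A ∈L allSubs m
∈allSubs [] = here refl
∈allSubs {suc m} (false ∷ A) = ∈-++⁺ˡ (∈-map⁺ (false ∷_) (∈allSubs A))
∈allSubs {suc m} (true ∷ A) = ∈-++⁺ʳ (mapL (false ∷_) (allSubs m)) (∈-map⁺ (true ∷_) (∈allSubs A))

allB⇒ : ∀ {A : Set} {p : A → Bool} {l} → allB p l ≡ true → ∀ {x} → x ∈L l → p x ≡ true
allB⇒ h (here refl) = ∧-elimˡ h
allB⇒ {p = p} {y ∷ l} h (there q) = allB⇒ {p = p} (∧-elimʳ {p y} h) q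

⇒allB : ∀ {A : Set} {p : A → Bool} l → (∀ x → p x ≡ true) → allB p l ≡ true
⇒allB [] h = refl
⇒allB (x ∷ l) h = ∧-intro (h x) (⇒allB l h)

-- Rank

maxCard-≥ : ∀ {m} (p : Sub m → Bool) l {B} → B ∈L l → p B ≡ true →
            card B ≤ foldr (λ B acc → if p B then card B ⊔ acc else acc) 0 l
maxCard-≥ p (B ∷ l) (here refl) h rewrite h = m≤m⊔n _ _
maxCard-≥ p (C ∷ l) (there q) h with p C
... | true = ≤-trans (maxCard-≥ p l q h) (m≤n⊔m (card C) _)
... | false = maxCard-≥ p l q h

maxCard-∃ : ∀ {m} (p : Sub m → Bool) l →
            let r = foldr (λ B acc → if p B then card B ⊔ acc else acc) 0 l in
            (r ≡ 0) ⊎ (∃ λ B → p B ≡ true × card B ≡ r)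
maxCard-∃ p [] = inj₁ refl
maxCard-∃ p (C ∷ l) with p C in eq
... | false = maxCard-∃ p l
... | true with ⊔-sel (card C) (foldr (λ B acc → if p B then card B ⊔ acc else acc) 0 l)
...   | inj₁ e = inj₂ (C , eq , sym e)
...   | inj₂ e with maxCard-∃ p l
...     | inj₁ z = inj₁ (trans e z)
...     | inj₂ (B , h , c) = inj₂ (B , h , trans c (sym e))

rank-≥ : ∀ M {A B} → B ⊆ A → indep M B ≡ true → card B ≤ rank M A
rank-≥ M {A} {B} s i = maxCard-≥ (λ B → (B ⊆b A) ∧ indep M B) (allSubs (size M)) (∈allSubs B) (∧-intro (⊆⇒⊆b s) i)

∪-assoc : ∀ {m} (A B C : Sub m) → (A ∪s B) ∪s C ≡ A ∪s (B ∪s C)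
∪-assoc [] [] [] = refl
∪-assoc (a ∷ A) (b ∷ B) (c ∷ C) = cong₂ _∷_ (∨-assoc a b c) (∪-assoc A B C)

∪-comm : ∀ {m} (A B : Sub m) → A ∪s B ≡ B ∪s A
∪-comm [] [] = refl
∪-comm (a ∷ A) (b ∷ B) = cong₂ _∷_ (∨-comm a b) (∪-comm A B)

∪-∅ʳ : ∀ {m} (A : Sub m) → A ∪s ∅s ≡ A
∪-∅ʳ [] = refl
∪-∅ʳ (a ∷ A) = cong₂ _∷_ (∨-identityʳ a) (∪-∅ʳ A)

∪-absorb : ∀ {m} {A B : Sub m} → B ⊆ A → A ∪s B ≡ A
∪-absorb {A = A} {B} p = ⊆-antisym (∪-least ⊆-refl p) (∪-introˡ {A = A} {B})

module Rank (M : RawMatroid) (isM : IsMatroid M) where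
  open IsMatroid isM

  private
    ρ = rank M
    m = size M
    Ind : Sub m → Set
    Ind A = indep M A ≡ true

  ind-∅ : Ind ∅s
  ind-∅ = T⇒≡ I1

  ind-⊆ : ∀ {A B} → A ⊆ B → Ind B → Ind A
  ind-⊆ {A} {B} p q = T⇒≡ (I2 A B (≡⇒T (⊆⇒⊆b p)) (≡⇒T q))

  ind-augment : ∀ {A B} → Ind A → Ind B → card A < card B →
                ∃ λ x → x ∈ B × x ∉ A × Ind (A ∪s single x)
  ind-augment {A} {B} p q c with I3 A B (≡⇒T p) (≡⇒T q) c
  ... | x , a , b , d = x , T⇒≡ a , not-true (T⇒≡ b) , T⇒≡ d

  basis : ∀ A → ∃ λ B → B ⊆ A × Ind B × card B ≡ ρ A
  basis A with maxCard-∃ (λ B → (B ⊆b A) ∧ indep M B) (allSubs m)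
  ... | inj₁ z = ∅s , ∅⊆ , ind-∅ , trans (card-∅ {m}) (sym z)
  ... | inj₂ (B , h , c) = B , ⊆b⇒⊆ B A (∧-elimˡ h) , ∧-elimʳ {B ⊆b A} h , c

  rank-mono : ∀ {A B} → A ⊆ B → ρ A ≤ ρ B
  rank-mono {A} {B} p with basis A
  ... | I , s , i , c = subst (_≤ ρ B) c (rank-≥ M (⊆-trans s p) i)

  rank≤card : ∀ A → ρ A ≤ card A
  rank≤card A with basis A
  ... | I , s , i , c = subst (_≤ card A) c (card-mono s)

  rank-ind : ∀ {A} → Ind A → ρ A ≡ card A
  rank-ind {A} i = ≤-antisym (rank≤card A) (rank-≥ M ⊆-refl i)

  rank-∅ : ρ ∅s ≡ 0
  rank-∅ = trans (rank-ind ind-∅) (card-∅ {m})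

  rank-∪≤ : ∀ A C → ρ (A ∪s C) ≤ ρ A + card C
  rank-∪≤ A C with basis (A ∪s C)
  ... | K , s , i , c = begin
      ρ (A ∪s C)                        ≡⟨ c ⟨
      card K                            ≡⟨ card-split K A ⟨
      card (K ∩ A) + card (K ∩ compl A) ≤⟨ +-mono-≤ (rank-≥ M (∩-⊆ʳ {A = K} {A}) (ind-⊆ (∩-⊆ˡ {A = K} {A}) i)) (card-mono sub) ⟩
      ρ A + card C                      ∎
    where
    open ≤-Reasoning
    sub : K ∩ compl A ⊆ C
    sub = mk⊆ λ x p → go x p (∪-elim A C x (s .at x (∩-⊆ˡ {A = K} {compl A} .at x p)))
      where
      go : ∀ x → x ∈ K ∩ compl A → (x ∈ A) ⊎ (x ∈ C) → x ∈ C
      go x p (inj₁ q) = ⊥-elim (true≢false q (compl-elim A (∩-⊆ʳ {A = K} {compl A} .at x p)))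
      go x p (inj₂ q) = q

  rank-augment : ∀ A B → ρ A < ρ B → ∃ λ x → x ∈ B × ρ A < ρ (A ∪s single x)
  rank-augment A B lt with basis A | basis B
  ... | I , s , i , c | J , s' , j , c' with ind-augment i j (subst₂ _<_ (sym c) (sym c') lt)
  ...   | x , x∈J , x∉I , k = x , s' .at x x∈J ,
          subst (_≤ ρ (A ∪s single x)) (trans (card-insert I x x∉I) (cong suc c))
            (rank-≥ M (∪-mono s ⊆-refl) k)

  private
    -- Basis extension by repeated augmentation; `d` bounds the number of elements still missing, so
    -- that the recursion terminates.
    extend : ∀ d I B → I ⊆ B → Ind I → ρ B ≤ d + card I → ∃ λ J → I ⊆ J × J ⊆ B × Ind J × card J ≡ ρ B
    extend zero I B s i h = I , ⊆-refl , s , i , ≤-antisym (rank-≥ M s i) h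
    extend (suc d) I B s i h with basis B
    ... | K , s' , k , c with <-cmp (card I) (card K)
    ...   | tri≈ _ e _ = I , ⊆-refl , s , i , trans e c
    ...   | tri> _ _ g = ⊥-elim (<-irrefl refl (<-≤-trans g (≤-trans (rank-≥ M s i) (≤-reflexive (sym c)))))
    ...   | tri< l _ _ with ind-augment i k l
    ...     | x , x∈K , x∉I , i' with extend d (I ∪s single x) B (∪-least s (single⊆ B (s' .at x x∈K))) i'
                                      (≤-trans h (≤-reflexive (trans (sym (+-suc d _)) (cong (d +_) (sym (card-insert I x x∉I))))))
    ...       | J , a , b , c' , e = J , ⊆-trans (∪-introˡ {A = I} {single x}) a , b , c' , e

  -- Diminishing returns. A basis `I` of `A` extends to a basis `J` of `B`. An element of
  -- `B ∪s single x` that enlarges `J` cannot lie in `B`, so it is `x`, and by heredity it enlarges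
  -- `I` as well.
  rank-insert-mono : ∀ {A B} x → A ⊆ B → ρ B < ρ (B ∪s single x) → ρ A < ρ (A ∪s single x)
  rank-insert-mono {A} {B} x s lt with basis A
  ... | I , sI , i , cI with extend (ρ B) I B (⊆-trans sI s) i (m≤m+n _ _)
  ...   | J , I⊆J , J⊆B , j , cJ with basis (B ∪s single x)
  ...     | K , sK , k , cK with ind-augment j k (subst₂ _<_ (sym cJ) (sym cK) lt)
  ...       | y , y∈K , y∉J , jy with ∪-elim B (single x) y (sK .at y y∈K)
  ...         | inj₁ y∈B = ⊥-elim (<-irrefl refl (≤-trans (≤-reflexive (trans (cong suc (sym cJ)) (sym (card-insert J y y∉J))))
                             (rank-≥ M (∪-least J⊆B (single⊆ B y∈B)) jy)))
  ...         | inj₂ y∈x = subst (λ z → ρ A < ρ (A ∪s single z)) (sym (∈single⇒≡ y∈x))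
                  (subst (_≤ ρ (A ∪s single y)) (trans (card-insert I y y∉I) (cong suc cI))
                    (rank-≥ M (∪-mono sI ⊆-refl)
                      (ind-⊆ (∪-mono I⊆J ⊆-refl) jy)))
    where
    y∉I : y ∉ I
    y∉I = ¬true⇒false λ p → true≢false (I⊆J .at y p) y∉J

  Flat : Sub m → Set
  Flat F = ∀ x → x ∉ F → ρ F < ρ (F ∪s single x)

  isFlat⇒Flat : ∀ {F} → isFlat M F ≡ true → Flat F
  isFlat⇒Flat {F} h x p with ∨-elim (allB⇒ h (∈-allFin x))
  ... | inj₁ q = ⊥-elim (true≢false q p)
  ... | inj₂ q = <ᵇ⇒< _ _ (≡⇒T q)

  Flat⇒isFlat : ∀ {F} → Flat F → isFlat M F ≡ true
  Flat⇒isFlat {F} h = ⇒allB (allFin m) lem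
    where
    lem : ∀ x → lookup F x ∨ (ρ F <ᵇ ρ (F ∪s single x)) ≡ true
    lem x with bool (lookup F x)
    ... | inj₁ p = ∨-introˡ p
    ... | inj₂ p = ∨-introʳ (lookup F x) (T⇒≡ (<⇒<ᵇ (h x p)))

  cl : Sub m → Sub m
  cl A = tabulate (λ x → ρ (A ∪s single x) ≤ᵇ ρ A)

  ∈cl⇒ : ∀ {A} x → x ∈ cl A → ρ (A ∪s single x) ≤ ρ A
  ∈cl⇒ {A} x p = ≤ᵇ⇒≤ _ _ (≡⇒T (trans (sym (lookup∘tabulate _ x)) p))

  ⇒∈cl : ∀ {A} x → ρ (A ∪s single x) ≤ ρ A → x ∈ cl A
  ⇒∈cl {A} x p = trans (lookup∘tabulate _ x) (T⇒≡ (≤⇒≤ᵇ p))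

  ⊆cl : ∀ A → A ⊆ cl A
  ⊆cl A = mk⊆ λ x p → ⇒∈cl {A} x (≤-reflexive (cong ρ (∪-absorb (single⊆ A p))))

  rank-cl : ∀ A → ρ (cl A) ≡ ρ A
  rank-cl A with ρ A <? ρ (cl A)
  ... | no q = ≤-antisym (≮⇒≥ q) (rank-mono (⊆cl A))
  ... | yes q with rank-augment A (cl A) q
  ...   | x , x∈ , lt = ⊥-elim (<-irrefl refl (<-≤-trans lt (∈cl⇒ {A} x x∈)))

  cl-flat : ∀ A → Flat (cl A)
  cl-flat A x x∉ with ρ A <? ρ (A ∪s single x)
  ... | no q = ⊥-elim (true≢false (⇒∈cl {A} x (≮⇒≥ q)) x∉)
  ... | yes q = <-≤-trans (subst (_< ρ (A ∪s single x)) (sym (rank-cl A)) q)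
                  (rank-mono (∪-mono (⊆cl A) ⊆-refl))

  cl-least : ∀ {A F} → Flat F → A ⊆ F → cl A ⊆ F
  cl-least {A} {F} fl s = mk⊆ go
    where
    go : ∀ x → x ∈ cl A → x ∈ F
    go x p with bool (lookup F x)
    ... | inj₁ q = q
    ... | inj₂ q = ⊥-elim (<-irrefl refl (<-≤-trans (rank-insert-mono x s (fl x q)) (∈cl⇒ {A} x p)))

  ∅-flat : Loopless M → Flat ∅s
  ∅-flat ll x _ = subst (_< ρ (∅s ∪s single x)) (sym rank-∅)
    (subst (_≤ ρ (∅s ∪s single x)) (card-single x) (rank-≥ M (∪-introʳ {A = ∅s} {single x}) (T⇒≡ (ll x))))

-- Sums over all subsets

infixr 7 _▸_

-- Iverson bracket. A sum over the subsets with a property becomes a sum over all subsets, so nested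
-- sums can be exchanged freely.
_▸_ : Bool → ℤ → ℤ
true ▸ z = z
false ▸ z = 0ℤ

▸-cong : ∀ b {x y} → (b ≡ true → x ≡ y) → b ▸ x ≡ b ▸ y
▸-cong true h = h refl
▸-cong false h = refl

▸-*ʳ : ∀ b c x → b ▸ (c *ℤ x) ≡ c *ℤ (b ▸ x)
▸-*ʳ true c x = refl
▸-*ʳ false c x = sym (ℤ.*-zeroʳ c)

▸-∧ : ∀ a b x → (a ∧ b) ▸ x ≡ a ▸ b ▸ x
▸-∧ true b x = refl
▸-∧ false b x = refl

▸-swap : ∀ a b x → a ▸ b ▸ x ≡ b ▸ a ▸ x
▸-swap true b x = refl
▸-swap false true x = refl
▸-swap false false x = refl

ΣS : ∀ m → (Sub m → ℤ) → ℤ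
ΣS zero f = f []
ΣS (suc m) f = ΣS m (f ∘ (false ∷_)) +ℤ ΣS m (f ∘ (true ∷_))

ΣS-cong : ∀ m {f g : Sub m → ℤ} → (∀ A → f A ≡ g A) → ΣS m f ≡ ΣS m g
ΣS-cong zero h = h []
ΣS-cong (suc m) h = cong₂ _+ℤ_ (ΣS-cong m (h ∘ (false ∷_))) (ΣS-cong m (h ∘ (true ∷_)))

ΣS-0 : ∀ m → ΣS m (λ _ → 0ℤ) ≡ 0ℤ
ΣS-0 zero = refl
ΣS-0 (suc m) = cong₂ _+ℤ_ (ΣS-0 m) (ΣS-0 m)

ℤ-interchange : ∀ a b c d → (a +ℤ b) +ℤ (c +ℤ d) ≡ (a +ℤ c) +ℤ (b +ℤ d)
ℤ-interchange = CommSemi.interchange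
  where module CommSemi = Algebra.Properties.CommutativeSemigroup ℤ.+-commutativeSemigroup

ΣS-+ : ∀ m (f g : Sub m → ℤ) → ΣS m (λ A → f A +ℤ g A) ≡ ΣS m f +ℤ ΣS m g
ΣS-+ zero f g = refl
ΣS-+ (suc m) f g = trans
  (cong₂ _+ℤ_ (ΣS-+ m (f ∘ (false ∷_)) (g ∘ (false ∷_))) (ΣS-+ m (f ∘ (true ∷_)) (g ∘ (true ∷_))))
  (ℤ-interchange (ΣS m (f ∘ (false ∷_))) (ΣS m (g ∘ (false ∷_))) (ΣS m (f ∘ (true ∷_))) (ΣS m (g ∘ (true ∷_))))

ΣS-* : ∀ m c (f : Sub m → ℤ) → ΣS m (λ A → c *ℤ f A) ≡ c *ℤ ΣS m f
ΣS-* zero c f = refl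
ΣS-* (suc m) c f = trans (cong₂ _+ℤ_ (ΣS-* m c _) (ΣS-* m c _)) (sym (ℤ.*-distribˡ-+ c _ _))

ΣS-▸ : ∀ m b (f : Sub m → ℤ) → ΣS m (λ A → b ▸ f A) ≡ b ▸ ΣS m f
ΣS-▸ m true f = refl
ΣS-▸ m false f = ΣS-0 m

ΣS-comm : ∀ m n (f : Sub m → Sub n → ℤ) → ΣS m (λ A → ΣS n (f A)) ≡ ΣS n (λ B → ΣS m (λ A → f A B))
ΣS-comm zero n f = refl
ΣS-comm (suc m) n f = trans (cong₂ _+ℤ_ (ΣS-comm m n _) (ΣS-comm m n _)) (sym (ΣS-+ n _ _))

ΣS-delta : ∀ {m} (A : Sub m) (f : Sub m → ℤ) → ΣS m (λ B → (A ==s B) ▸ f B) ≡ f A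
ΣS-delta [] f = refl
ΣS-delta {suc m} (true ∷ A) f = trans (cong₂ _+ℤ_ (ΣS-0 m) (ΣS-delta A _)) (ℤ.+-identityˡ _)
ΣS-delta {suc m} (false ∷ A) f = trans (cong₂ _+ℤ_ (ΣS-delta A _) (ΣS-0 m)) (ℤ.+-identityʳ _)

sumL : ∀ {A : Set} → (A → ℤ) → List A → ℤ
sumL f = foldr (λ x s → f x +ℤ s) 0ℤ

sumL-++ : ∀ {A : Set} (f : A → ℤ) k l → sumL f (k ++ l) ≡ sumL f k +ℤ sumL f l
sumL-++ f [] l = sym (ℤ.+-identityˡ _)
sumL-++ f (x ∷ k) l = trans (cong (f x +ℤ_) (sumL-++ f k l)) (sym (ℤ.+-assoc (f x) _ _))

sumL-map : ∀ {A B : Set} (f : B → ℤ) (g : A → B) l → sumL f (mapL g l) ≡ sumL (f ∘ g) l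
sumL-map f g [] = refl
sumL-map f g (x ∷ l) = cong (f (g x) +ℤ_) (sumL-map f g l)

sumL-filter : ∀ {A : Set} (f : A → ℤ) p l → sumL f (filterᵇ p l) ≡ sumL (λ x → p x ▸ f x) l
sumL-filter f p [] = refl
sumL-filter f p (x ∷ l) with p x
... | true = cong (f x +ℤ_) (sumL-filter f p l)
... | false = trans (sumL-filter f p l) (sym (ℤ.+-identityˡ _))

sumL-allSubs : ∀ m (f : Sub m → ℤ) → sumL f (allSubs m) ≡ ΣS m f
sumL-allSubs zero f = ℤ.+-identityʳ _
sumL-allSubs (suc m) f = trans (sumL-++ f (mapL (false ∷_) (allSubs m)) _) (cong₂ _+ℤ_ (half false) (half true))
  where
  half : ∀ b → sumL f (mapL (b ∷_) (allSubs m)) ≡ ΣS m (f ∘ (b ∷_))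
  half b = trans (sumL-map f (b ∷_) (allSubs m)) (sumL-allSubs m _)

-- Coefficients of polynomials

coeff-+P : ∀ p q i → coeff (p +P q) i ≡ coeff p i +ℤ coeff q i
coeff-+P [] q i = sym (ℤ.+-identityˡ _)
coeff-+P (a ∷ p) [] i = sym (ℤ.+-identityʳ _)
coeff-+P (a ∷ p) (b ∷ q) zero = refl
coeff-+P (a ∷ p) (b ∷ q) (suc i) = coeff-+P p q i

coeff-scaleP : ∀ c p i → coeff (scaleP c p) i ≡ c *ℤ coeff p i
coeff-scaleP c [] i = sym (ℤ.*-zeroʳ c)
coeff-scaleP c (a ∷ p) zero = refl
coeff-scaleP c (a ∷ p) (suc i) = coeff-scaleP c p i

coeff-sumP : ∀ {A : Set} (g : A → Poly) l i → coeff (sumP (mapL g l)) i ≡ sumL (λ x → coeff (g x) i) l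
coeff-sumP g [] i = refl
coeff-sumP g (x ∷ l) i = trans (coeff-+P (g x) _ i) (cong (coeff (g x) i +ℤ_) (coeff-sumP g l i))

-- Multiplication by t^k on coefficient sequences.
shift : ℕ → (ℕ → ℤ) → ℕ → ℤ
shift zero q j = q j
shift (suc k) q zero = 0ℤ
shift (suc k) q (suc j) = shift k q j

shift-cong : ∀ k {p q : ℕ → ℤ} → (∀ i → p i ≡ q i) → ∀ i → shift k p i ≡ shift k q i
shift-cong zero h i = h i
shift-cong (suc k) h zero = refl
shift-cong (suc k) h (suc i) = shift-cong k h i

coeff-*P-∷ : ∀ a p q j → coeff ((a ∷ p) *P q) j ≡ a *ℤ coeff q j +ℤ shift 1 (coeff (p *P q)) j
coeff-*P-∷ a p q zero = trans (coeff-+P (scaleP a q) _ zero) (cong (_+ℤ 0ℤ) (coeff-scaleP a q zero))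
coeff-*P-∷ a p q (suc j) = trans (coeff-+P (scaleP a q) _ (suc j)) (cong (_+ℤ _) (coeff-scaleP a q (suc j)))

shift1-+ : ∀ (p q : ℕ → ℤ) j → shift 1 (λ i → p i +ℤ q i) j ≡ shift 1 p j +ℤ shift 1 q j
shift1-+ p q zero = refl
shift1-+ p q (suc j) = refl

shift1-* : ∀ c (p : ℕ → ℤ) j → shift 1 (λ i → c *ℤ p i) j ≡ c *ℤ shift 1 p j
shift1-* c p zero = sym (ℤ.*-zeroʳ c)
shift1-* c p (suc j) = refl

*P-distribʳ : ∀ p p' q j → coeff ((p +P p') *P q) j ≡ coeff (p *P q) j +ℤ coeff (p' *P q) j
*P-distribʳ [] p' q j = sym (ℤ.+-identityˡ _)
*P-distribʳ (a ∷ p) [] q j = sym (ℤ.+-identityʳ _)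
*P-distribʳ (a ∷ p) (b ∷ p') q j = begin
  coeff (((a +ℤ b) ∷ (p +P p')) *P q) j
    ≡⟨ coeff-*P-∷ (a +ℤ b) (p +P p') q j ⟩
  (a +ℤ b) *ℤ coeff q j +ℤ shift 1 (coeff ((p +P p') *P q)) j
    ≡⟨ cong₂ _+ℤ_ (ℤ.*-distribʳ-+ (coeff q j) a b) (trans (shift-cong 1 (*P-distribʳ p p' q) j) (shift1-+ _ _ j)) ⟩
  (a *ℤ coeff q j +ℤ b *ℤ coeff q j) +ℤ (shift 1 (coeff (p *P q)) j +ℤ shift 1 (coeff (p' *P q)) j)
    ≡⟨ ℤ-interchange (a *ℤ coeff q j) (b *ℤ coeff q j) _ _ ⟩
  (a *ℤ coeff q j +ℤ shift 1 (coeff (p *P q)) j) +ℤ (b *ℤ coeff q j +ℤ shift 1 (coeff (p' *P q)) j)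
    ≡⟨ cong₂ _+ℤ_ (coeff-*P-∷ a p q j) (coeff-*P-∷ b p' q j) ⟨
  coeff ((a ∷ p) *P q) j +ℤ coeff ((b ∷ p') *P q) j ∎
  where open ≡-Reasoning

*P-scaleˡ : ∀ c p q j → coeff (scaleP c p *P q) j ≡ c *ℤ coeff (p *P q) j
*P-scaleˡ c [] q j = sym (ℤ.*-zeroʳ c)
*P-scaleˡ c (a ∷ p) q j = begin
  coeff (((c *ℤ a) ∷ scaleP c p) *P q) j
    ≡⟨ coeff-*P-∷ (c *ℤ a) (scaleP c p) q j ⟩
  (c *ℤ a) *ℤ coeff q j +ℤ shift 1 (coeff (scaleP c p *P q)) j
    ≡⟨ cong₂ _+ℤ_ (ℤ.*-assoc c a _) (trans (shift-cong 1 (*P-scaleˡ c p q) j) (shift1-* c _ j)) ⟩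
  c *ℤ (a *ℤ coeff q j) +ℤ c *ℤ shift 1 (coeff (p *P q)) j
    ≡⟨ ℤ.*-distribˡ-+ c _ _ ⟨
  c *ℤ (a *ℤ coeff q j +ℤ shift 1 (coeff (p *P q)) j)
    ≡⟨ cong (c *ℤ_) (coeff-*P-∷ a p q j) ⟨
  c *ℤ coeff ((a ∷ p) *P q) j ∎
  where open ≡-Reasoning

X^-* : ∀ k q j → coeff (X^ k *P q) j ≡ shift k (coeff q) j
X^-* zero q j = trans (coeff-*P-∷ 1ℤ [] q j) (trans (cong₂ _+ℤ_ (ℤ.*-identityˡ (coeff q j)) (lem j)) (ℤ.+-identityʳ (coeff q j)))
  where
  lem : ∀ j → shift 1 (coeff []) j ≡ 0ℤ
  lem zero = refl
  lem (suc j) = refl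
X^-* (suc k) q j = trans (coeff-*P-∷ 0ℤ (X^ k) q j)
  (trans (cong₂ _+ℤ_ (ℤ.*-zeroˡ (coeff q j)) (shift-cong 1 (X^-* k q) j)) (trans (ℤ.+-identityˡ _) (lem j)))
  where
  lem : ∀ j → shift 1 (shift k (coeff q)) j ≡ shift (suc k) (coeff q) j
  lem zero = refl
  lem (suc j) = refl

-- Characteristic polynomials enter the proof only through this signed sum of shifts; their own
-- coefficients are never computed.
charPoly-* : ∀ M q j → coeff (charPoly M *P q) j ≡
             ΣS (size M) (λ A → sgn (card A) *ℤ shift (rk M ∸ rank M A) (coeff q) j)
charPoly-* M q j = trans (go (allSubs (size M))) (sumL-allSubs (size M) _)
  where
  go : ∀ l → coeff (sumP (mapL (λ A → scaleP (sgn (card A)) (X^ (rk M ∸ rank M A))) l) *P q) j ≡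
             sumL (λ A → sgn (card A) *ℤ shift (rk M ∸ rank M A) (coeff q) j) l
  go [] = refl
  go (A ∷ l) = trans (*P-distribʳ (scaleP (sgn (card A)) (X^ (rk M ∸ rank M A))) _ q j)
    (cong₂ _+ℤ_ (trans (*P-scaleˡ (sgn (card A)) (X^ (rk M ∸ rank M A)) q j)
                       (cong (sgn (card A) *ℤ_) (X^-* (rk M ∸ rank M A) q j))) (go l))

coeff-reflect : ∀ r p j → j ≤ r → coeff (reflect r p) j ≡ coeff p (r ∸ j)
coeff-reflect r p j le = trans (go (suc r) j (s≤s le) id) refl
  where
  go : ∀ n j → j < n → (g : ℕ → ℕ) →
       coeff (mapL (λ i → coeff p (r ∸ i)) (applyUpTo g n)) j ≡ coeff p (r ∸ g j)
  go (suc n) zero (s≤s _) g = refl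
  go (suc n) (suc j) (s≤s lt) g = go n j lt (g ∘ suc)

-- Re-indexed subsets

card-expand : ∀ {m} (G : Sub m) B → card (expand G B) ≡ card B
card-expand [] [] = refl
card-expand (true ∷ G) (true ∷ B) = cong suc (card-expand G B)
card-expand (true ∷ G) (false ∷ B) = card-expand G B
card-expand (false ∷ G) B = card-expand G B

-- Brings sums over the re-indexed ground set of a restriction back to one fixed ground set, where
-- the sums belonging to different flats can be interchanged. `ΣS-contract` does the same for
-- contractions.
ΣS-expand : ∀ {m} (F : Sub m) (g : Sub m → ℤ) →
            ΣS (card F) (λ A → g (expand F A)) ≡ ΣS m (λ Y → (Y ⊆b F) ▸ g Y)
ΣS-expand [] g = refl
ΣS-expand (true ∷ F) g = cong₂ _+ℤ_ (ΣS-expand F _) (ΣS-expand F _)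
ΣS-expand {suc m} (false ∷ F) g =
  trans (ΣS-expand F (g ∘ (false ∷_))) (sym (trans (cong (S +ℤ_) (ΣS-0 m)) (ℤ.+-identityʳ S)))
  where S = ΣS m (λ Y → (Y ⊆b F) ▸ g (false ∷ Y))

ΣS-contract : ∀ {m} (F : Sub m) (g : Sub m → ℤ) →
              ΣS (card (compl F)) (λ B → g (expand (compl F) B ∪s F)) ≡ ΣS m (λ Y → (F ⊆b Y) ▸ g Y)
ΣS-contract [] g = refl
ΣS-contract {suc m} (true ∷ F) g =
  trans (ΣS-contract F (g ∘ (true ∷_))) (sym (trans (cong (_+ℤ S) (ΣS-0 m)) (ℤ.+-identityˡ S)))
  where S = ΣS m (λ Y → (F ⊆b Y) ▸ g (true ∷ Y))
ΣS-contract (false ∷ F) g = cong₂ _+ℤ_ (ΣS-contract F _) (ΣS-contract F _)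

-- Toggling the first element of `F` pairs subsets of opposite sign; only the empty `F` leaves a
-- term.
ΣS-sgn : ∀ {m} (F : Sub m) → ΣS m (λ A → (A ⊆b F) ▸ sgn (card A)) ≡ (∅s ==s F) ▸ 1ℤ
ΣS-sgn [] = refl
ΣS-sgn {suc m} (true ∷ F) = trans (cong (S +ℤ_) neg) (ℤ.+-inverseʳ S)
  where
  S = ΣS m (λ A → (A ⊆b F) ▸ sgn (card A))
  neg : ΣS m (λ A → (A ⊆b F) ▸ (- sgn (card A))) ≡ - S
  neg = trans (ΣS-cong m λ A → trans (cong ((A ⊆b F) ▸_) (sym (ℤ.-1*i≡-i (sgn (card A))))) (▸-*ʳ (A ⊆b F) (- 1ℤ) (sgn (card A))))
          (trans (ΣS-* m (- 1ℤ) (λ A → (A ⊆b F) ▸ sgn (card A))) (ℤ.-1*i≡-i S))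
ΣS-sgn {suc m} (false ∷ F) = trans (cong₂ _+ℤ_ (ΣS-sgn F) (ΣS-0 m)) (ℤ.+-identityʳ _)

emb : ∀ {m} (G : Sub m) → Fin (card G) → Fin m
emb (true ∷ G) zero = zero
emb (true ∷ G) (suc x) = suc (emb G x)
emb (false ∷ G) x = suc (emb G x)

lookup-emb : ∀ {m} (G : Sub m) B x → lookup (expand G B) (emb G x) ≡ lookup B x
lookup-emb (true ∷ G) (b ∷ B) zero = refl
lookup-emb (true ∷ G) (b ∷ B) (suc x) = lookup-emb G B x
lookup-emb (false ∷ G) B x = lookup-emb G B x

emb-∈ : ∀ {m} (G : Sub m) x → emb G x ∈ G
emb-∈ (true ∷ G) zero = refl
emb-∈ (true ∷ G) (suc x) = emb-∈ G x
emb-∈ (false ∷ G) x = emb-∈ G x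

emb-surj : ∀ {m} (G : Sub m) y → y ∈ G → ∃ λ x → emb G x ≡ y
emb-surj (true ∷ G) zero p = zero , refl
emb-surj (true ∷ G) (suc y) p with emb-surj G y p
... | x , e = suc x , cong suc e
emb-surj (false ∷ G) (suc y) p with emb-surj G y p
... | x , e = x , cong suc e

expand-⊆ : ∀ {m} (G : Sub m) B → expand G B ⊆ G
expand-⊆ G B = mk⊆ (go G B)
  where
  go : ∀ {m} (G : Sub m) B x → x ∈ expand G B → x ∈ G
  go (true ∷ G) (b ∷ B) zero p = refl
  go (true ∷ G) (b ∷ B) (suc x) p = go G B x p
  go (false ∷ G) B (suc x) p = go G B x p

expand-∪ : ∀ {m} (G : Sub m) A B → expand G (A ∪s B) ≡ expand G A ∪s expand G B
expand-∪ [] [] [] = refl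
expand-∪ (true ∷ G) (a ∷ A) (b ∷ B) = cong ((a ∨ b) ∷_) (expand-∪ G A B)
expand-∪ (false ∷ G) A B = cong (false ∷_) (expand-∪ G A B)

expand-∅ : ∀ {m} (G : Sub m) → expand G ∅s ≡ ∅s
expand-∅ [] = refl
expand-∅ (true ∷ G) = cong (false ∷_) (expand-∅ G)
expand-∅ (false ∷ G) = cong (false ∷_) (expand-∅ G)

expand-full : ∀ {m} (G : Sub m) → expand G fulls ≡ G
expand-full [] = refl
expand-full (true ∷ G) = cong (true ∷_) (expand-full G)
expand-full (false ∷ G) = cong (false ∷_) (expand-full G)

∈-expand : ∀ {m} (G : Sub m) B y → y ∈ expand G B → ∃ λ x → emb G x ≡ y × x ∈ B
∈-expand G B y p with emb-surj G y (expand-⊆ G B .at y p)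
... | x , refl = x , refl , trans (sym (lookup-emb G B x)) p

expand-mono : ∀ {m} (G : Sub m) {A B} → A ⊆ B → expand G A ⊆ expand G B
expand-mono G {A} {B} s = mk⊆ go
  where
  go : ∀ y → y ∈ expand G A → y ∈ expand G B
  go y p with ∈-expand G A y p
  ... | x , refl , q = trans (lookup-emb G B x) (s .at x q)

expand-reflects-⊆ : ∀ {m} (G : Sub m) A B → expand G A ⊆ expand G B → A ⊆ B
expand-reflects-⊆ G A B s = mk⊆ λ x p →
  trans (sym (lookup-emb G B x)) (s .at (emb G x) (trans (lookup-emb G A x) p))

expand-surj : ∀ {m} (G : Sub m) Y → Y ⊆ G → ∃ λ B → expand G B ≡ Y
expand-surj G Y s = go G Y (s .at)
  where
  go : ∀ {m} (G Y : Sub m) → (∀ x → x ∈ Y → x ∈ G) → ∃ λ B → expand G B ≡ Y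
  go [] [] s = [] , refl
  go (g ∷ G) (y ∷ Y) s with go G Y (s ∘ suc)
  go (true ∷ G) (y ∷ Y) s | B , e = y ∷ B , cong (y ∷_) e
  go (false ∷ G) (false ∷ Y) s | B , e = B , cong (false ∷_) e
  go (false ∷ G) (true ∷ Y) s | B , e with () ← s zero refl

expand-single : ∀ {m} (G : Sub m) x → expand G (single x) ≡ single (emb G x)
expand-single G x = ⊆-antisym {A = expand G (single x)} {single (emb G x)} (mk⊆ go)
  (single⊆ (expand G (single x)) (trans (lookup-emb G (single x) x) (x∈single x)))
  where
  go : ∀ y → y ∈ expand G (single x) → y ∈ single (emb G x)
  go y p with ∈-expand G (single x) y p
  ... | z , refl , q = subst (λ w → emb G z ∈ single (emb G w)) (sym (∈single⇒≡ q)) (x∈single (emb G z))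

rank-restrict : ∀ M → IsMatroid M → ∀ F A → rank (restrict M F) A ≡ rank M (expand F A)
rank-restrict M isM F A = ≤-antisym le ge
  where
  open Rank M isM
  le : rank (restrict M F) A ≤ rank M (expand F A)
  le with maxCard-∃ (λ B → (B ⊆b A) ∧ indep M (expand F B)) (allSubs (card F))
  ... | inj₁ z = subst (_≤ rank M (expand F A)) (sym z) z≤n
  ... | inj₂ (B , h , c) = subst (_≤ rank M (expand F A)) (trans (card-expand F B) c)
        (rank-≥ M (expand-mono F (⊆b⇒⊆ B A (∧-elimˡ h))) (∧-elimʳ {B ⊆b A} h))
  ge : rank M (expand F A) ≤ rank (restrict M F) A
  ge with basis (expand F A)
  ... | I , s , i , c with expand-surj F I (⊆-trans s (expand-⊆ F A))
  ...   | B , refl = subst (_≤ rank (restrict M F) A) (trans (sym (card-expand F B)) c)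
                       (rank-≥ (restrict M F) (expand-reflects-⊆ F B A s) i)

-- Contraction

module Contract (M : RawMatroid) (isM : IsMatroid M) (F : Sub (size M)) where
  open Rank M isM

  private
    ρ = rank M
    C = contract M F
    G = compl F

  infix 25 _⁺
  -- Identifies the subsets of the contraction's ground set with the supersets of `F`. Rank and
  -- flats of the contraction are read off in `M` along this map.
  _⁺ : Sub (card G) → Sub (size M)
  B ⁺ = expand G B ∪s F

  indC⇒ : ∀ {B} → indep C B ≡ true → ρ (B ⁺) ≡ card B + ρ F
  indC⇒ h = ≡ᵇ⇒≡ _ _ (≡⇒T h)

  ⇒indC : ∀ {B} → ρ (B ⁺) ≡ card B + ρ F → indep C B ≡ true
  ⇒indC h = T⇒≡ (≡⇒≡ᵇ _ _ h)

  F⊆⁺ : ∀ B → F ⊆ B ⁺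
  F⊆⁺ B = ∪-introʳ {A = expand G B} {F}

  ⁺-mono : ∀ {A B} → A ⊆ B → A ⁺ ⊆ B ⁺
  ⁺-mono s = ∪-mono (expand-mono G s) ⊆-refl

  ⁺-∪ : ∀ A B → (A ∪s B) ⁺ ≡ A ⁺ ∪s expand G B
  ⁺-∪ A B = trans (cong (_∪s F) (expand-∪ G A B)) (trans (∪-assoc (expand G A) (expand G B) F)
    (trans (cong (expand G A ∪s_) (∪-comm (expand G B) F)) (sym (∪-assoc (expand G A) F (expand G B)))))

  ⁺-insert : ∀ A x → (A ∪s single x) ⁺ ≡ A ⁺ ∪s single (emb G x)
  ⁺-insert A x = trans (⁺-∪ A (single x)) (cong (A ⁺ ∪s_) (expand-single G x))

  ∅⁺ : ∅s ⁺ ≡ F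
  ∅⁺ = trans (cong (_∪s F) (expand-∅ G)) (trans (∪-comm ∅s F) (∪-∅ʳ F))

  full⁺ : fulls ⁺ ≡ fulls
  full⁺ = ⊆-antisym ⊆full (mk⊆ go)
    where
    go : ∀ x → x ∈ fulls → x ∈ fulls ⁺
    go x _ with bool (lookup F x)
    ... | inj₁ p = F⊆⁺ fulls .at x p
    ... | inj₂ p = ∪-introˡ {A = expand G fulls} {F} .at x (subst (x ∈_) (sym (expand-full G)) (compl-intro F p))

  lookup-⁺-emb : ∀ B x → lookup (B ⁺) (emb G x) ≡ lookup B x
  lookup-⁺-emb B x = trans (lookup-∪ (expand G B) F (emb G x))
    (trans (cong₂ _∨_ (lookup-emb G B x) (compl-elim F (emb-∈ G x))) (∨-identityʳ _))

  ∉⁺⇒emb : ∀ B y → y ∉ B ⁺ → ∃ λ x → emb G x ≡ y × x ∉ B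
  ∉⁺⇒emb B y p with emb-surj G y (compl-intro F (¬true⇒false λ q → true≢false (F⊆⁺ B .at y q) p))
  ... | x , refl = x , refl , trans (sym (lookup-⁺-emb B x)) p

  ⁺-reflects-⊆ : ∀ A B → A ⁺ ⊆ B ⁺ → A ⊆ B
  ⁺-reflects-⊆ A B s = mk⊆ λ x p → trans (sym (lookup-⁺-emb B x)) (s .at (emb G x) (trans (lookup-⁺-emb A x) p))

  ρ⁺≤ : ∀ B → ρ (B ⁺) ≤ card B + ρ F
  ρ⁺≤ B = begin
    ρ (B ⁺)                    ≡⟨ cong ρ (∪-comm (expand G B) F) ⟩
    ρ (F ∪s expand G B)        ≤⟨ rank-∪≤ F (expand G B) ⟩
    ρ F + card (expand G B)    ≡⟨ cong (ρ F +_) (card-expand G B) ⟩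
    ρ F + card B               ≡⟨ +-comm (ρ F) _ ⟩
    card B + ρ F               ∎
    where open ≤-Reasoning

  -- Compares `A` with a set `Y` of larger rank that need not come from an independent set; this
  -- serves the exchange axiom and the computation of the rank alike.
  indC-augment : ∀ A Y → indep C A ≡ true → ρ (A ⁺) < ρ Y →
                 ∃ λ x → emb G x ∈ Y × x ∉ A × indep C (A ∪s single x) ≡ true
  indC-augment A Y iA lt with rank-augment (A ⁺) Y lt
  ... | y , y∈Y , lt' with ∉⁺⇒emb A y (¬true⇒false λ q →
                              <-irrefl (cong ρ (sym (∪-absorb (single⊆ (A ⁺) q)))) lt')
  ...   | x , refl , x∉A = x , y∈Y , x∉A , ⇒indC {A ∪s single x} (≤-antisym (ρ⁺≤ (A ∪s single x)) (begin
          card (A ∪s single x) + ρ F       ≡⟨ cong (_+ ρ F) (card-insert A x x∉A) ⟩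
          suc (card A + ρ F)               ≡⟨ cong suc (indC⇒ {A} iA) ⟨
          suc (ρ (A ⁺))                    ≤⟨ lt' ⟩
          ρ (A ⁺ ∪s single (emb G x))      ≡⟨ cong ρ (⁺-insert A x) ⟨
          ρ ((A ∪s single x) ⁺)            ∎))
    where open ≤-Reasoning

  isMatroid : IsMatroid C
  isMatroid = record { I1 = ≡⇒T i1 ; I2 = λ A B s i → ≡⇒T (i2 A B (⊆b⇒⊆ A B (T⇒≡ s)) (T⇒≡ i)) ; I3 = λ A B a b c → i3 A B (T⇒≡ a) (T⇒≡ b) c }
    where
    i1 : indep C ∅s ≡ true
    i1 = ⇒indC {∅s} (trans (cong ρ ∅⁺) (cong (_+ ρ F) (sym (card-∅ {card G}))))
    -- Passing from `A ⁺` to `B ⁺` adds `card (B ∩ compl A)` elements and at most that much rank, so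
    -- a deficit at `A` would persist at `B`.
    i2 : ∀ A B → A ⊆ B → indep C B ≡ true → indep C A ≡ true
    i2 A B s iB = ⇒indC {A} (≤-antisym (ρ⁺≤ A) (+-cancelʳ-≤ (card (B ∩ compl A)) _ _ (begin
      card A + ρ F + card (B ∩ compl A)      ≡⟨ +-assoc (card A) _ _ ⟩
      card A + (ρ F + card (B ∩ compl A))    ≡⟨ cong (card A +_) (+-comm (ρ F) _) ⟩
      card A + (card (B ∩ compl A) + ρ F)    ≡⟨ +-assoc (card A) _ _ ⟨
      card A + card (B ∩ compl A) + ρ F      ≡⟨ cong (λ X → card X + card (B ∩ compl A) + ρ F) BA ⟨
      card (B ∩ A) + card (B ∩ compl A) + ρ F ≡⟨ cong (_+ ρ F) (card-split B A) ⟩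
      card B + ρ F                           ≡⟨ indC⇒ {B} iB ⟨
      ρ (B ⁺)                                ≤⟨ rank-mono (⊆-trans (⁺-mono B⊆)
          (subst (_⊆ (A ⁺ ∪s expand G (B ∩ compl A))) (sym (⁺-∪ A (B ∩ compl A))) ⊆-refl)) ⟩
      ρ (A ⁺ ∪s expand G (B ∩ compl A))      ≤⟨ rank-∪≤ (A ⁺) _ ⟩
      ρ (A ⁺) + card (expand G (B ∩ compl A)) ≡⟨ cong (ρ (A ⁺) +_) (card-expand G _) ⟩
      ρ (A ⁺) + card (B ∩ compl A)           ∎)))
      where
      open ≤-Reasoning
      BA : B ∩ A ≡ A
      BA = ⊆-antisym (∩-⊆ʳ {A = B}) (mk⊆ λ x p → ∩-intro B A (s .at x p) p)
      B⊆ : B ⊆ A ∪s (B ∩ compl A)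
      B⊆ = mk⊆ go
        where
        go : ∀ x → x ∈ B → x ∈ A ∪s (B ∩ compl A)
        go x p with bool (lookup A x)
        ... | inj₁ q = ∪-introˡ {A = A} {B ∩ compl A} .at x q
        ... | inj₂ q = ∪-introʳ {A = A} {B ∩ compl A} .at x (∩-intro B (compl A) p (compl-intro A q))
    i3 : ∀ A B → indep C A ≡ true → indep C B ≡ true → card A < card B →
         ∃ λ x → T (lookup B x) × T (not (lookup A x)) × T (indep C (A ∪s single x))
    i3 A B iA iB lt with indC-augment A (B ⁺) iA (subst₂ _<_ (sym (indC⇒ {A} iA)) (sym (indC⇒ {B} iB)) (+-monoˡ-< (ρ F) lt))
    ... | x , p , q , i = x , ≡⇒T (trans (sym (lookup-⁺-emb B x)) p) , ≡⇒T (cong not q) , ≡⇒T i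

  -- A maximal independent `I` inside `B` already attains the rank of `B ⁺`, since otherwise
  -- `indC-augment` would enlarge it within `B`.
  rankC : ∀ B → rank C B + ρ F ≡ ρ (B ⁺)
  rankC B with Rank.basis C isMatroid B
  ... | I , s , i , c with ρ (I ⁺) <? ρ (B ⁺)
  ...   | no q = trans (cong (_+ ρ F) (sym c)) (trans (sym (indC⇒ {I} i)) (≤-antisym (rank-mono (⁺-mono s)) (≮⇒≥ q)))
  ...   | yes q with indC-augment I (B ⁺) i q
  ...     | x , p , x∉I , i' = ⊥-elim (<-irrefl c (≤-trans (≤-reflexive (sym (card-insert I x x∉I)))
              (rank-≥ C (∪-least s (single⊆ B (trans (sym (lookup-⁺-emb B x)) p))) i')))

  rkC : rk C + ρ F ≡ rk M
  rkC = trans (rankC fulls) (cong ρ full⁺)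

  loopless : Flat F → Loopless C
  loopless fl x = ≡⇒T (⇒indC {single x} (≤-antisym (ρ⁺≤ (single x)) (begin
    card (single x) + ρ F    ≡⟨ cong (_+ ρ F) (card-single x) ⟩
    suc (ρ F)                ≤⟨ fl (emb G x) (compl-elim F (emb-∈ G x)) ⟩
    ρ (F ∪s single (emb G x)) ≡⟨ cong ρ (trans (∪-comm F _) (cong (_∪s F) (sym (expand-single G x)))) ⟩
    ρ (single x ⁺)           ∎)))
    where open ≤-Reasoning

  rankC-< : ∀ A B → ρ (A ⁺) < ρ (B ⁺) → rank C A < rank C B
  rankC-< A B lt = +-cancelʳ-< (ρ F) _ _ (subst₂ _<_ (sym (rankC A)) (sym (rankC B)) lt)

  <-rankC : ∀ A B → rank C A < rank C B → ρ (A ⁺) < ρ (B ⁺)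
  <-rankC A B lt = subst₂ _<_ (rankC A) (rankC B) (+-monoˡ-< (ρ F) lt)

  isFlatC : ∀ B → isFlat C B ≡ isFlat M (B ⁺)
  isFlatC B = bool-ext to from
    where
    to : isFlat C B ≡ true → isFlat M (B ⁺) ≡ true
    to h = Flat⇒isFlat λ y p → go y (∉⁺⇒emb B y p)
      where
      go : ∀ y → (∃ λ x → emb G x ≡ y × x ∉ B) → ρ (B ⁺) < ρ (B ⁺ ∪s single y)
      go y (x , refl , q) = subst (λ X → ρ (B ⁺) < ρ X) (⁺-insert B x)
        (<-rankC B (B ∪s single x) (Rank.isFlat⇒Flat C isMatroid {B} h x q))
    from : isFlat M (B ⁺) ≡ true → isFlat C B ≡ true
    from h = Rank.Flat⇒isFlat C isMatroid {B} λ x p → rankC-< B (B ∪s single x)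
      (subst (λ X → ρ (B ⁺) < ρ X) (sym (⁺-insert B x)) (isFlat⇒Flat h (emb G x) (trans (lookup-⁺-emb B x) p)))

  ⊆b-⁺ : ∀ A B → A ⊆b B ≡ (A ⁺) ⊆b (B ⁺)
  ⊆b-⁺ A B = bool-ext (λ h → ⊆⇒⊆b (⁺-mono (⊆b⇒⊆ A B h))) (λ h → ⊆⇒⊆b (⁺-reflects-⊆ A B (⊆b⇒⊆ (A ⁺) (B ⁺) h)))

-- Recognising a Kazhdan–Lusztig polynomial by palindromic Z-polynomials

-- The coefficients of t^d q(1/t). The guard matters: beyond `d`, truncated subtraction would return
-- `q 0`.
reverse : ℕ → (ℕ → ℤ) → ℕ → ℤ
reverse d q i = (i ≤ᵇ d) ▸ q (d ∸ i)

reverse-≤ : ∀ {d i} q → i ≤ d → reverse d q i ≡ q (d ∸ i)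
reverse-≤ {d} {i} q le rewrite T⇒≡ (≤⇒≤ᵇ le) = refl

reverse-> : ∀ {d i} q → d < i → reverse d q i ≡ 0ℤ
reverse-> {d} {i} q lt rewrite ¬true⇒false {i ≤ᵇ d} (λ h → <⇒≱ lt (≤ᵇ⇒≤ i d (≡⇒T h))) = refl

shift-+ : ∀ k q i → shift k q (k + i) ≡ q i
shift-+ zero q i = refl
shift-+ (suc k) q i = shift-+ k q i

shift-< : ∀ k q i → i < k → shift k q i ≡ 0ℤ
shift-< (suc k) q zero lt = refl
shift-< (suc k) q (suc i) (s≤s lt) = shift-< k q i lt

-- Reversal absorbs a power of t. In `charSum` this removes the rank of the lower set `A` from the
-- inner sum.
reverse-shift : ∀ k d q j → reverse (k + d) (shift k q) j ≡ reverse d q j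
reverse-shift k d q j with j ≤? d
... | yes le = trans (reverse-≤ (shift k q) (m≤n⇒m≤o+n k le))
        (trans (cong (shift k q) (+-∸-assoc k le)) (trans (shift-+ k q (d ∸ j)) (sym (reverse-≤ q le))))
... | no gt with j ≤? k + d
...   | no gt' = trans (reverse-> (shift k q) (≰⇒> gt')) (sym (reverse-> q (≰⇒> gt)))
...   | yes le = trans (reverse-≤ (shift k q) le) (trans (shift-< k q (k + d ∸ j)
          (+-cancelʳ-< j _ _ (subst (_< k + j) (sym (m∸n+n≡m le)) (+-monoʳ-< k (≰⇒> gt))))) (sym (reverse-> q (≰⇒> gt))))

Zcoeff : (N : RawMatroid) → (Sub (size N) → ℕ → ℤ) → Sub (size N) → ℕ → ℤ
Zcoeff N Q G i = ΣS (size N) λ F → (isFlat N F ∧ (G ⊆b F)) ▸ shift (rank N F ∸ rank N G) (Q F) i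

-- Q F plays the role of the coefficients of the Kazhdan–Lusztig polynomial of the contraction
-- at F, and Zcoeff N Q G is the Z-polynomial of the contraction at G.
record Palindromic (N : RawMatroid) (Q : Sub (size N) → ℕ → ℤ) : Set where
  field
    matroid  : IsMatroid N
    noLoops  : Loopless N
    top      : ∀ F → isFlat N F ≡ true → rank N F ≡ rk N → ∀ i → Q F i ≡ coeff (1ℤ ∷ []) i
    lowDeg   : ∀ F → isFlat N F ≡ true → rank N F < rk N → ∀ i → rk N ≤ rank N F + 2 * i → Q F i ≡ 0ℤ
    symm     : ∀ G → isFlat N G ≡ true → ∀ i → Zcoeff N Q G i ≡ reverse (rk N ∸ rank N G) (Zcoeff N Q G) i

-- The flats of the contraction at `F` are the flats of `N` above `F`, with all ranks lowered by
-- `rank N F`. Every condition involves only differences of ranks, so it is inherited.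
contract-palindromic : ∀ N Q → Palindromic N Q → ∀ F → isFlat N F ≡ true →
                       Palindromic (contract N F) (λ B → Q (expand (compl F) B ∪s F))
contract-palindromic N Q pal F flat = record
  { matroid = isMatroid
  ; noLoops = loopless (isFlat⇒Flat flat)
  ; top     = λ B fl e → P.top (B ⁺) (trans (sym (isFlatC B)) fl)
                (trans (sym (rankC B)) (trans (cong (_+ rank N F) e) rkC))
  ; lowDeg  = λ B fl lt i le → P.lowDeg (B ⁺) (trans (sym (isFlatC B)) fl)
                (subst₂ _<_ (rankC B) rkC (+-monoˡ-< (rank N F) lt)) i (subst₂ _≤_ rkC (shuffle B i) (+-monoˡ-≤ (rank N F) le))
  ; symm    = λ B fl i → trans (Zc B i) (trans (P.symm (B ⁺) (trans (sym (isFlatC B)) fl) i)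
                (cong₂ (λ d (z : ℤ) → (i ≤ᵇ d) ▸ z) (sym (codim B))
                  (trans (cong (Zcoeff N Q (B ⁺)) (cong (_∸ i) (sym (codim B)))) (sym (Zc B _)))))
  }
  where
  module P = Palindromic pal
  open Contract N P.matroid F
  open Rank N P.matroid
  C = contract N F
  shuffle : ∀ B i → rank C B + 2 * i + rank N F ≡ rank N (B ⁺) + 2 * i
  shuffle B i = trans (+-assoc (rank C B) (2 * i) (rank N F)) (trans (cong (rank C B +_) (+-comm (2 * i) (rank N F)))
    (trans (sym (+-assoc (rank C B) (rank N F) (2 * i))) (cong (_+ 2 * i) (rankC B))))
  diff : ∀ A B → rank C A ∸ rank C B ≡ rank N (A ⁺) ∸ rank N (B ⁺)
  diff A B = trans (sym ([m+n]∸[m+o]≡n∸o (rank N F) (rank C A) (rank C B)))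
    (cong₂ _∸_ (trans (+-comm (rank N F) (rank C A)) (rankC A)) (trans (+-comm (rank N F) (rank C B)) (rankC B)))
  codim : ∀ B → rk C ∸ rank C B ≡ rk N ∸ rank N (B ⁺)
  codim B = trans (diff fulls B) (cong (λ X → rank N X ∸ rank N (B ⁺)) full⁺)
  Zc : ∀ B i → Zcoeff C (λ B → Q (B ⁺)) B i ≡ Zcoeff N Q (B ⁺) i
  Zc B i = begin
    ΣS (card (compl F)) (λ A → (isFlat C A ∧ (B ⊆b A)) ▸ shift (rank C A ∸ rank C B) (Q (A ⁺)) i)
      ≡⟨ ΣS-cong (card (compl F)) (λ A → cong₂ _▸_ (cong₂ _∧_ (isFlatC A) (⊆b-⁺ B A)) (cong (λ k → shift k (Q (A ⁺)) i) (diff A B))) ⟩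
    ΣS (card (compl F)) (λ A → h (A ⁺))
      ≡⟨ ΣS-contract F h ⟩
    ΣS (size N) (λ Y → (F ⊆b Y) ▸ h Y)
      ≡⟨ ΣS-cong (size N) absorb ⟩
    ΣS (size N) h ∎
    where
    open ≡-Reasoning
    h : Sub (size N) → ℤ
    h Y = (isFlat N Y ∧ ((B ⁺) ⊆b Y)) ▸ shift (rank N Y ∸ rank N (B ⁺)) (Q Y) i
    -- Everything above `B ⁺` contains `F`, so the extra bracket from `ΣS-contract` is redundant
    -- here.
    absorb : ∀ Y → (F ⊆b Y) ▸ h Y ≡ h Y
    absorb Y with bool (isFlat N Y ∧ ((B ⁺) ⊆b Y))
    ... | inj₁ e rewrite ⊆⇒⊆b (⊆-trans (F⊆⁺ B) (⊆b⇒⊆ (B ⁺) Y (∧-elimʳ {isFlat N Y} e))) = refl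
    ... | inj₂ e rewrite e with F ⊆b Y
    ...   | true = refl
    ...   | false = refl

module _ (N : RawMatroid) (Q : Sub (size N) → ℕ → ℤ) (pal : Palindromic N Q) where
  open Palindromic pal
  open Rank N matroid

  private
    m = size N
    r = rk N
    ρ = rank N

  -- Zcoeff A depends on the closure of A only, so palindromicity at flats suffices; after
  -- reversing, the inner sum no longer sees A and the alternating sum over A ⊆ F kills F ≠ ∅.
  charSum : ∀ j → ΣS m (λ F → isFlat N F ▸ ΣS m (λ A → (A ⊆b F) ▸ (sgn (card A) *ℤ shift (ρ F ∸ ρ A) (Q F) j)))
                ≡ reverse r (Q ∅s) j
  charSum j = begin
    ΣS m (λ F → isFlat N F ▸ ΣS m (λ A → (A ⊆b F) ▸ (sgn (card A) *ℤ shift (ρ F ∸ ρ A) (Q F) j)))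
      ≡⟨ ΣS-cong m (λ F → sym (ΣS-▸ m (isFlat N F) _)) ⟩
    ΣS m (λ F → ΣS m (λ A → isFlat N F ▸ (A ⊆b F) ▸ (sgn (card A) *ℤ shift (ρ F ∸ ρ A) (Q F) j)))
      ≡⟨ ΣS-comm m m _ ⟩
    ΣS m (λ A → ΣS m (λ F → isFlat N F ▸ (A ⊆b F) ▸ (sgn (card A) *ℤ shift (ρ F ∸ ρ A) (Q F) j)))
      ≡⟨ ΣS-cong m (λ A → trans (ΣS-cong m (λ F → trans (sym (▸-∧ (isFlat N F) (A ⊆b F) _))
          (▸-*ʳ (isFlat N F ∧ (A ⊆b F)) (sgn (card A)) _))) (ΣS-* m (sgn (card A)) _)) ⟩
    ΣS m (λ A → sgn (card A) *ℤ Zcoeff N Q A j)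
      ≡⟨ ΣS-cong m (λ A → cong (sgn (card A) *ℤ_) (reversed A)) ⟩
    ΣS m (λ A → sgn (card A) *ℤ ΣS m (λ F → (isFlat N F ∧ (A ⊆b F)) ▸ reverse (r ∸ ρ F) (Q F) j))
      ≡⟨ ΣS-cong m (λ A → trans (sym (ΣS-* m (sgn (card A)) _)) (ΣS-cong m (λ F → trans (sym (▸-*ʳ (isFlat N F ∧ (A ⊆b F)) (sgn (card A)) _))
           (trans (▸-∧ (isFlat N F) (A ⊆b F) _) (cong (isFlat N F ▸_) (trans
               (cong ((A ⊆b F) ▸_) (ℤ.*-comm (sgn (card A)) (reverse (r ∸ ρ F) (Q F) j)))
               (▸-*ʳ (A ⊆b F) (reverse (r ∸ ρ F) (Q F) j) (sgn (card A))))))))) ⟩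
    ΣS m (λ A → ΣS m (λ F → isFlat N F ▸ (reverse (r ∸ ρ F) (Q F) j *ℤ ((A ⊆b F) ▸ sgn (card A)))))
      ≡⟨ ΣS-comm m m _ ⟩
    ΣS m (λ F → ΣS m (λ A → isFlat N F ▸ (reverse (r ∸ ρ F) (Q F) j *ℤ ((A ⊆b F) ▸ sgn (card A)))))
      ≡⟨ ΣS-cong m (λ F → trans (ΣS-▸ m (isFlat N F) _) (cong (isFlat N F ▸_) (ΣS-* m (reverse (r ∸ ρ F) (Q F) j) _))) ⟩
    ΣS m (λ F → isFlat N F ▸ (reverse (r ∸ ρ F) (Q F) j *ℤ ΣS m (λ A → (A ⊆b F) ▸ sgn (card A))))
      ≡⟨ ΣS-cong m (λ F → trans (cong (λ z → isFlat N F ▸ (reverse (r ∸ ρ F) (Q F) j *ℤ z)) (ΣS-sgn F)) (collapse F)) ⟩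
    ΣS m (λ F → (∅s ==s F) ▸ (isFlat N F ▸ reverse (r ∸ ρ F) (Q F) j))
      ≡⟨ ΣS-delta ∅s (λ F → isFlat N F ▸ reverse (r ∸ ρ F) (Q F) j) ⟩
    isFlat N ∅s ▸ reverse (r ∸ ρ ∅s) (Q ∅s) j
      ≡⟨ cong₂ (λ b d → b ▸ reverse d (Q ∅s) j) (Flat⇒isFlat (∅-flat noLoops)) (cong (r ∸_) rank-∅) ⟩
    reverse r (Q ∅s) j ∎
    where
    open ≡-Reasoning
    collapse : ∀ F → isFlat N F ▸ (reverse (r ∸ ρ F) (Q F) j *ℤ ((∅s ==s F) ▸ 1ℤ)) ≡ (∅s ==s F) ▸ (isFlat N F ▸ reverse (r ∸ ρ F) (Q F) j)
    collapse F with ∅s ==s F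
    ... | true = cong (isFlat N F ▸_) (ℤ.*-identityʳ (reverse (r ∸ ρ F) (Q F) j))
    ... | false with isFlat N F
    ...   | true = ℤ.*-zeroʳ (reverse (r ∸ ρ F) (Q F) j)
    ...   | false = refl
    Z-cl : ∀ A i → Zcoeff N Q A i ≡ Zcoeff N Q (cl A) i
    Z-cl A i = ΣS-cong m λ F → cong₂ _▸_ (cases F) (cong (λ k → shift (ρ F ∸ k) (Q F) i) (sym (rank-cl A)))
      where
      cases : ∀ F → isFlat N F ∧ (A ⊆b F) ≡ isFlat N F ∧ (cl A ⊆b F)
      cases F with bool (isFlat N F)
      ... | inj₁ fl = cong (isFlat N F ∧_) (bool-ext
              (λ h → ⊆⇒⊆b (cl-least (isFlat⇒Flat fl) (⊆b⇒⊆ A F h)))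
              (λ h → ⊆⇒⊆b (⊆-trans (⊆cl A) (⊆b⇒⊆ (cl A) F h))))
      ... | inj₂ fl rewrite fl = refl
    reversed : ∀ A → Zcoeff N Q A j ≡ ΣS m (λ F → (isFlat N F ∧ (A ⊆b F)) ▸ reverse (r ∸ ρ F) (Q F) j)
    reversed A = trans (Z-cl A j) (trans (symm (cl A) (Flat⇒isFlat (cl-flat A)) j)
      (trans (cong₂ (λ d z → (j ≤ᵇ d) ▸ z) (cong (r ∸_) (rank-cl A))
         (trans (sym (Z-cl A (r ∸ ρ (cl A) ∸ j))) (cong (λ d → Zcoeff N Q A (r ∸ d ∸ j)) (rank-cl A))))
       (trans (sym (ΣS-▸ m (j ≤ᵇ (r ∸ ρ A)) _)) (ΣS-cong m λ F → trans (▸-swap (j ≤ᵇ (r ∸ ρ A)) (isFlat N F ∧ (A ⊆b F)) _)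
         (▸-cong (isFlat N F ∧ (A ⊆b F)) λ h → term F (⊆b⇒⊆ A F (∧-elimʳ {isFlat N F} h)))))))
      where
      term : ∀ F → A ⊆ F → reverse (r ∸ ρ A) (shift (ρ F ∸ ρ A) (Q F)) j ≡ reverse (r ∸ ρ F) (Q F) j
      term F s = trans (cong (λ d → reverse d (shift (ρ F ∸ ρ A) (Q F)) j) split) (reverse-shift (ρ F ∸ ρ A) (r ∸ ρ F) (Q F) j)
        where
        ρF≤r : ρ F ≤ r
        ρF≤r = rank-mono ⊆full
        split : r ∸ ρ A ≡ (ρ F ∸ ρ A) + (r ∸ ρ F)
        split = trans (cong (_∸ ρ A) (trans (sym (m∸n+n≡m ρF≤r)) (+-comm (r ∸ ρ F) (ρ F)))) (+-∸-comm (r ∸ ρ F) (rank-mono s))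

module KL (P : RawMatroid → Poly) (isKL : IsKL P) where
  open IsKL isKL

  private
    -- Induction on the rank r, bounded by `d`. For 2i < r the coefficient of t^i equals that of
    -- t^(r - i) in the reflected polynomial, which the recurrence expresses through contractions at
    -- flats. At or above r/2 both coefficients vanish.
    go : ∀ d N Q → Palindromic N Q → rk N ≤ d → ∀ i → coeff (P N) i ≡ Q ∅s i

    -- A nonempty flat of a loopless matroid has positive rank, so the contraction falls under the
    -- induction hypothesis.
    contracted : ∀ d N Q (pal : Palindromic N Q) F → isFlat N F ≡ true → F ≢ ∅s → rk N ≤ suc d →
                 ∀ i → coeff (P (contract N F)) i ≡ Q F i
    contracted d N Q pal F fl ne le i = trans
      (go d (contract N F) _ (contract-palindromic N Q pal F fl) small i)
      (cong (λ X → Q X i) ∅⁺)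
      where
      open Palindromic pal
      open Contract N matroid F
      open Rank N matroid
      positive : 0 < rank N F
      positive with rank N F in eq
      ... | suc _ = s≤s z≤n
      ... | zero = ⊥-elim (ne (⊆-antisym (mk⊆ λ x p → ⊥-elim (<-irrefl refl (≤-trans
                     (subst (_≤ rank N F) (card-single x) (rank-≥ N (single⊆ F p) (T⇒≡ (noLoops x)))) (≤-reflexive eq)))) ∅⊆))
      small : rk (contract N F) ≤ d
      small = ≤-pred (≤-trans (subst (suc (rk (contract N F)) ≤_) rkC
        (subst (_≤ rk (contract N F) + rank N F) (+-comm (rk (contract N F)) 1) (+-monoʳ-≤ (rk (contract N F)) positive))) le)

    go d N Q pal le i with rk N in eq
    ... | zero = trans (rank-zero N matroid noLoops eq i)
            (sym (top ∅s (Flat⇒isFlat (∅-flat noLoops)) (trans rank-∅ (sym eq)) i))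
      where
      open Palindromic pal
      open Rank N matroid
    go (suc d) N Q pal (s≤s le) i | suc r' with rk N ≤? 2 * i
    ... | yes big = trans (degree N matroid noLoops (subst (0 <_) (sym eq) (s≤s z≤n)) i big)
            (sym (lowDeg ∅s (Flat⇒isFlat (∅-flat noLoops)) (subst₂ _<_ (sym rank-∅) (sym eq) (s≤s z≤n)) i
              (subst (λ z → rk N ≤ z + 2 * i) (sym rank-∅) big)))
      where
      open Palindromic pal
      open Rank N matroid
    ... | no small = begin
          coeff (P N) i
            ≡⟨ cong (coeff (P N)) (m∸[m∸n]≡n i≤r) ⟨
          coeff (P N) (rk N ∸ j)
            ≡⟨ coeff-reflect (rk N) (P N) j (m∸n≤m (rk N) i) ⟨
          coeff (reflect (rk N) (P N)) j
            ≡⟨ recurrence N matroid noLoops j ⟩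
          coeff (sumP (mapL (λ F → charPoly (restrict N F) *P P (contract N F)) (flats N))) j
            ≡⟨ coeff-sumP (λ F → charPoly (restrict N F) *P P (contract N F)) (flats N) j ⟩
          sumL (λ F → coeff (charPoly (restrict N F) *P P (contract N F)) j) (flats N)
            ≡⟨ sumL-filter _ (isFlat N) (allSubs (size N)) ⟩
          sumL (λ F → isFlat N F ▸ coeff (charPoly (restrict N F) *P P (contract N F)) j) (allSubs (size N))
            ≡⟨ sumL-allSubs (size N) _ ⟩
          ΣS (size N) (λ F → isFlat N F ▸ coeff (charPoly (restrict N F) *P P (contract N F)) j)
            ≡⟨ ΣS-cong (size N) (λ F → ▸-cong (isFlat N F) (term F)) ⟩
          ΣS (size N) (λ F → isFlat N F ▸ ΣS (size N) (λ A → (A ⊆b F) ▸ (sgn (card A) *ℤ shift (rank N F ∸ rank N A) (Q F) j)))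
            ≡⟨ charSum N Q pal j ⟩
          reverse (rk N) (Q ∅s) j
            ≡⟨ reverse-≤ (Q ∅s) (m∸n≤m (rk N) i) ⟩
          Q ∅s (rk N ∸ j)
            ≡⟨ cong (Q ∅s) (m∸[m∸n]≡n i≤r) ⟩
          Q ∅s i ∎
      where
      open Palindromic pal
      open Rank N matroid
      open ≡-Reasoning
      j = rk N ∸ i
      i≤r : i ≤ rk N
      i≤r = ≤-trans (m≤m+n i (i + 0)) (<⇒≤ (≰⇒> small))
      pos : 0 < rk N
      pos = subst (0 <_) (sym eq) (s≤s z≤n)
      high : rk N ≤ 2 * j
      high = subst (_≤ 2 * j) (m∸n+n≡m i≤r) (+-monoʳ-≤ j (subst (i ≤_) (sym (+-identityʳ j))
        (+-cancelʳ-≤ i i j (subst (i + i ≤_) (sym (m∸n+n≡m i≤r)) (subst (λ z → i + z ≤ rk N) (+-identityʳ i) (<⇒≤ (≰⇒> small)))))))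
      -- the polynomial of N / ∅ is not covered by the induction, but its j-th coefficient vanishes
      sameCoeff : ∀ F → isFlat N F ≡ true → (∀ k → coeff (P (contract N F)) k ≡ Q F k) ⊎ (F ≡ ∅s)
      sameCoeff F fl with bool (F ==s ∅s)
      ... | inj₁ e = inj₂ (==s⇒≡ e)
      ... | inj₂ e = inj₁ (contracted d N Q pal F fl (λ { refl → true≢false (==s-refl (∅s {size N})) e }) (≤-trans (≤-reflexive eq) (s≤s le)))
      expanded : ∀ F (q : ℕ → ℤ) → ΣS (card F) (λ A → sgn (card A) *ℤ shift (rk (restrict N F) ∸ rank (restrict N F) A) q j)
                 ≡ ΣS (size N) (λ A → (A ⊆b F) ▸ (sgn (card A) *ℤ shift (rank N F ∸ rank N A) q j))
      expanded F q = trans (ΣS-cong (card F) λ A → cong₂ (λ c k → sgn c *ℤ shift k q j) (sym (card-expand F A))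
          (cong₂ _∸_ (trans (rank-restrict N matroid F fulls) (cong (rank N) (expand-full F))) (rank-restrict N matroid F A)))
        (ΣS-expand F (λ A → sgn (card A) *ℤ shift (rank N F ∸ rank N A) q j))
      atEmpty : ∀ (q : ℕ → ℤ) → ΣS (size N) (λ A → (A ⊆b ∅s) ▸ (sgn (card A) *ℤ shift (rank N ∅s ∸ rank N A) q j)) ≡ q j
      atEmpty q = trans (ΣS-cong (size N) only∅) (trans (ΣS-delta ∅s (λ A → sgn (card A) *ℤ shift (rank N ∅s ∸ rank N A) q j))
          (trans (cong₂ (λ c k → sgn c *ℤ shift k q j) (card-∅ {size N}) (n∸n≡0 (rank N ∅s))) (ℤ.*-identityˡ (q j))))
        where
        only∅ : ∀ A → (A ⊆b ∅s) ▸ (sgn (card A) *ℤ shift (rank N ∅s ∸ rank N A) q j) ≡ (∅s ==s A) ▸ (sgn (card A) *ℤ shift (rank N ∅s ∸ rank N A) q j)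
        only∅ A = cong (_▸ (sgn (card A) *ℤ shift (rank N ∅s ∸ rank N A) q j)) (bool-ext
          (λ h → subst (λ X → ∅s ==s X ≡ true) (⊆-antisym ∅⊆ (⊆b⇒⊆ A ∅s h)) (==s-refl (∅s {size N})))
          (λ h → subst (λ X → X ⊆b ∅s ≡ true) (==s⇒≡ {A = ∅s} {A} h) (⊆⇒⊆b (⊆-refl {A = ∅s {size N}}))))
      term : ∀ F → isFlat N F ≡ true → coeff (charPoly (restrict N F) *P P (contract N F)) j ≡
             ΣS (size N) (λ A → (A ⊆b F) ▸ (sgn (card A) *ℤ shift (rank N F ∸ rank N A) (Q F) j))
      term F fl with sameCoeff F fl
      ... | inj₁ same = trans (charPoly-* (restrict N F) (P (contract N F)) j) (trans (ΣS-cong (card F)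
              λ A → cong (sgn (card A) *ℤ_) (shift-cong (rk (restrict N F) ∸ rank (restrict N F) A) same j)) (expanded F (Q F)))
      ... | inj₂ refl = trans (charPoly-* (restrict N ∅s) (P (contract N ∅s)) j) (trans (expanded ∅s (coeff (P (contract N ∅s))))
              (trans (atEmpty (coeff (P (contract N ∅s)))) (trans vanish (sym (atEmpty (Q ∅s))))))
        where
        open Contract N matroid ∅s
        rk∅ : rk (contract N ∅s) ≡ rk N
        rk∅ = trans (sym (+-identityʳ _)) (trans (cong (rk (contract N ∅s) +_) (sym rank-∅)) rkC)
        vanish : coeff (P (contract N ∅s)) j ≡ Q ∅s j
        vanish = trans (degree (contract N ∅s) isMatroid (loopless (∅-flat noLoops)) (subst (0 <_) (sym rk∅) pos) j
                   (subst (_≤ 2 * j) (sym rk∅) high))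
                 (sym (lowDeg ∅s fl (subst (_< rk N) (sym rank-∅) pos) j (subst (λ z → rk N ≤ z + 2 * j) (sym rank-∅) high)))

  kl-unique : ∀ N Q → Palindromic N Q → ∀ i → coeff (P N) i ≡ Q ∅s i
  kl-unique N Q pal = go (rk N) N Q pal ≤-refl

-- Rotation of a cycle

rot-inject₁ : ∀ {k} (j : Fin k) → rot (inject₁ j) ≡ suc j
rot-inject₁ {k} j = toℕ-injective (trans (toℕ-fromℕ< _) (trans (cong (λ x → suc x % suc k) (toℕ-inject₁ j)) (m<n⇒m%n≡m (s≤s (toℕ<n j)))))

rot-fromℕ : ∀ k → rot (fromℕ k) ≡ zero
rot-fromℕ k = toℕ-injective (trans (toℕ-fromℕ< _) (trans (cong (λ x → suc x % suc k) (toℕ-fromℕ k)) (n%n≡0 (suc k))))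

rot⁻¹ : ∀ {k} → Fin (suc k) → Fin (suc k)
rot⁻¹ {k} zero = fromℕ k
rot⁻¹ (suc j) = inject₁ j

rot-rot⁻¹ : ∀ {k} (v : Fin (suc k)) → rot (rot⁻¹ v) ≡ v
rot-rot⁻¹ {k} zero = rot-fromℕ k
rot-rot⁻¹ (suc j) = rot-inject₁ j

rot⁻¹-rot : ∀ {k} (v : Fin (suc k)) → rot⁻¹ (rot v) ≡ v
rot⁻¹-rot v with view v
... | ‵fromℕ {n = n} = cong rot⁻¹ (rot-fromℕ n)
... | ‵inject₁ j = cong rot⁻¹ (rot-inject₁ j)

-- `up` never passes from the last vertex to `zero`, so it is run twice: from `v₀` to the last
-- vertex, then from `zero` to `w`.
rot-induction : ∀ {k} (X : Fin (suc k) → Set) v₀ → X v₀ → (∀ v → X v → X (rot v)) → ∀ w → X w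
rot-induction {k} X v₀ x₀ step w = up w zero (toℕ w) (sym (+-identityʳ _)) x-zero
  where
  up : ∀ w v d → toℕ w ≡ d + toℕ v → X v → X w
  up w v zero e x = subst X (toℕ-injective (sym e)) x
  up w v (suc d) e x with view v
  ... | ‵inject₁ j = up w (suc j) d (trans e (trans (cong (λ z → suc (d + z)) (toℕ-inject₁ j)) (sym (+-suc d (toℕ j)))))
      (subst X (rot-inject₁ j) (step _ x))
  ... | ‵fromℕ = ⊥-elim (<-irrefl refl (≤-trans (subst (_≤ k) e (≤-pred (toℕ<n w))) (≤-trans (≤-reflexive (sym (toℕ-fromℕ k))) (m≤n+m _ d))))
  x-zero : X zero
  x-zero = subst X (rot-fromℕ k) (step _ (up (fromℕ k) v₀ (k ∸ toℕ v₀)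
    (trans (toℕ-fromℕ k) (sym (m∸n+n≡m (≤-pred (toℕ<n v₀))))) x₀))

-- Forward induction on the implication `X v → X w`, starting at `w`, where it is trivial.
rot⁻¹-induction : ∀ {k} (X : Fin (suc k) → Set) v₀ → X v₀ → (∀ v → X v → X (rot⁻¹ v)) → ∀ w → X w
rot⁻¹-induction {k} X v₀ x₀ step w = rot-induction (λ v → X v → X w) w id
  (λ v h x → h (subst X (rot⁻¹-rot v) (step _ x))) v₀ x₀

∑-rot : ∀ {k} (f : Fin (suc k) → ℕ) → ∑ (λ v → f (rot v)) ≡ ∑ f
∑-rot f = sym (ΣN.sum-permute f (permutation rot rot⁻¹ rot-rot⁻¹ rot⁻¹-rot))

∑-rot⁻¹ : ∀ {k} (f : Fin (suc k) → ℕ) → ∑ (λ v → f (rot⁻¹ v)) ≡ ∑ f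
∑-rot⁻¹ f = trans (sym (∑-rot (f ∘ rot⁻¹))) (∑-cong λ v → cong f (rot⁻¹-rot v))

-- Recursion around a cycle is well defined as soon as one step forgets its argument.
module CyclicRecursion {V : Set} (σ τ : V → V) (τσ : ∀ v → τ (σ v) ≡ v)
  (induct : ∀ (X : V → Set) v₀ → X v₀ → (∀ v → X v → X (σ v)) → ∀ w → X w)
  {Y : Set} (y₀ : Y) (step : V → Y → Y) (e : V) (cut : ∀ y y' → step e y ≡ step e y') where

  private
    approx : ℕ → V → Y
    approx zero v = y₀
    approx (suc d) v = step (τ v) (approx d (τ v))

    -- `approx d v` performs `d` steps of the recursion ending at `v`; once these steps cross `e`,
    -- the initial value `y₀` is forgotten.
    Stable : V → Set
    Stable v = ∃ λ j → ∀ d d' → j ≤ d → j ≤ d' → approx d v ≡ approx d' v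

    stable : ∀ v → Stable v
    stable = induct Stable (σ e) (1 , base) next
      where
      base : ∀ d d' → 1 ≤ d → 1 ≤ d' → approx d (σ e) ≡ approx d' (σ e)
      base (suc d) (suc d') _ _ rewrite τσ e = cut _ _
      next : ∀ v → Stable v → Stable (σ v)
      next v (j , s) = suc j , λ { (suc d) (suc d') (s≤s p) (s≤s q) → lem d d' p q }
        where
        lem : ∀ d d' → j ≤ d → j ≤ d' → approx (suc d) (σ v) ≡ approx (suc d') (σ v)
        lem d d' p q rewrite τσ v = cong (step v) (s d d' p q)

  cycRec : V → Y
  cycRec v = approx (proj₁ (stable v)) v

  cycRec-step : ∀ v → cycRec (σ v) ≡ step v (cycRec v)
  cycRec-step v with stable v | stable (σ v)
  ... | j , s | j' , s' = trans (s' j' (suc (j + j')) ≤-refl (m≤n⇒m≤o+n (suc j) ≤-refl))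
        (trans (cong (λ w → step w (approx (j + j') w)) (τσ v)) (cong (step v) (s (j + j') j (m≤m+n j j') ≤-refl)))

-- The matroid given by Hall's condition

search : ∀ {n} {P Q : Fin n → Set} → (∀ x → P x ⊎ Q x) → (∃ P) ⊎ (∀ x → Q x)
search {zero} f = inj₂ λ ()
search {suc n} f with f zero
... | inj₁ p = inj₁ (zero , p)
... | inj₂ q with search (f ∘ suc)
...   | inj₁ (x , p) = inj₁ (suc x , p)
...   | inj₂ h = inj₂ λ { zero → q ; (suc x) → h x }

module HallMatroid {m n : ℕ} (Nb : Sub m → Sub n)
  (Nb-mono : ∀ {C D} → C ⊆ D → Nb C ⊆ Nb D)
  (Nb-elim : ∀ C v → v ∈ Nb C → ∃ λ y → y ∈ C × v ∈ Nb (single y)) where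

  Hall : Sub m → Set
  Hall A = ∀ C → C ⊆ A → card C ≤ card (Nb C)

  Tight : Sub m → Sub m → Set
  Tight A C = C ⊆ A × card (Nb C) ≤ card C

  Nb-∪ : ∀ C D → Nb (C ∪s D) ⊆ Nb C ∪s Nb D
  Nb-∪ C D = mk⊆ go
    where
    go : ∀ v → v ∈ Nb (C ∪s D) → v ∈ Nb C ∪s Nb D
    go v p with Nb-elim (C ∪s D) v p
    ... | y , q , r with ∪-elim C D y q
    ...   | inj₁ h = ∪-introˡ {A = Nb C} {Nb D} .at v (Nb-mono (single⊆ C h) .at v r)
    ...   | inj₂ h = ∪-introʳ {A = Nb C} {Nb D} .at v (Nb-mono (single⊆ D h) .at v r)

  hall-⊆ : ∀ {A B} → A ⊆ B → Hall B → Hall A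
  hall-⊆ s h C p = h C (⊆-trans p s)

  hall-∅ : Hall ∅s
  hall-∅ C s = subst (_≤ card (Nb C)) (sym (trans (cong card (⊆-antisym s ∅⊆)) (card-∅ {m}))) z≤n

  -- Uncrossing: `card (Nb C)` is submodular in `C`, and Hall's condition bounds the intersection
  -- term from below.
  tight-∪ : ∀ {A C D} → Hall A → Tight A C → Tight A D → Tight A (C ∪s D)
  tight-∪ {A} {C} {D} h (sC , tC) (sD , tD) = ∪-least sC sD , +-cancelʳ-≤ (card (Nb (C ∩ D))) _ _ (begin
    card (Nb (C ∪s D)) + card (Nb (C ∩ D))
      ≤⟨ +-mono-≤ (card-mono (Nb-∪ C D)) (card-mono {A = Nb (C ∩ D)} {Nb C ∩ Nb D}
          (mk⊆ λ v p → ∩-intro (Nb C) (Nb D) (Nb-mono (∩-⊆ˡ {A = C} {D}) .at v p) (Nb-mono (∩-⊆ʳ {A = C} {D}) .at v p))) ⟩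
    card (Nb C ∪s Nb D) + card (Nb C ∩ Nb D)  ≡⟨ card-∪∩ (Nb C) (Nb D) ⟩
    card (Nb C) + card (Nb D)                 ≤⟨ +-mono-≤ tC tD ⟩
    card C + card D                           ≡⟨ card-∪∩ C D ⟨
    card (C ∪s D) + card (C ∩ D)              ≤⟨ +-monoʳ-≤ (card (C ∪s D)) (h (C ∩ D) (⊆-trans (∩-⊆ˡ {A = C} {D}) sC)) ⟩
    card (C ∪s D) + card (Nb (C ∩ D))         ∎)
    where open ≤-Reasoning

  tight-∅ : ∀ {A} → Tight A ∅s
  tight-∅ = ∅⊆ , subst (_≤ card (∅s {m})) (sym (trans (cong card (⊆-antisym {A = Nb ∅s} {∅s} (mk⊆ λ v p → ⊥-elim (none v p)) ∅⊆)) (card-∅ {n}))) z≤n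
    where
    none : ∀ v → v ∈ Nb ∅s → ⊥
    none v p with Nb-elim ∅s v p
    ... | y , q , _ = true≢false q (x∉∅ y)

  hall? : ∀ A → Hall A ⊎ ∃ λ C → C ⊆ A × card (Nb C) < card C
  hall? A with anySubset? {P = λ C → (C ⊆b A ≡ true) × (card (Nb C) < card C)} (λ C → (C ⊆b A Data.Bool.≟ true) ×-dec (card (Nb C) <? card C))
  ... | yes (C , s , lt) = inj₂ (C , ⊆b⇒⊆ C A s , lt)
  ... | no ne = inj₁ λ C s → ≮⇒≥ λ lt → ne (C , ⊆⇒⊆b s , lt)

  -- A violator `C` of `A ∪s single x` must contain `x`. Removing `x` leaves `D ⊆ A` with
  -- `card (Nb C) ≤ card D ≤ card (Nb D)`, so `D` is tight and `x` contributes no new neighbour.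
  dependent⇒tight : ∀ {A} x → Hall A → Hall (A ∪s single x) ⊎ ∃ λ C → Tight A C × Nb (single x) ⊆ Nb C
  dependent⇒tight {A} x h with hall? (A ∪s single x)
  ... | inj₁ g = inj₁ g
  ... | inj₂ (C , s , lt) = inj₂ (D , (D⊆A , ≤-trans (card-mono (Nb-mono D⊆C)) NbC≤D) , subst (Nb (single x) ⊆_) same (Nb-mono (single⊆ C x∈C)))
    where
    D = C ∩ compl (single x)
    D⊆C : D ⊆ C
    D⊆C = ∩-⊆ˡ {A = C} {compl (single x)}
    D⊆A : D ⊆ A
    D⊆A = mk⊆ λ y p → go y p (∪-elim A (single x) y (s .at y (D⊆C .at y p)))
      where
      go : ∀ y → y ∈ D → (y ∈ A) ⊎ (y ∈ single x) → y ∈ A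
      go y p (inj₁ q) = q
      go y p (inj₂ q) = ⊥-elim (true≢false q (compl-elim (single x) (∩-⊆ʳ {A = C} {compl (single x)} .at y p)))
    x∈C : x ∈ C
    x∈C with bool (lookup C x)
    ... | inj₁ p = p
    ... | inj₂ p = ⊥-elim (<⇒≱ lt (h C (mk⊆ λ y q → go y q (∪-elim A (single x) y (s .at y q)))))
      where
      go : ∀ y → y ∈ C → (y ∈ A) ⊎ (y ∈ single x) → y ∈ A
      go y q (inj₁ r) = r
      go y q (inj₂ r) = ⊥-elim (true≢false (subst (_∈ C) (sym (∈single⇒≡ r)) q) p)
    C≤ : card C ≤ suc (card D)
    C≤ = ≤-trans (≤-reflexive (sym (card-split C (single x)))) (+-monoˡ-≤ (card D)
        (≤-trans (card-mono (∩-⊆ʳ {A = C} {single x})) (≤-reflexive (card-single x))))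
    NbC≤D : card (Nb C) ≤ card D
    NbC≤D = ≤-pred (≤-trans lt C≤)
    same : Nb C ≡ Nb D
    same = sym (⊆∧card⇒≡ (Nb-mono D⊆C) (≤-trans NbC≤D (h D D⊆A)))

  private
    -- Merges the individual tight sets into a single one that covers the neighbourhoods of all
    -- listed elements not exempted by `X`.
    tight-all : ∀ {A} → Hall A → (X : Fin m → Set) → (∀ x → X x ⊎ ∃ λ C → Tight A C × Nb (single x) ⊆ Nb C) →
                ∀ l → ∃ λ C → Tight A C × (∀ x → x ∈L l → X x ⊎ Nb (single x) ⊆ Nb C)
    tight-all h X f [] = ∅s , tight-∅ , λ _ ()
    tight-all h X f (x ∷ l) with tight-all h X f l | f x
    ... | C , t , g | inj₁ p = C , t , λ { _ (here refl) → inj₁ p ; y (there q) → g y q }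
    ... | C , t , g | inj₂ (D , t' , s) = C ∪s D , tight-∪ h t t' , λ
          { _ (here refl) → inj₂ (⊆-trans s (Nb-mono (∪-introʳ {A = C} {D})))
          ; y (there q) → lift (g y q) }
      where
      lift : ∀ {y} → X y ⊎ Nb (single y) ⊆ Nb C → X y ⊎ Nb (single y) ⊆ Nb (C ∪s D)
      lift (inj₁ a) = inj₁ a
      lift (inj₂ b) = inj₂ (⊆-trans b (Nb-mono (∪-introˡ {A = C} {D})))

  -- If no element can be added, one tight `D ⊆ A` covers the neighbourhoods of all elements of `B`
  -- outside `E`, the part of `A` outside `D`. Hall's condition for `B` then leaves at most `card D`
  -- elements of `B` outside `E`, whence `card B ≤ card A`.
  hall-augment : ∀ A B → Hall A → Hall B → card A < card B → ∃ λ x → x ∈ B × x ∉ A × Hall (A ∪s single x)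
  hall-augment A B hA hB lt with search {P = λ x → x ∈ B × x ∉ A × Hall (A ∪s single x)}
      {Q = λ x → (x ∈ B → x ∈ A) ⊎ ∃ λ C → Tight A C × Nb (single x) ⊆ Nb C} try
    where
    try : ∀ x → (x ∈ B × x ∉ A × Hall (A ∪s single x)) ⊎ ((x ∈ B → x ∈ A) ⊎ ∃ λ C → Tight A C × Nb (single x) ⊆ Nb C)
    try x with bool (lookup B x) | bool (lookup A x)
    ... | inj₂ p | _ = inj₂ (inj₁ λ q → ⊥-elim (true≢false q p))
    ... | inj₁ p | inj₁ q = inj₂ (inj₁ λ _ → q)
    ... | inj₁ p | inj₂ q with dependent⇒tight x hA
    ...   | inj₁ g = inj₁ (p , q , g)
    ...   | inj₂ t = inj₂ (inj₂ t)
  ... | inj₁ r = r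
  ... | inj₂ g with tight-all hA (λ x → x ∈ B → x ∈ A) g (allFin m)
  ...   | D , (sD , tD) , f = ⊥-elim (<⇒≱ lt (begin
      card B                                          ≡⟨ card-split B E ⟨
      card (B ∩ E) + card B₂                          ≤⟨ +-mono-≤ (card-mono (∩-⊆ʳ {A = B} {E})) (hB B₂ (∩-⊆ˡ {A = B} {compl E})) ⟩
      card E + card (Nb B₂)                           ≤⟨ +-monoʳ-≤ (card E) (≤-trans (card-mono NbB₂) tD) ⟩
      card E + card D                                 ≡⟨ cong (λ X → card E + card X) AD ⟨
      card E + card (A ∩ D)                           ≡⟨ +-comm (card E) _ ⟩
      card (A ∩ D) + card E                           ≡⟨ card-split A D ⟩
      card A                                          ∎))
    where
    open ≤-Reasoning
    E = A ∩ compl D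
    B₂ = B ∩ compl E
    AD : A ∩ D ≡ D
    AD = ⊆-antisym (∩-⊆ʳ {A = A} {D}) (mk⊆ λ x p → ∩-intro A D (sD .at x p) p)
    elt : ∀ y → y ∈ B₂ → Nb (single y) ⊆ Nb D
    elt y p with bool (lookup D y) | f y (∈-allFin y)
    ... | inj₁ q | _ = Nb-mono (single⊆ D q)
    ... | inj₂ q | inj₂ r = r
    ... | inj₂ q | inj₁ r = ⊥-elim (true≢false (∩-intro A (compl D) (r (∩-⊆ˡ {A = B} {compl E} .at y p)) (compl-intro D q))
            (compl-elim E (∩-⊆ʳ {A = B} {compl E} .at y p)))
    NbB₂ : Nb B₂ ⊆ Nb D
    NbB₂ = mk⊆ go
      where
      go : ∀ v → v ∈ Nb B₂ → v ∈ Nb D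
      go v p with Nb-elim B₂ v p
      ... | y , q , r = elt y q .at v r

  hall-isMatroid : (I : Sub m → Bool) → (∀ A → I A ≡ true → Hall A) → (∀ A → Hall A → I A ≡ true) →
                   IsMatroid (record { size = m ; indep = I })
  hall-isMatroid I to from = record
    { I1 = ≡⇒T (from ∅s hall-∅)
    ; I2 = λ A B s i → ≡⇒T (from A (hall-⊆ (⊆b⇒⊆ A B (T⇒≡ s)) (to B (T⇒≡ i))))
    ; I3 = λ A B a b lt → aug A B (hall-augment A B (to A (T⇒≡ a)) (to B (T⇒≡ b)) lt)
    }
    where
    aug : ∀ A B → (∃ λ x → x ∈ B × x ∉ A × Hall (A ∪s single x)) →
          ∃ λ x → T (lookup B x) × T (not (lookup A x)) × T (I (A ∪s single x))
    aug A B (x , p , q , r) = x , ≡⇒T p , ≡⇒T (cong not q) , ≡⇒T (from _ r)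

-- Whirls: independence is Hall's condition

∑-↑ : ∀ m {n} (f : Fin (m + n) → ℕ) → ∑ f ≡ ∑ (λ i → f (i ↑ˡ n)) + ∑ (λ i → f (m ↑ʳ i))
∑-↑ zero f = refl
∑-↑ (suc m) f = trans (cong (f zero +_) (∑-↑ m (f ∘ suc))) (sym (+-assoc (f zero) _ _))

∑-zero : ∀ {n} {f : Fin n → ℕ} → (∀ i → f i ≡ 0) → ∑ f ≡ 0
∑-zero {n} h = trans (∑-cong h) (trans (∑-const n 0) (*-zeroʳ n))

∑-pick : ∀ {n} (f : Fin n → ℕ) v → ∑ (λ i → f i * 𝟙 ⌊ v ≟F i ⌋) ≡ f v
∑-pick {n} f v = trans (∑-cong at-v) (trans (scaled (f v) (λ i → 𝟙 ⌊ v ≟F i ⌋)) (trans (cong (f v *_) (∑-delta v)) (*-identityʳ (f v))))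
  where
  at-v : ∀ i → f i * 𝟙 ⌊ v ≟F i ⌋ ≡ f v * 𝟙 ⌊ v ≟F i ⌋
  at-v i with v ≟F i
  ... | yes refl = refl
  ... | no _ = trans (*-zeroʳ (f i)) (sym (*-zeroʳ (f v)))
  scaled : ∀ {n} c (g : Fin n → ℕ) → ∑ (λ i → c * g i) ≡ c * ∑ g
  scaled {zero} c g = sym (*-zeroʳ c)
  scaled {suc n} c g = trans (cong (c * g zero +_) (scaled c (g ∘ suc))) (sym (*-distribˡ-+ c (g zero) _))

foldr-allFin : ∀ {m} (C : Fin m → Bool) (w : Fin m → ℕ) →
               foldr (λ e acc → if C e then w e + acc else acc) 0 (allFin m) ≡ ∑ (λ e → 𝟙 (C e) * w e)
foldr-allFin {m} C w = go m id
  where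
  go : ∀ k (g : Fin k → Fin m) → foldr (λ e acc → if C e then w e + acc else acc) 0 (tabulateL g) ≡ ∑ (λ i → 𝟙 (C (g i)) * w (g i))
  go zero g = refl
  go (suc k) g with C (g zero)
  ... | true = cong₂ _+_ (sym (+-identityʳ (w (g zero)))) (go k (g ∘ suc))
  ... | false = go k (g ∘ suc)

∑≡0 : ∀ {n} (f : Fin n → ℕ) → ∑ f ≡ 0 → ∀ i → f i ≡ 0
∑≡0 f e i = n≤0⇒n≡0 (subst (f i ≤_) e (∑-≤-term f i))

hits : ∀ {n} → Fin n → Fin n → ℕ
hits v w = if ⌊ v ≟F w ⌋ then 1 else 0

hits-suc : ∀ {n} (v w : Fin n) → hits (suc v) (suc w) ≡ 𝟙 ⌊ v ≟F w ⌋
hits-suc v w with v ≟F w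
... | yes _ = refl
... | no _ = refl

deg≡∑ : ∀ G C v → deg G C v ≡ ∑ (λ e → 𝟙 (lookup C e) * (hits v (proj₁ (ends G e)) + hits v (proj₂ (ends G e))))
deg≡∑ G C v = foldr-allFin (lookup C) (λ e → hits v (proj₁ (ends G e)) + hits v (proj₂ (ends G e)))

isRim : ∀ {m n} → Fin m ⊎ Fin n → Bool
isRim (inj₁ _) = false
isRim (inj₂ _) = true

lookup-rimSet : ∀ k x → lookup (rimSet k) x ≡ isRim (splitAt (suc k) x)
-- The left-hand side of the next statement involves a local function of rimSet, so it is left to unification.
lookup-rimSet-suc : ∀ k (x : Fin (k + suc k)) → _
lookup-rimSet k zero = refl
lookup-rimSet k (suc x) = trans (lookup∘tabulate _ x) (lookup-rimSet-suc k x)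
lookup-rimSet-suc k x with splitAt k x
... | inj₁ _ = refl
... | inj₂ _ = refl

xor-cancel : ∀ a b c → (a xor b) xor (b xor c) ≡ a xor c
xor-cancel true true true = refl
xor-cancel true true false = refl
xor-cancel true false true = refl
xor-cancel true false false = refl
xor-cancel false true true = refl
xor-cancel false true false = refl
xor-cancel false false true = refl
xor-cancel false false false = refl

xor-swap : ∀ a b c d → (a xor b) xor (c xor d) ≡ (a xor c) xor (b xor d)
xor-swap true true true true = refl
xor-swap true true true false = refl
xor-swap true true false true = refl
xor-swap true true false false = refl
xor-swap true false true true = refl
xor-swap true false true false = refl
xor-swap true false false true = refl
xor-swap true false false false = refl
xor-swap false true true true = refl
xor-swap false true true false = refl
xor-swap false true false true = refl
xor-swap false true false false = refl
xor-swap false false true true = refl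
xor-swap false false true false = refl
xor-swap false false false true = refl
xor-swap false false false false = refl

xor-self : ∀ a → a xor a ≡ false
xor-self true = refl
xor-self false = refl

module Elements (k : ℕ) where

  private n = suc k

  sp rim : Fin n → Fin (n + n)
  sp i = i ↑ˡ n
  rim i = n ↑ʳ i

  elt : ∀ x → (∃ λ i → sp i ≡ x) ⊎ (∃ λ i → rim i ≡ x)
  elt x with splitAt n x in eq
  ... | inj₁ i = inj₁ (i , splitAt⁻¹-↑ˡ eq)
  ... | inj₂ i = inj₂ (i , splitAt⁻¹-↑ʳ eq)

  elements : ∀ {X : Fin (n + n) → Set} → (∀ i → X (sp i)) → (∀ i → X (rim i)) → ∀ x → X x
  elements f g x with elt x
  ... | inj₁ (i , refl) = f i
  ... | inj₂ (i , refl) = g i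

  mkSub : (Fin n → Bool) → (Fin n → Bool) → Sub (n + n)
  mkSub s r = tabulate s Vec.++ tabulate r

  lookup-sp : ∀ s r i → lookup (mkSub s r) (sp i) ≡ s i
  lookup-sp s r i = trans (lookup-++ˡ (tabulate s) (tabulate r) i) (lookup∘tabulate s i)

  lookup-rim : ∀ s r i → lookup (mkSub s r) (rim i) ≡ r i
  lookup-rim s r i = trans (lookup-++ʳ (tabulate s) (tabulate r) i) (lookup∘tabulate r i)

  card-elements : ∀ A → card A ≡ ∑ (λ i → 𝟙 (lookup A (sp i))) + ∑ (λ i → 𝟙 (lookup A (rim i)))
  card-elements A = trans (card≡∑ A) (∑-↑ n (λ x → 𝟙 (lookup A x)))

  card-mkSub : ∀ s r → card (mkSub s r) ≡ ∑ (𝟙 ∘ s) + ∑ (𝟙 ∘ r)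
  card-mkSub s r = trans (card-elements (mkSub s r)) (cong₂ _+_ (∑-cong λ i → cong 𝟙 (lookup-sp s r i)) (∑-cong λ i → cong 𝟙 (lookup-rim s r i)))

  rimSet≡ : rimSet k ≡ mkSub (λ _ → false) (λ _ → true)
  rimSet≡ = sub-ext (elements (λ i → trans (atSp i) (sym (lookup-sp (λ _ → false) (λ _ → true) i)))
      (λ i → trans (atRim i) (sym (lookup-rim (λ _ → false) (λ _ → true) i))))
    where
    atSp : ∀ i → lookup (rimSet k) (sp i) ≡ false
    atSp i = trans (lookup-rimSet k (sp i)) (cong isRim (splitAt-↑ˡ n i n))
    atRim : ∀ i → lookup (rimSet k) (rim i) ≡ true
    atRim i = trans (lookup-rimSet k (rim i)) (cong isRim (splitAt-↑ʳ n n i))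

  Nb : Sub (n + n) → Sub n
  Nb C = tabulate λ v → lookup C (sp v) ∨ (lookup C (rim v) ∨ lookup C (rim (rot⁻¹ v)))

  lookup-Nb : ∀ C v → lookup (Nb C) v ≡ lookup C (sp v) ∨ (lookup C (rim v) ∨ lookup C (rim (rot⁻¹ v)))
  lookup-Nb C v = lookup∘tabulate (λ v → lookup C (sp v) ∨ (lookup C (rim v) ∨ lookup C (rim (rot⁻¹ v)))) v

  data Incident (C : Sub (n + n)) (v : Fin n) : Set where
    bySp   : sp v ∈ C → Incident C v
    byRim  : rim v ∈ C → Incident C v
    byRim' : rim (rot⁻¹ v) ∈ C → Incident C v

  ∈Nb⇒ : ∀ C v → v ∈ Nb C → Incident C v
  ∈Nb⇒ C v p with ∨-elim (trans (sym (lookup-Nb C v)) p)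
  ... | inj₁ q = bySp q
  ... | inj₂ q with ∨-elim {lookup C (rim v)} q
  ...   | inj₁ r = byRim r
  ...   | inj₂ r = byRim' r

  ⇒∈Nb : ∀ C v → Incident C v → v ∈ Nb C
  ⇒∈Nb C v (bySp p) = trans (lookup-Nb C v) (∨-introˡ p)
  ⇒∈Nb C v (byRim p) = trans (lookup-Nb C v) (∨-introʳ (lookup C (sp v)) (∨-introˡ p))
  ⇒∈Nb C v (byRim' p) = trans (lookup-Nb C v) (∨-introʳ (lookup C (sp v)) (∨-introʳ (lookup C (rim v)) p))

  Nb-mono : ∀ {C D} → C ⊆ D → Nb C ⊆ Nb D
  Nb-mono {C} {D} s = mk⊆ λ v p → ⇒∈Nb D v (go v (∈Nb⇒ C v p))
    where
    go : ∀ v → Incident C v → Incident D v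
    go v (bySp p) = bySp (s .at _ p)
    go v (byRim p) = byRim (s .at _ p)
    go v (byRim' p) = byRim' (s .at _ p)

  Nb-elim : ∀ C v → v ∈ Nb C → ∃ λ y → y ∈ C × v ∈ Nb (single y)
  Nb-elim C v p with ∈Nb⇒ C v p
  ... | bySp q = sp v , q , ⇒∈Nb (single (sp v)) v (bySp (x∈single (sp v)))
  ... | byRim q = rim v , q , ⇒∈Nb (single (rim v)) v (byRim (x∈single (rim v)))
  ... | byRim' q = rim (rot⁻¹ v) , q , ⇒∈Nb (single (rim (rot⁻¹ v))) v (byRim' (x∈single (rim (rot⁻¹ v))))

  open HallMatroid Nb Nb-mono Nb-elim public

  ends-sp : ∀ i → ends (wheel k) (sp i) ≡ (zero , suc i)
  ends-sp i rewrite splitAt-↑ˡ n i n = refl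

  ends-rim : ∀ i → ends (wheel k) (rim i) ≡ (suc i , suc (rot i))
  ends-rim i rewrite splitAt-↑ʳ n n i = refl

  rot-≟ : ∀ (v i : Fin n) → ⌊ v ≟F rot i ⌋ ≡ ⌊ rot⁻¹ v ≟F i ⌋
  rot-≟ v i = bool-ext
    (λ h → subst (λ w → ⌊ w ≟F i ⌋ ≡ true) (trans (sym (rot⁻¹-rot i)) (cong rot⁻¹ (sym (≟F-true {x = v} h)))) (≟F-diag i))
    (λ h → subst (λ w → ⌊ v ≟F w ⌋ ≡ true) (trans (sym (rot-rot⁻¹ v)) (cong rot (≟F-true {x = rot⁻¹ v} h))) (≟F-diag v))

  deg-rim : ∀ C v → deg (wheel k) C (suc v) ≡ 𝟙 (lookup C (sp v)) + (𝟙 (lookup C (rim v)) + 𝟙 (lookup C (rim (rot⁻¹ v))))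
  deg-rim C v = trans (deg≡∑ (wheel k) C (suc v)) (trans (∑-↑ n (λ e → 𝟙 (lookup C e) *
      (hits (suc v) (proj₁ (ends (wheel k) e)) + hits (suc v) (proj₂ (ends (wheel k) e))))) (cong₂ _+_
      (trans (∑-cong λ i → trans (cong (λ p → 𝟙 (lookup C (sp i)) * (hits (suc v) (proj₁ p) + hits (suc v) (proj₂ p))) (ends-sp i))
         (cong (𝟙 (lookup C (sp i)) *_) (hits-suc v i))) (∑-pick (λ i → 𝟙 (lookup C (sp i))) v))
      (trans (∑-cong λ i → trans (cong (λ p → 𝟙 (lookup C (rim i)) * (hits (suc v) (proj₁ p) + hits (suc v) (proj₂ p))) (ends-rim i))
         (trans (cong (𝟙 (lookup C (rim i)) *_) (cong₂ _+_ (hits-suc v i) (trans (hits-suc v (rot i)) (cong 𝟙 (rot-≟ v i)))))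
           (*-distribˡ-+ (𝟙 (lookup C (rim i))) (𝟙 ⌊ v ≟F i ⌋) (𝟙 ⌊ rot⁻¹ v ≟F i ⌋))))
        (trans (∑-+ (λ i → 𝟙 (lookup C (rim i)) * 𝟙 ⌊ v ≟F i ⌋) (λ i → 𝟙 (lookup C (rim i)) * 𝟙 ⌊ rot⁻¹ v ≟F i ⌋))
          (cong₂ _+_ (∑-pick (λ i → 𝟙 (lookup C (rim i))) v) (∑-pick (λ i → 𝟙 (lookup C (rim i))) (rot⁻¹ v)))))))

  deg-hub : ∀ C → deg (wheel k) C zero ≡ ∑ (λ i → 𝟙 (lookup C (sp i)))
  deg-hub C = trans (deg≡∑ (wheel k) C zero) (trans (∑-↑ n (λ e → 𝟙 (lookup C e) *
      (hits zero (proj₁ (ends (wheel k) e)) + hits zero (proj₂ (ends (wheel k) e))))) (trans (cong₂ _+_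
      (∑-cong λ i → trans (cong (λ p → 𝟙 (lookup C (sp i)) * (hits zero (proj₁ p) + hits zero (proj₂ p))) (ends-sp i))
          (*-identityʳ (𝟙 (lookup C (sp i)))))
      (∑-zero λ i → trans (cong (λ p → 𝟙 (lookup C (rim i)) * (hits zero (proj₁ p) + hits zero (proj₂ p))) (ends-rim i))
          (*-zeroʳ (𝟙 (lookup C (rim i))))))
    (+-identityʳ (∑ (λ i → 𝟙 (lookup C (sp i)))))))

  evenTwo⇒ : ∀ C → evenTwo (wheel k) C ≡ true → ∀ v → (deg (wheel k) C v ≡ 0) ⊎ (deg (wheel k) C v ≡ 2)
  evenTwo⇒ C h v with ∨-elim (allB⇒ {p = λ v → (deg (wheel k) C v ≡ᵇ 0) ∨ (deg (wheel k) C v ≡ᵇ 2)} h (∈-allFin v))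
  ... | inj₁ p = inj₁ (≡ᵇ⇒≡ _ _ (≡⇒T p))
  ... | inj₂ p = inj₂ (≡ᵇ⇒≡ _ _ (≡⇒T p))

  ⇒evenTwo : ∀ C → (∀ v → (deg (wheel k) C v ≡ 0) ⊎ (deg (wheel k) C v ≡ 2)) → evenTwo (wheel k) C ≡ true
  ⇒evenTwo C h = ⇒allB (allFin (suc n)) λ v → lem v (h v)
    where
    lem : ∀ v → (deg (wheel k) C v ≡ 0) ⊎ (deg (wheel k) C v ≡ 2) → ((deg (wheel k) C v ≡ᵇ 0) ∨ (deg (wheel k) C v ≡ᵇ 2)) ≡ true
    lem v (inj₁ p) = ∨-introˡ (T⇒≡ (≡⇒≡ᵇ (deg (wheel k) C v) 0 p))
    lem v (inj₂ p) = ∨-introʳ (deg (wheel k) C v ≡ᵇ 0) (T⇒≡ (≡⇒≡ᵇ (deg (wheel k) C v) 2 p))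

  forest⇒ : ∀ A → isForest (wheel k) A ≡ true → ∀ C → C ⊆ A → evenTwo (wheel k) C ≡ true → ∀ x → x ∈ C → ⊥
  forest⇒ A h C s e x p = true≢false (∧-intro (⊆⇒⊆b s) (∧-intro (cong not (¬true⇒false λ q →
    true≢false p (subst (λ X → x ∉ X) (sym (==s⇒≡ {A = C} {∅s} q)) (x∉∅ x)))) e))
    (not-true (allB⇒ h (∈allSubs C)))

  ⇒forest : ∀ A → (∀ C → C ⊆ A → evenTwo (wheel k) C ≡ true → C ≢ ∅s → ⊥) → isForest (wheel k) A ≡ true
  ⇒forest A h = ⇒allB (allSubs (n + n)) λ C → cong not (¬true⇒false (bad C))
    where
    bad : ∀ C → (C ⊆b A) ∧ cycleUnion (wheel k) C ≡ true → ⊥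
    bad C p = h C (⊆b⇒⊆ C A (∧-elimˡ p)) (∧-elimʳ {not (C ==s ∅s)} (∧-elimʳ {C ⊆b A} p))
      λ e → true≢false (subst (λ X → X ==s ∅s ≡ true) (sym e) (==s-refl (∅s {n + n}))) (not-true (∧-elimˡ (∧-elimʳ {C ⊆b A} p)))

  -- Handshake: if the hub has degree two in a 2-regular C, then C has one more edge than rim vertices.
  hall⇒indep : ∀ A → Hall A → indep (whirl k) A ≡ true
  hall⇒indep A h with bool (A ==s rimSet k)
  ... | inj₁ e = ∨-introʳ (isForest (wheel k) A) e
  ... | inj₂ ne = ∨-introˡ (⇒forest A λ C s e C≢∅ → bad C s (evenTwo⇒ C e) C≢∅)
    where
    bad : ∀ C → C ⊆ A → (∀ v → (deg (wheel k) C v ≡ 0) ⊎ (deg (wheel k) C v ≡ 2)) → C ≢ ∅s → ⊥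
    bad C s e C≢∅ with e zero
    ... | inj₂ two = <-irrefl refl (≤-trans (≤-reflexive (trans (cong suc count) (sym cardC))) (h C s))
      where
      S = ∑ (λ i → 𝟙 (lookup C (sp i)))
      R = ∑ (λ i → 𝟙 (lookup C (rim i)))
      cardC : card C ≡ 2 + R
      cardC = trans (card-elements C) (cong (_+ R) (trans (sym (deg-hub C)) two))
      -- Degrees are 0 or 2, so a rim vertex has degree 2 exactly when it lies in `Nb C`; summing
      -- counts each rim edge twice and each spoke once.
      pointwise : ∀ v → 𝟙 (lookup C (sp v)) + (𝟙 (lookup C (rim v)) + 𝟙 (lookup C (rim (rot⁻¹ v)))) ≡ 2 * 𝟙 (lookup (Nb C) v)
      pointwise v with e (suc v)
      ... | p rewrite deg-rim C v | lookup-Nb C v with lookup C (sp v) | lookup C (rim v) | lookup C (rim (rot⁻¹ v)) | p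
      ...   | true | true | false | _ = refl
      ...   | true | false | true | _ = refl
      ...   | true | true | true | inj₁ ()
      ...   | true | true | true | inj₂ ()
      ...   | true | false | false | inj₁ ()
      ...   | true | false | false | inj₂ ()
      ...   | false | true | true | _ = refl
      ...   | false | true | false | inj₁ ()
      ...   | false | true | false | inj₂ ()
      ...   | false | false | true | inj₁ ()
      ...   | false | false | true | inj₂ ()
      ...   | false | false | false | _ = refl
      count : card (Nb C) ≡ suc R
      count = *-cancelˡ-≡ (card (Nb C)) (suc R) 2 (begin
        2 * card (Nb C)
          ≡⟨ cong (2 *_) (card≡∑ (Nb C)) ⟩
        2 * ∑ (λ v → 𝟙 (lookup (Nb C) v))
          ≡⟨ cong (∑ (λ v → 𝟙 (lookup (Nb C) v)) +_) (+-identityʳ _) ⟩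
        ∑ (λ v → 𝟙 (lookup (Nb C) v)) + ∑ (λ v → 𝟙 (lookup (Nb C) v))
          ≡⟨ ∑-+ (λ v → 𝟙 (lookup (Nb C) v)) (λ v → 𝟙 (lookup (Nb C) v)) ⟨
        ∑ (λ v → 𝟙 (lookup (Nb C) v) + 𝟙 (lookup (Nb C) v))
          ≡⟨ ∑-cong (λ v → trans (cong (𝟙 (lookup (Nb C) v) +_) (sym (+-identityʳ _))) (sym (pointwise v))) ⟩
        ∑ (λ v → 𝟙 (lookup C (sp v)) + (𝟙 (lookup C (rim v)) + 𝟙 (lookup C (rim (rot⁻¹ v)))))
          ≡⟨ ∑-+ (λ v → 𝟙 (lookup C (sp v))) (λ v → 𝟙 (lookup C (rim v)) + 𝟙 (lookup C (rim (rot⁻¹ v)))) ⟩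
        S + ∑ (λ v → 𝟙 (lookup C (rim v)) + 𝟙 (lookup C (rim (rot⁻¹ v))))
          ≡⟨ cong₂ _+_ (trans (sym (deg-hub C)) two) (trans (∑-+ (λ v → 𝟙 (lookup C (rim v))) (λ v → 𝟙 (lookup C (rim (rot⁻¹ v)))))
              (cong (R +_) (trans (∑-rot⁻¹ (λ v → 𝟙 (lookup C (rim v)))) (sym (+-identityʳ R))))) ⟩
        2 + 2 * R
          ≡⟨ *-suc 2 R ⟨
        2 * suc R ∎)
        where open ≡-Reasoning
    -- Without spokes, degree 2 propagates along the rim, so `C` is the whole rim. Then `A` is
    -- either the rim itself, or has a further spoke and more than `n` elements, against Hall's
    -- condition.
    ... | inj₁ nil = contradict (search {P = λ v → rim v ∈ C} {Q = λ v → rim v ∉ C} (λ v → bool (lookup C (rim v))))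
      where
      noSp : ∀ v → sp v ∉ C
      noSp v with lookup C (sp v) | ∑≡0 (λ i → 𝟙 (lookup C (sp i))) (trans (sym (deg-hub C)) nil) v
      ... | false | _ = refl
      step : ∀ v → rim v ∈ C → rim (rot v) ∈ C
      step v p with e (suc (rot v))
      ... | q rewrite deg-rim C (rot v) | rot⁻¹-rot v | noSp (rot v) | p with lookup C (rim (rot v)) | q
      ...   | true | _ = refl
      ...   | false | inj₁ ()
      ...   | false | inj₂ ()
      contradict : (∃ λ v → rim v ∈ C) ⊎ (∀ v → rim v ∉ C) → ⊥
      contradict (inj₂ none) = C≢∅ (⊆-antisym (mk⊆ λ x p → ⊥-elim (true≢false p (elements {X = λ x → x ∉ C} noSp none x))) ∅⊆)
      contradict (inj₁ (v₀ , p₀)) = contradict' (search {P = λ v → sp v ∈ A} {Q = λ v → sp v ∉ A} (λ v → bool (lookup A (sp v))))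
        where
        allRim : ∀ v → rim v ∈ A
        allRim v = s .at (rim v) (rot-induction (λ v → rim v ∈ C) v₀ p₀ step v)
        contradict' : (∃ λ v → sp v ∈ A) ⊎ (∀ v → sp v ∉ A) → ⊥
        contradict' (inj₂ none) = true≢false (subst (λ X → X ==s rimSet k ≡ true) (sym A≡) (==s-refl (rimSet k))) ne
          where
          A≡ : A ≡ rimSet k
          A≡ = trans (sub-ext (elements (λ i → trans (none i) (sym (lookup-sp (λ _ → false) (λ _ → true) i)))
              (λ i → trans (allRim i) (sym (lookup-rim (λ _ → false) (λ _ → true) i))))) (sym rimSet≡)
        contradict' (inj₁ (v , p)) = <-irrefl refl (begin-strict
          n                       ≡⟨ trans (∑-const n 1) (*-identityʳ n) ⟨
          ∑ {n} (λ _ → 1)         ≡⟨ ∑-cong (λ i → cong 𝟙 (allRim i)) ⟨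
          R                       <⟨ +-monoˡ-≤ R (subst (λ b → 𝟙 b ≤ S) p (∑-≤-term (λ i → 𝟙 (lookup A (sp i))) v)) ⟩
          S + R                   ≡⟨ card-elements A ⟨
          card A                  ≤⟨ h A ⊆-refl ⟩
          card (Nb A)             ≤⟨ card≤ (Nb A) ⟩
          n                       ∎)
          where
          open ≤-Reasoning
          S = ∑ (λ i → 𝟙 (lookup A (sp i)))
          R = ∑ (λ i → 𝟙 (lookup A (rim i)))

  -- An edge set J of the rim together with the spokes at its boundary points has all rim degrees 0 or 2.
  ∂ : (Fin n → Bool) → Fin n → Bool
  ∂ J w = J w xor J (rot⁻¹ w)

  is : Fin n → Fin n → Bool
  is v w = ⌊ v ≟F w ⌋

  boundary-even : ∀ J → (∑ (λ w → 𝟙 (∂ J w)) ≡ 0) ⊎ (∑ (λ w → 𝟙 (∂ J w)) ≡ 2) → evenTwo (wheel k) (mkSub (∂ J) J) ≡ true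
  boundary-even J h = ⇒evenTwo (mkSub (∂ J) J) λ { zero → hub h ; (suc v) → rimV v }
    where
    hubDeg : deg (wheel k) (mkSub (∂ J) J) zero ≡ ∑ (λ w → 𝟙 (∂ J w))
    hubDeg = trans (deg-hub (mkSub (∂ J) J)) (∑-cong λ i → cong 𝟙 (lookup-sp (∂ J) J i))
    hub : (∑ (λ w → 𝟙 (∂ J w)) ≡ 0) ⊎ (∑ (λ w → 𝟙 (∂ J w)) ≡ 2) → (deg (wheel k) (mkSub (∂ J) J) zero ≡ 0) ⊎ (deg (wheel k) (mkSub (∂ J) J) zero ≡ 2)
    hub (inj₁ p) = inj₁ (trans hubDeg p)
    hub (inj₂ p) = inj₂ (trans hubDeg p)
    rimV : ∀ v → (deg (wheel k) (mkSub (∂ J) J) (suc v) ≡ 0) ⊎ (deg (wheel k) (mkSub (∂ J) J) (suc v) ≡ 2)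
    rimV v rewrite deg-rim (mkSub (∂ J) J) v | lookup-sp (∂ J) J v | lookup-rim (∂ J) J v | lookup-rim (∂ J) J (rot⁻¹ v) with J v | J (rot⁻¹ v)
    ... | true | true = inj₂ refl
    ... | true | false = inj₂ refl
    ... | false | true = inj₂ refl
    ... | false | false = inj₁ refl

  -- L v: walking back from v along rim edges of A one meets a spoke of A; D measures the distance from rot e.
  module _ (A : Sub (n + n)) (forest : isForest (wheel k) A ≡ true) (e : Fin n) (e∉A : rim e ∉ A)
    (L : Fin n → Bool) (L-step : ∀ v → L (rot v) ≡ lookup A (sp (rot v)) ∨ (lookup A (rim v) ∧ L v))
    (D : Fin n → ℕ) (D-step : ∀ v → rim v ∈ A → D (rot v) ≡ suc (D v)) where

    private
      s r : Fin n → Bool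
      s i = lookup A (sp i)
      r i = lookup A (rim i)

    -- `J` is the set of rim edges of a walk from a spoke vertex `i` to `v`, described by its
    -- boundary modulo 2. The inequality on `D` records that the walk has not gone around the cycle.
    Path : Fin n → Fin n → Set
    Path i v = ∃ λ (J : Fin n → Bool) → s i ≡ true × (∀ w → J w ≡ true → r w ≡ true) × (∀ w → ∂ J w ≡ is i w xor is v w) × D i ≤ D v

    extend : ∀ i v → r v ≡ true → Path i v → Path i (rot v)
    extend i v p (J , si , sub , bd , le) = (λ w → J w xor is v w) , si , sub' , bd' , ≤-trans le (≤-trans (n≤1+n _) (≤-reflexive (sym (D-step v p))))
      where
      sub' : ∀ w → J w xor is v w ≡ true → r w ≡ true
      sub' w q with bool (J w)
      ... | inj₁ j = sub w j
      ... | inj₂ j = subst (λ x → r x ≡ true) (≟F-true {x = v} (trans (cong (_xor is v w) (sym j)) q)) p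
      bd' : ∀ w → (J w xor is v w) xor (J (rot⁻¹ w) xor is v (rot⁻¹ w)) ≡ is i w xor is (rot v) w
      bd' w = trans (xor-swap (J w) (is v w) (J (rot⁻¹ w)) (is v (rot⁻¹ w)))
          (trans (cong₂ _xor_ (bd w) (cong (is v w xor_) edge)) (xor-cancel (is i w) (is v w) (is (rot v) w)))
        where
        edge : is v (rot⁻¹ w) ≡ is (rot v) w
        edge = bool-ext
          (λ h → subst (λ x → is x w ≡ true) (trans (sym (rot-rot⁻¹ w)) (cong rot (sym (≟F-true {x = v} h)))) (≟F-diag w))
          (λ h → subst (λ x → is v x ≡ true) (trans (sym (rot⁻¹-rot v)) (cong rot⁻¹ (≟F-true {x = rot v} h))) (≟F-diag v))

    path : ∀ v → L v ≡ true → ∃ λ i → Path i v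
    path = rot-induction (λ v → L v ≡ true → ∃ λ i → Path i v) (rot e) (λ p → atSpoke (rot e) (base p)) step
      where
      atSpoke : ∀ v → s v ≡ true → ∃ λ i → Path i v
      atSpoke v p = v , (λ _ → false) , p , (λ _ ()) , (λ w → sym (xor-self (is v w))) , ≤-refl
      base : L (rot e) ≡ true → s (rot e) ≡ true
      base p with ∨-elim {s (rot e)} (trans (sym (L-step e)) p)
      ... | inj₁ q = q
      ... | inj₂ q = ⊥-elim (true≢false (∧-elimˡ q) e∉A)
      step : ∀ v → (L v ≡ true → ∃ λ i → Path i v) → L (rot v) ≡ true → ∃ λ i → Path i (rot v)
      step v ih p with ∨-elim {s (rot v)} (trans (sym (L-step v)) p)
      ... | inj₁ q = atSpoke (rot v) q
      ... | inj₂ q = let i , h = ih (∧-elimʳ {r v} q) in i , extend i v (∧-elimˡ q) h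

    -- The walk from `i` to `rot v` together with the spokes at its two ends would be a cycle of
    -- `A`. These ends differ because `D` increases strictly along the last edge.
    noCycle : ∀ v → L v ≡ true → r v ≡ true → s (rot v) ≡ true → ⊥
    noCycle v l p q with path v l
    ... | i , pth@(_ , si , _ , _ , le) with extend i v p pth
    ...   | J , _ , sub , bd , _ = forest⇒ A forest (mkSub (∂ J) J) inA (boundary-even J (inj₂ two)) (sp i)
              (trans (lookup-sp (∂ J) J i) (trans (bd i) (cong₂ _xor_ (≟F-diag i) (apart i (≟F-diag i)))))
      where
      i≢ : i ≢ rot v
      i≢ refl = <-irrefl refl (≤-trans (≤-reflexive (sym (D-step v p))) le)
      apart : ∀ w → is i w ≡ true → is (rot v) w ≡ false
      apart w a = ¬true⇒false λ b → i≢ (trans (≟F-true {x = i} a) (sym (≟F-true {x = rot v} b)))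
      inA : mkSub (∂ J) J ⊆ A
      inA = mk⊆ (elements (λ w h → spokes w (trans (sym (bd w)) (trans (sym (lookup-sp (∂ J) J w)) h)))
          (λ w h → sub w (trans (sym (lookup-rim (∂ J) J w)) h)))
        where
        spokes : ∀ w → is i w xor is (rot v) w ≡ true → s w ≡ true
        spokes w h with bool (is i w)
        ... | inj₁ a = subst (λ x → s x ≡ true) (≟F-true {x = i} a) si
        ... | inj₂ a = subst (λ x → s x ≡ true) (≟F-true {x = rot v} (trans (cong (_xor is (rot v) w) (sym a)) h)) q
      two : ∑ (λ w → 𝟙 (∂ J w)) ≡ 2
      two = trans (∑-cong λ w → trans (cong 𝟙 (bd w)) (sum w)) (trans (∑-+ (𝟙 ∘ is i) (𝟙 ∘ is (rot v))) (cong₂ _+_ (∑-delta i) (∑-delta (rot v))))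
        where
        sum : ∀ w → 𝟙 (is i w xor is (rot v) w) ≡ 𝟙 (is i w) + 𝟙 (is (rot v) w)
        sum w with is i w | is (rot v) w | apart w
        ... | true | true | f with () ← f refl
        ... | true | false | _ = refl
        ... | false | b | _ = refl

    -- Each rim edge v is assigned to its end rot v if L v, to v otherwise; this is injective on A.
    hall : Hall A
    hall C sub = begin
      card C                          ≡⟨ card-elements C ⟩
      ∑ (λ v → 𝟙 (c v)) + ∑ (λ v → 𝟙 (d v)) ≡⟨ cong (∑ (λ v → 𝟙 (c v)) +_)
          (trans (∑-cong split) (trans (∑-+ (λ v → 𝟙 (d v ∧ not (L v))) (λ v → 𝟙 (d v ∧ L v)))
          (cong (∑ (λ v → 𝟙 (d v ∧ not (L v))) +_) (sym (∑-rot⁻¹ (λ v → 𝟙 (d v ∧ L v))))))) ⟩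
      ∑ (λ v → 𝟙 (c v)) + (∑ (λ v → 𝟙 (d v ∧ not (L v))) + ∑ (λ v → 𝟙 (d (rot⁻¹ v) ∧ L (rot⁻¹ v)))) ≡⟨ cong (∑ (λ v → 𝟙 (c v)) +_)
          (∑-+ (λ v → 𝟙 (d v ∧ not (L v))) (λ v → 𝟙 (d (rot⁻¹ v) ∧ L (rot⁻¹ v)))) ⟨
      ∑ (λ v → 𝟙 (c v)) + ∑ (λ v → 𝟙 (d v ∧ not (L v)) + 𝟙 (d (rot⁻¹ v) ∧ L (rot⁻¹ v))) ≡⟨ ∑-+ (λ v → 𝟙 (c v))
          (λ v → 𝟙 (d v ∧ not (L v)) + 𝟙 (d (rot⁻¹ v) ∧ L (rot⁻¹ v))) ⟨
      ∑ (λ v → 𝟙 (c v) + (𝟙 (d v ∧ not (L v)) + 𝟙 (d (rot⁻¹ v) ∧ L (rot⁻¹ v)))) ≤⟨ ∑-mono atMostOne ⟩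
      ∑ (λ v → 𝟙 (lookup (Nb C) v))   ≡⟨ card≡∑ (Nb C) ⟨
      card (Nb C)                     ∎
      where
      open ≤-Reasoning
      c d : Fin n → Bool
      c v = lookup C (sp v)
      d v = lookup C (rim v)
      split : ∀ v → 𝟙 (d v) ≡ 𝟙 (d v ∧ not (L v)) + 𝟙 (d v ∧ L v)
      split v with d v | L v
      ... | true | true = refl
      ... | true | false = refl
      ... | false | _ = refl
      c⇒L : ∀ v → c v ≡ true → L v ≡ true
      c⇒L v p = subst (λ w → L w ≡ true) (rot-rot⁻¹ v) (trans (L-step (rot⁻¹ v))
          (∨-introˡ (subst (λ w → s w ≡ true) (sym (rot-rot⁻¹ v)) (sub .at (sp v) p))))
      d⇒L : ∀ v → d (rot⁻¹ v) ∧ L (rot⁻¹ v) ≡ true → L v ≡ true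
      d⇒L v p = subst (λ w → L w ≡ true) (rot-rot⁻¹ v) (trans (L-step (rot⁻¹ v))
          (∨-introʳ (s (rot (rot⁻¹ v))) (∧-intro (sub .at (rim (rot⁻¹ v)) (∧-elimˡ p)) (∧-elimʳ {d (rot⁻¹ v)} p))))
      c⇒d : ∀ v → c v ≡ true → d (rot⁻¹ v) ∧ L (rot⁻¹ v) ≡ true → ⊥
      c⇒d v p q = noCycle (rot⁻¹ v) (∧-elimʳ {d (rot⁻¹ v)} q) (sub .at (rim (rot⁻¹ v)) (∧-elimˡ q))
          (subst (λ w → s w ≡ true) (sym (rot-rot⁻¹ v)) (sub .at (sp v) p))
      atMostOne : ∀ v → 𝟙 (c v) + (𝟙 (d v ∧ not (L v)) + 𝟙 (d (rot⁻¹ v) ∧ L (rot⁻¹ v))) ≤ 𝟙 (lookup (Nb C) v)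
      atMostOne v with bool (c v) | bool (d (rot⁻¹ v) ∧ L (rot⁻¹ v))
      ... | inj₁ p | inj₁ q = ⊥-elim (c⇒d v p q)
      ... | inj₁ p | inj₂ q rewrite ⇒∈Nb C v (bySp p) | p | q | c⇒L v p with d v
      ...   | true = ≤-refl
      ...   | false = ≤-refl
      atMostOne v | inj₂ p | inj₁ q rewrite ⇒∈Nb C v (byRim' (∧-elimˡ q)) | p | q | d⇒L v q with d v
      ...   | true = ≤-refl
      ...   | false = ≤-refl
      atMostOne v | inj₂ p | inj₂ q rewrite p | q with bool (d v)
      ...   | inj₂ z rewrite z = z≤n
      ...   | inj₁ z rewrite ⇒∈Nb C v (byRim z) = ≤-trans (≤-reflexive (+-identityʳ _)) (𝟙≤1 _)

  -- A forest misses some rim edge `e`, since the rim is a cycle; cutting there makes the cyclic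
  -- recursions for `L` and `D` well defined. The rim set itself is represented by the first ends of
  -- its edges.
  indep⇒hall : ∀ A → indep (whirl k) A ≡ true → Hall A
  indep⇒hall A ind with ∨-elim {isForest (wheel k) A} ind
  ... | inj₂ isRim = λ C s → begin
      card C                                          ≡⟨ card-elements C ⟩
      ∑ (λ i → 𝟙 (lookup C (sp i))) + ∑ (λ i → 𝟙 (lookup C (rim i))) ≡⟨ cong (_+ ∑ (λ i → 𝟙 (lookup C (rim i)))) (∑-zero λ i → cong 𝟙 (noSp C s i)) ⟩
      ∑ (λ i → 𝟙 (lookup C (rim i)))                  ≤⟨ ∑-mono (λ i → 𝟙-mono λ p → ⇒∈Nb C i (byRim p)) ⟩
      ∑ (λ v → 𝟙 (lookup (Nb C) v))                   ≡⟨ card≡∑ (Nb C) ⟨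
      card (Nb C)                                     ∎
    where
    open ≤-Reasoning
    noSp : ∀ C → C ⊆ A → ∀ i → sp i ∉ C
    noSp C s i = ¬true⇒false λ p → true≢false (s .at (sp i) p) (trans (cong (λ X → lookup X (sp i))
        (trans (==s⇒≡ {A = A} {rimSet k} isRim) rimSet≡)) (lookup-sp (λ _ → false) (λ _ → true) i))
  ... | inj₁ forest with search {P = λ v → rim v ∉ A} {Q = λ v → rim v ∈ A} (λ v → Data.Sum.swap (bool (lookup A (rim v))))
  ...   | inj₂ allRim = ⊥-elim (forest⇒ A forest (mkSub (∂ (λ _ → true)) (λ _ → true))
            (mk⊆ (elements (λ i p → ⊥-elim (true≢false p (lookup-sp (∂ (λ _ → true)) (λ _ → true) i))) (λ i _ → allRim i)))
            (boundary-even (λ _ → true) (inj₁ (∑-zero {n} λ _ → refl))) (rim zero) (lookup-rim (∂ (λ _ → true)) (λ _ → true) zero))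
  ...   | inj₁ (e , e∉A) = hall A forest e e∉A LRec.cycRec LRec.cycRec-step DRec.cycRec D-step
    where
    s r : Fin n → Bool
    s i = lookup A (sp i)
    r i = lookup A (rim i)
    module LRec = CyclicRecursion rot rot⁻¹ rot⁻¹-rot rot-induction false
      (λ v b → s (rot v) ∨ (r v ∧ b)) e (λ b b' → cong (λ c → s (rot e) ∨ c) (trans (cong (_∧ b) e∉A) (cong (_∧ b') (sym e∉A))))
    module DRec = CyclicRecursion rot rot⁻¹ rot⁻¹-rot rot-induction 0
      (λ v d → if is e v then 0 else suc d) e (λ d d' → trans (cong (λ b → if b then 0 else suc d) (≟F-diag e))
          (cong (λ b → if b then 0 else suc d') (sym (≟F-diag e))))
    D-step : ∀ v → r v ≡ true → DRec.cycRec (rot v) ≡ suc (DRec.cycRec v)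
    D-step v p = trans (DRec.cycRec-step v) (cong (λ b → if b then 0 else suc (DRec.cycRec v))
      (¬true⇒false {is e v} λ q → true≢false p (subst (λ w → r w ≡ false) (≟F-true {x = e} q) e∉A)))

  whirl-isMatroid : IsMatroid (whirl k)
  whirl-isMatroid = hall-isMatroid (indep (whirl k)) indep⇒hall hall⇒indep

-- Flats of whirls

∑-squeeze : ∀ {n} {f g : Fin n → ℕ} → (∀ i → f i ≤ g i) → ∑ g ≤ ∑ f → ∀ i → g i ≤ f i
∑-squeeze {suc n} {f} {g} h le zero = +-cancelʳ-≤ (∑ (f ∘ suc)) _ _ (≤-trans (+-monoʳ-≤ (g zero) (∑-mono (h ∘ suc))) le)
∑-squeeze {suc n} {f} {g} h le (suc i) = ∑-squeeze {f = f ∘ suc} {g ∘ suc} (h ∘ suc)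
  (+-cancelˡ-≤ (f zero) _ _ (≤-trans (+-monoˡ-≤ (∑ (g ∘ suc)) (h zero)) le)) i

rot≢ : ∀ {k} (v : Fin (suc (suc k))) → v ≢ rot v
rot≢ v e with view v
... | ‵inject₁ j = 1+n≢n (trans (cong toℕ (trans (sym (rot-inject₁ j)) (sym e))) (toℕ-inject₁ j))
... | ‵fromℕ {n = suc n} with () ← trans e (rot-fromℕ (suc n))

-- Assuming rot≢ rather than k = suc k′ keeps the list of all subsets from unfolding.
module WhirlFlats (k : ℕ) (rot≢ : (v : Fin (suc k)) → v ≢ rot v) where

  n = suc k

  open Elements k public

  M : RawMatroid
  M = whirl k

  open Rank M whirl-isMatroid public

  sp≢rim : ∀ v w → sp v ≢ rim w
  sp≢rim v w e with trans (sym (splitAt-↑ˡ n v n)) (trans (cong (splitAt n) e) (splitAt-↑ʳ n n w))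
  ... | ()

  private
    hall-count : ∀ A (f : Sub (n + n) → Fin n → ℕ) →
      (∀ C → card C ≡ ∑ (f C)) → (∀ C → C ⊆ A → ∀ v → f C v ≤ 𝟙 (lookup (Nb C) v)) → Hall A
    hall-count A f count le C s = subst₂ _≤_ (sym (count C)) (sym (card≡∑ (Nb C))) (∑-mono (le C s))

    atMostOne : ∀ {a b c} → (a ≡ true → b ≡ true → ⊥) → (a ≡ true → c ≡ true) → (b ≡ true → c ≡ true) → 𝟙 a + 𝟙 b ≤ 𝟙 c
    atMostOne {true} {true} x p q = ⊥-elim (x refl refl)
    atMostOne {true} {false} x p q rewrite p refl = ≤-refl
    atMostOne {false} {b} x p q = 𝟙-mono q

  pair : Sub (n + n) → Fin n → ℕ
  pair C v = 𝟙 (lookup C (sp v)) + 𝟙 (lookup C (rim v))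

  card≡pair : ∀ C → card C ≡ ∑ (pair C)
  card≡pair C = trans (card-elements C) (sym (∑-+ (λ v → 𝟙 (lookup C (sp v))) (λ v → 𝟙 (lookup C (rim v)))))

  pair≤Nb : ∀ A → (∀ v → sp v ∈ A → rim v ∈ A → ⊥) → ∀ C → C ⊆ A → ∀ v → pair C v ≤ 𝟙 (lookup (Nb C) v)
  pair≤Nb A h C s v = atMostOne (λ p q → h v (s .at (sp v) p) (s .at (rim v) q)) (λ p → ⇒∈Nb C v (bySp p)) (λ p → ⇒∈Nb C v (byRim p))

  -- Spokes are represented by their rim vertices and each rim edge `v` by its end `v`; `hall-right`
  -- uses the end `rot v` instead.
  hall-left : ∀ A → (∀ v → sp v ∈ A → rim v ∈ A → ⊥) → Hall A
  hall-left A h = hall-count A pair card≡pair (pair≤Nb A h)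

  hall-right : ∀ A → (∀ v → sp (rot v) ∈ A → rim v ∈ A → ⊥) → Hall A
  hall-right A h = hall-count A (λ C v → 𝟙 (lookup C (sp v)) + 𝟙 (lookup C (rim (rot⁻¹ v))))
    (λ C → trans (card-elements C) (trans (cong (∑ (λ v → 𝟙 (lookup C (sp v))) +_) (sym (∑-rot⁻¹ (λ v → 𝟙 (lookup C (rim v))))))
      (sym (∑-+ (λ v → 𝟙 (lookup C (sp v))) (λ v → 𝟙 (lookup C (rim (rot⁻¹ v))))))))
    (λ C s v → atMostOne (λ p q → h (rot⁻¹ v) (subst (λ w → sp w ∈ A) (sym (rot-rot⁻¹ v)) (s .at (sp v) p)) (s .at (rim (rot⁻¹ v)) q))
      (λ p → ⇒∈Nb C v (bySp p)) (λ p → ⇒∈Nb C v (byRim' p)))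

  indep≤Nb : ∀ I → indep M I ≡ true → card I ≤ card (Nb I)
  indep≤Nb I i = indep⇒hall I i I ⊆-refl

  rank≤Nb : ∀ A → rank M A ≤ card (Nb A)
  rank≤Nb A with basis A
  ... | I , s , i , c = subst (_≤ card (Nb A)) c (≤-trans (indep≤Nb I i) (card-mono (Nb-mono s)))

  rank-hall : ∀ {A} → Hall A → rank M A ≡ card A
  rank-hall {A} h = rank-ind (hall⇒indep A h)

  whirl-loopless : Loopless M
  whirl-loopless x = ≡⇒T (hall⇒indep (single x) (hall-left (single x) λ v p q → sp≢rim v v (trans (sym (∈single⇒≡ p)) (∈single⇒≡ q))))

  -- The local description of a flat. The first three conditions express that `sp v`, `sp (rot v)`
  -- and `rim v` form a circuit; the last one, that the rim already has full rank.
  record Closed (F : Sub (n + n)) : Set where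
    field
      fill   : ∀ v → sp v ∈ F → sp (rot v) ∈ F → rim v ∈ F
      right  : ∀ v → rim v ∈ F → sp v ∈ F → sp (rot v) ∈ F
      left   : ∀ v → rim v ∈ F → sp (rot v) ∈ F → sp v ∈ F
      notRim : (∀ v → sp v ∉ F) → (∀ v → rim v ∈ F) → ⊥

  -- A block with spokes contributes its number of vertices, one without spokes its number of rim
  -- edges; a rim edge is charged to its end `v`, unless that vertex has been charged for its spoke.
  rankTerm : Sub (n + n) → Fin n → ℕ
  rankTerm F v = 𝟙 (lookup F (sp v)) + 𝟙 (not (lookup F (sp v)) ∧ lookup F (rim v))

  module _ (F : Sub (n + n)) where
    private
      s r : Fin n → Bool
      s v = lookup F (sp v)
      r v = lookup F (rim v)

    base : Sub (n + n)
    base = mkSub s (λ v → not (s v) ∧ r v)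

    private
      base-sp : ∀ v → lookup base (sp v) ≡ s v
      base-sp = lookup-sp s (λ v → not (s v) ∧ r v)

      base-rim : ∀ v → lookup base (rim v) ≡ not (s v) ∧ r v
      base-rim = lookup-rim s (λ v → not (s v) ∧ r v)

    base-disjoint : ∀ v → sp v ∈ base → rim v ∈ base → ⊥
    base-disjoint v p q = true≢false (trans (sym (base-sp v)) p) (not-true (∧-elimˡ (trans (sym (base-rim v)) q)))

    base⊆ : base ⊆ F
    base⊆ = mk⊆ (elements (λ v p → trans (sym (base-sp v)) p) (λ v p → ∧-elimʳ {not (s v)} (trans (sym (base-rim v)) p)))

    base-hall : Hall base
    base-hall = hall-left base base-disjoint

    card-base : card base ≡ ∑ (rankTerm F)
    card-base = trans (card-mkSub s (λ v → not (s v) ∧ r v)) (sym (∑-+ (λ v → 𝟙 (s v)) (λ v → 𝟙 (not (s v) ∧ r v))))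

    -- Lower bound by `base`. For the upper bound, the spokes of an independent `I` and its rim
    -- edges starting at spoke vertices meet only spoke vertices, so Hall's condition bounds them
    -- jointly by the number of spokes of `F`; the other rim edges are counted one by one.
    rank-right-closed : (∀ v → rim v ∈ F → sp v ∈ F → sp (rot v) ∈ F) → rank M F ≡ ∑ (rankTerm F)
    rank-right-closed right = ≤-antisym upper (subst (_≤ rank M F) card-base (rank-≥ M base⊆ (hall⇒indep base base-hall)))
      where
      upper : rank M F ≤ ∑ (rankTerm F)
      upper with basis F
      ... | I , sub , i , c = begin
          rank M F                        ≡⟨ c ⟨
          card I                          ≡⟨ trans (card-elements I) (cong (∑ (𝟙 ∘ x) +_)
              (trans (∑-cong split) (∑-+ (λ v → 𝟙 (y v ∧ s v)) (λ v → 𝟙 (y v ∧ not (s v)))))) ⟩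
          ∑ (𝟙 ∘ x) + (∑ (λ v → 𝟙 (y v ∧ s v)) + ∑ (λ v → 𝟙 (y v ∧ not (s v)))) ≡⟨ +-assoc (∑ (𝟙 ∘ x)) _ _ ⟨
          ∑ (𝟙 ∘ x) + ∑ (λ v → 𝟙 (y v ∧ s v)) + ∑ (λ v → 𝟙 (y v ∧ not (s v))) ≡⟨ cong (_+ ∑ (λ v → 𝟙 (y v ∧ not (s v))))
              (card-mkSub x (λ v → y v ∧ s v)) ⟨
          card H + ∑ (λ v → 𝟙 (y v ∧ not (s v)))   ≤⟨ +-mono-≤ (≤-trans (indep⇒hall I i H H⊆I) NbH≤) (∑-mono λ v → 𝟙-mono (rest v)) ⟩
          ∑ (𝟙 ∘ s) + ∑ (λ v → 𝟙 (not (s v) ∧ r v)) ≡⟨ ∑-+ (𝟙 ∘ s) (λ v → 𝟙 (not (s v) ∧ r v)) ⟨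
          ∑ (rankTerm F)                  ∎
        where
        open ≤-Reasoning
        x y : Fin n → Bool
        x v = lookup I (sp v)
        y v = lookup I (rim v)
        H = mkSub x (λ v → y v ∧ s v)
        H-sp = lookup-sp x (λ v → y v ∧ s v)
        H-rim = lookup-rim x (λ v → y v ∧ s v)
        H⊆I : H ⊆ I
        H⊆I = mk⊆ (elements (λ v p → trans (sym (H-sp v)) p) (λ v p → ∧-elimˡ (trans (sym (H-rim v)) p)))
        split : ∀ v → 𝟙 (y v) ≡ 𝟙 (y v ∧ s v) + 𝟙 (y v ∧ not (s v))
        split v with y v | s v
        ... | true | true = refl
        ... | true | false = refl
        ... | false | _ = refl
        rest : ∀ v → y v ∧ not (s v) ≡ true → not (s v) ∧ r v ≡ true
        rest v p = ∧-intro (∧-elimʳ {y v} p) (sub .at (rim v) (∧-elimˡ p))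
        NbH⇒s : ∀ v → Incident H v → s v ≡ true
        NbH⇒s v (bySp p) = sub .at (sp v) (trans (sym (H-sp v)) p)
        NbH⇒s v (byRim p) = ∧-elimʳ {y v} (trans (sym (H-rim v)) p)
        NbH⇒s v (byRim' p) = subst (λ w → s w ≡ true) (rot-rot⁻¹ v) (right (rot⁻¹ v) (sub .at (rim (rot⁻¹ v)) (∧-elimˡ q)) (∧-elimʳ {y (rot⁻¹ v)} q))
          where q = trans (sym (H-rim (rot⁻¹ v))) p
        NbH≤ : card (Nb H) ≤ ∑ (𝟙 ∘ s)
        NbH≤ = ≤-trans (≤-reflexive (card≡∑ (Nb H))) (∑-mono λ v → 𝟙-mono λ p → NbH⇒s v (∈Nb⇒ H v p))

    -- If adding `x` to `base` destroys independence, a tight `C` already meets the ends of `x`. One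
    -- of these ends carries no spoke of `F`, by `fill` when `x` is a rim edge.
    closed⇒flat : Closed F → Flat F
    closed⇒flat cl x x∉F with dependent⇒tight {base} x base-hall
    ... | inj₁ h = subst₂ _≤_
            (trans (card-insert base x (¬true⇒false λ p → true≢false (base⊆ .at x p) x∉F))
                (cong suc (trans card-base (sym (rank-right-closed (Closed.right cl))))))
            refl (rank-≥ M (∪-mono base⊆ (⊆-refl {A = single x})) (hall⇒indep (base ∪s single x) h))
    ... | inj₂ (C , (C⊆ , tight) , Nbx) = ⊥-elim (elements {X = λ x → x ∉ F → Nb (single x) ⊆ Nb C → ⊥} atSp atRim x x∉F Nbx)
      where
      open Closed cl
      -- Tightness turns the inequality `pair≤Nb` into an equality at every vertex: a vertex met by
      -- `C` has its own spoke or its own rim edge in `C`.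
      full : ∀ v → 𝟙 (lookup (Nb C) v) ≤ pair C v
      full = ∑-squeeze (pair≤Nb base base-disjoint C C⊆) (subst₂ _≤_ (card≡∑ (Nb C)) (card≡pair C) tight)
      rim∈C : ∀ v → v ∈ Nb C → s v ≡ false → rim v ∈ C
      rim∈C v p q with lookup C (rim v) | lookup C (sp v) in eq | full v
      ... | true | _ | _ = refl
      ... | false | true | _ = ⊥-elim (true≢false (trans (sym (base-sp v)) (C⊆ .at (sp v) eq)) q)
      ... | false | false | le rewrite p with () ← le
      rim∈F : ∀ v → rim v ∈ C → r v ≡ true
      rim∈F v p = base⊆ .at (rim v) (C⊆ .at (rim v) p)
      -- the tight set propagates around the whole rim
      step : ∀ v → (v ∈ Nb C × s v ≡ false) → (rot v ∈ Nb C × s (rot v) ≡ false)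
      step v (p , q) = ⇒∈Nb C (rot v) (byRim' (subst (λ w → rim w ∈ C) (sym (rot⁻¹-rot v)) (rim∈C v p q))) ,
        ¬true⇒false λ z → true≢false (left v (rim∈F v (rim∈C v p q)) z) q
      impossible : ∀ v → v ∈ Nb C → s v ≡ false → ⊥
      impossible v p q = notRim (λ w → proj₂ (all w)) (λ w → rim∈F w (rim∈C w (proj₁ (all w)) (proj₂ (all w))))
        where
        all : ∀ w → w ∈ Nb C × s w ≡ false
        all = rot-induction (λ v → v ∈ Nb C × s v ≡ false) v (p , q) step
      atSp : ∀ v → sp v ∉ F → Nb (single (sp v)) ⊆ Nb C → ⊥
      atSp v p sub = impossible v (sub .at v (⇒∈Nb (single (sp v)) v (bySp (x∈single (sp v))))) p
      atRim : ∀ v → rim v ∉ F → Nb (single (rim v)) ⊆ Nb C → ⊥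
      atRim v p sub with bool (s v) | bool (s (rot v))
      ... | inj₂ q | _ = impossible v (sub .at v (⇒∈Nb (single (rim v)) v (byRim (x∈single (rim v))))) q
      ... | inj₁ _ | inj₂ q = impossible (rot v) (sub .at (rot v) (⇒∈Nb (single (rim v)) (rot v)
              (byRim' (subst (λ w → rim w ∈ single (rim v)) (sym (rot⁻¹-rot v)) (x∈single (rim v)))))) q
      ... | inj₁ a | inj₁ b = true≢false (fill v a b) p

    -- Any two elements of a triangle have rank 2, as has the triangle, so the third lies in their
    -- closure. The three flags of `tri` select elements of the triangle at `v`.
    flat⇒closed : Flat F → Closed F
    flat⇒closed fl = record { fill = fill ; right = right ; left = left ; notRim = notRim }
      where
      tri : Bool → Bool → Bool → Fin n → Sub (n + n)
      tri a b c v = mkSub (λ w → (a ∧ is v w) ∨ (b ∧ is (rot v) w)) (λ w → c ∧ is v w)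
      tri-sp : ∀ a b c v w → lookup (tri a b c v) (sp w) ≡ (a ∧ is v w) ∨ (b ∧ is (rot v) w)
      tri-sp a b c v = lookup-sp (λ w → (a ∧ is v w) ∨ (b ∧ is (rot v) w)) (λ w → c ∧ is v w)
      tri-rim : ∀ a b c v w → lookup (tri a b c v) (rim w) ≡ c ∧ is v w
      tri-rim a b c v = lookup-rim (λ w → (a ∧ is v w) ∨ (b ∧ is (rot v) w)) (λ w → c ∧ is v w)
      tri⊆ : ∀ a b c v {A : Sub (n + n)} → (a ≡ true → sp v ∈ A) → (b ≡ true → sp (rot v) ∈ A) → (c ≡ true → rim v ∈ A) → tri a b c v ⊆ A
      tri⊆ a b c v {A} f g h = mk⊆ (elements (λ w p → spokes w (∨-elim (trans (sym (tri-sp a b c v w)) p)))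
          (λ w p → rims w (trans (sym (tri-rim a b c v w)) p)))
        where
        spokes : ∀ w → (a ∧ is v w ≡ true) ⊎ (b ∧ is (rot v) w ≡ true) → sp w ∈ A
        spokes w (inj₁ p) = subst (λ u → sp u ∈ A) (≟F-true {x = v} (∧-elimʳ {a} p)) (f (∧-elimˡ p))
        spokes w (inj₂ p) = subst (λ u → sp u ∈ A) (≟F-true {x = rot v} (∧-elimʳ {b} p)) (g (∧-elimˡ p))
        rims : ∀ w → c ∧ is v w ≡ true → rim w ∈ A
        rims w p = subst (λ u → rim u ∈ A) (≟F-true {x = v} (∧-elimʳ {c} p)) (h (∧-elimˡ p))
      apart : ∀ v w → is v w ≡ true → is (rot v) w ≡ true → ⊥
      apart v w p q = rot≢ v (trans (≟F-true {x = v} p) (sym (≟F-true {x = rot v} q)))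
      two : ∀ v → ∑ (λ w → 𝟙 (is v w ∨ is (rot v) w)) ≡ 2
      two v = trans (∑-cong sum) (trans (∑-+ (𝟙 ∘ is v) (𝟙 ∘ is (rot v))) (cong₂ _+_ (∑-delta v) (∑-delta (rot v))))
        where
        sum : ∀ w → 𝟙 (is v w ∨ is (rot v) w) ≡ 𝟙 (is v w) + 𝟙 (is (rot v) w)
        sum w with is v w | is (rot v) w | apart v w
        ... | true | true | f = ⊥-elim (f refl refl)
        ... | true | false | _ = refl
        ... | false | _ | _ = refl
      rank-triangle : ∀ v → rank M (tri true true true v) ≤ 2
      rank-triangle v = ≤-trans (rank≤Nb (tri true true true v)) (≤-trans (≤-reflexive (card≡∑ (Nb (tri true true true v))))
          (≤-trans (∑-mono λ w → 𝟙-mono λ p → near w (∈Nb⇒ (tri true true true v) w p)) (≤-reflexive (two v))))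
        where
        near : ∀ w → Incident (tri true true true v) w → is v w ∨ is (rot v) w ≡ true
        near w (bySp p) = trans (sym (tri-sp true true true v w)) p
        near w (byRim p) = ∨-introˡ (trans (sym (tri-rim true true true v w)) p)
        near w (byRim' p) = ∨-introʳ (is v w) (subst (λ u → is (rot v) u ≡ true)
            (trans (cong rot (≟F-true {x = v} (trans (sym (tri-rim true true true v (rot⁻¹ w))) p))) (rot-rot⁻¹ w)) (≟F-diag (rot v)))
      spanned : ∀ a b c v x → tri a b c v ⊆ F → x ∈ tri true true true v → Hall (tri a b c v) → card (tri a b c v) ≡ 2 → x ∈ F
      spanned a b c v x sub x∈ h two = cl-least fl sub .at x (⇒∈cl {tri a b c v} x (≤-trans (≤-trans
        (rank-mono (∪-least (tri⊆ a b c v (λ _ → ∈sp) (λ _ → ∈sp') (λ _ → ∈rim)) (single⊆ (tri true true true v) x∈))) (rank-triangle v))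
        (≤-reflexive (sym (trans (rank-hall h) two)))))
        where
        ∈sp : sp v ∈ tri true true true v
        ∈sp = trans (tri-sp true true true v v) (∨-introˡ (≟F-diag v))
        ∈sp' : sp (rot v) ∈ tri true true true v
        ∈sp' = trans (tri-sp true true true v (rot v)) (∨-introʳ (is v (rot v)) (≟F-diag (rot v)))
        ∈rim : rim v ∈ tri true true true v
        ∈rim = trans (tri-rim true true true v v) (≟F-diag v)
      none : ∀ {f : Fin n → Bool} → (∀ w → f w ≡ false) → ∑ (λ w → 𝟙 (f w)) ≡ 0
      none h = ∑-zero λ w → cong 𝟙 (h w)
      fill : ∀ v → sp v ∈ F → sp (rot v) ∈ F → rim v ∈ F
      fill v p q = spanned true true false v (rim v) (tri⊆ true true false v (λ _ → p) (λ _ → q) λ ())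
        (trans (tri-rim true true true v v) (≟F-diag v))
        (hall-left (tri true true false v) λ w _ z → true≢false z (tri-rim true true false v w))
        (trans (card-mkSub (λ w → is v w ∨ is (rot v) w) (λ w → false)) (cong₂ _+_ (two v) (∑-zero {n} λ _ → refl)))
      right : ∀ v → rim v ∈ F → sp v ∈ F → sp (rot v) ∈ F
      right v p q = spanned true false true v (sp (rot v)) (tri⊆ true false true v (λ _ → q) (λ ()) (λ _ → p))
        (trans (tri-sp true true true v (rot v)) (∨-introʳ (is v (rot v)) (≟F-diag (rot v))))
        (hall-right (tri true false true v) λ w y z → rot≢ v (trans (≟F-true {x = v}
            (trans (sym (∨-identityʳ _)) (trans (sym (tri-sp true false true v (rot w))) y)))
          (cong rot (sym (≟F-true {x = v} (trans (sym (tri-rim true false true v w)) z))))))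
        (trans (card-mkSub (λ w → is v w ∨ false) (is v)) (cong₂ _+_ (trans (∑-cong λ w → cong 𝟙 (∨-identityʳ (is v w))) (∑-delta v)) (∑-delta v)))
      left : ∀ v → rim v ∈ F → sp (rot v) ∈ F → sp v ∈ F
      left v p q = spanned false true true v (sp v) (tri⊆ false true true v (λ ()) (λ _ → q) (λ _ → p))
        (trans (tri-sp true true true v v) (∨-introˡ (≟F-diag v)))
        (hall-left (tri false true true v) λ w y z → apart v w (trans (sym (tri-rim false true true v w)) z)
            (trans (sym (tri-sp false true true v w)) y))
        (trans (card-mkSub (is (rot v)) (is v)) (cong₂ _+_ (∑-delta (rot v)) (∑-delta v)))
      -- The rim alone has rank `n`, so no spoke could raise the rank.
      notRim : (∀ v → sp v ∉ F) → (∀ v → rim v ∈ F) → ⊥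
      notRim p q = <-irrefl refl (≤-trans (subst (_< rank M (F ∪s single (sp zero))) rank≡n (fl (sp zero) (p zero)))
          (≤-trans (rank≤Nb (F ∪s single (sp zero))) (card≤ (Nb (F ∪s single (sp zero))))))
        where
        rank≡n : rank M F ≡ n
        rank≡n = trans (rank-hall (hall-left F λ v z _ → true≢false z (p v))) (trans (card-elements F)
          (cong₂ _+_ (none p) (trans (∑-cong λ v → cong 𝟙 (q v)) (trans (∑-const n 1) (*-identityʳ n)))))

  rk-whirl : rk M ≡ n
  rk-whirl = trans (rank-right-closed fulls (λ v _ _ → x∈full (sp (rot v))))
    (trans (∑-cong λ v → cong (λ b → 𝟙 b + 𝟙 (not b ∧ lookup fulls (rim v))) (x∈full (sp v))) (trans (∑-const n 1) (*-identityʳ n)))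

-- Words and their potentials

-- The letters of `A` before position `i` plus those of `B` from `i` on: the height of the path
-- raised by `card B`, so as to remain in ℕ.
pot : ∀ {m} → Sub m → Sub m → Fin m → ℕ
pot (a ∷ A) (b ∷ B) zero = card (b ∷ B)
pot (a ∷ A) (b ∷ B) (suc i) = 𝟙 a + pot A B i

card-∷ : ∀ {m} b (B : Sub m) → card (b ∷ B) ≡ 𝟙 b + card B
card-∷ true B = refl
card-∷ false B = refl

pot-inject₁ : ∀ {m} (A B : Sub (suc m)) (j : Fin m) →
              pot A B (suc j) + 𝟙 (lookup B (inject₁ j)) ≡ pot A B (inject₁ j) + 𝟙 (lookup A (inject₁ j))
pot-inject₁ (a ∷ a' ∷ A) (b ∷ b' ∷ B) zero = begin
  𝟙 a + card (b' ∷ B) + 𝟙 b    ≡⟨ +-assoc (𝟙 a) (card (b' ∷ B)) (𝟙 b) ⟩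
  𝟙 a + (card (b' ∷ B) + 𝟙 b)  ≡⟨ cong (𝟙 a +_) (trans (+-comm (card (b' ∷ B)) (𝟙 b)) (sym (card-∷ b (b' ∷ B)))) ⟩
  𝟙 a + card (b ∷ b' ∷ B)      ≡⟨ +-comm (𝟙 a) (card (b ∷ b' ∷ B)) ⟩
  card (b ∷ b' ∷ B) + 𝟙 a      ∎
  where open ≡-Reasoning
pot-inject₁ (a ∷ a' ∷ A) (b ∷ b' ∷ B) (suc j) =
  trans (+-assoc (𝟙 a) _ _) (trans (cong (𝟙 a +_) (pot-inject₁ (a' ∷ A) (b' ∷ B) j)) (sym (+-assoc (𝟙 a) _ _)))

pot-fromℕ : ∀ {m} (A B : Sub (suc m)) → pot A B (fromℕ m) + 𝟙 (lookup A (fromℕ m)) ≡ card A + 𝟙 (lookup B (fromℕ m))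
pot-fromℕ (a ∷ []) (b ∷ []) = trans (cong₂ _+_ (card-∷ b []) refl) (trans (cong (_+ 𝟙 a) (+-identityʳ (𝟙 b)))
  (trans (+-comm (𝟙 b) (𝟙 a)) (cong (_+ 𝟙 b) (trans (sym (+-identityʳ (𝟙 a))) (sym (card-∷ a []))))))
pot-fromℕ {suc m} (a ∷ a' ∷ A) (b ∷ b' ∷ B) = trans (+-assoc (𝟙 a) _ _) (trans (cong (𝟙 a +_) (pot-fromℕ (a' ∷ A) (b' ∷ B)))
  (trans (sym (+-assoc (𝟙 a) _ _)) (cong (_+ 𝟙 (lookup (b' ∷ B) (fromℕ m))) (sym (card-∷ a (a' ∷ A))))))

Potential : ∀ {k} → (a b : Fin (suc k) → Bool) → (Fin (suc k) → ℕ) → Set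
Potential a b h = ∀ v → h (rot v) + 𝟙 (b v) ≡ h v + 𝟙 (a v)

pot-potential : ∀ {k} (A B : Sub (suc k)) → card A ≡ card B → Potential (lookup A) (lookup B) (pot A B)
pot-potential {k} A B bal v with view v
... | ‵inject₁ j rewrite rot-inject₁ j = pot-inject₁ A B j
... | ‵fromℕ rewrite rot-fromℕ k = trans (cong (_+ 𝟙 (lookup B (fromℕ k))) (trans (pot-zero A B) (sym bal))) (sym (pot-fromℕ A B))
  where
  pot-zero : ∀ (A B : Sub (suc k)) → pot A B zero ≡ card B
  pot-zero (a ∷ A) (b ∷ B) = refl

potential-balanced : ∀ {k} {a b : Fin (suc k) → Bool} {h} → Potential a b h → ∑ (𝟙 ∘ a) ≡ ∑ (𝟙 ∘ b)
potential-balanced {a = a} {b} {h} p = sym (+-cancelˡ-≡ (∑ h) _ _ (begin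
  ∑ h + ∑ (𝟙 ∘ b)                 ≡⟨ cong (_+ ∑ (𝟙 ∘ b)) (∑-rot h) ⟨
  ∑ (h ∘ rot) + ∑ (𝟙 ∘ b)         ≡⟨ ∑-+ (h ∘ rot) (𝟙 ∘ b) ⟨
  ∑ (λ v → h (rot v) + 𝟙 (b v))   ≡⟨ ∑-cong p ⟩
  ∑ (λ v → h v + 𝟙 (a v))         ≡⟨ ∑-+ h (𝟙 ∘ a) ⟩
  ∑ h + ∑ (𝟙 ∘ a)                 ∎))
  where open ≡-Reasoning

+-shuffle : ∀ x y z → x + y + z ≡ x + z + y
+-shuffle x y z = trans (+-assoc x y z) (trans (cong (x +_) (+-comm y z)) (sym (+-assoc x z y)))

-- Two potentials of a word differ by a constant. The involution produces a potential that is not of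
-- the form `pot`, while `hub` is defined through `pot`.
potential-unique : ∀ {k} {a b : Fin (suc k) → Bool} {h g} → Potential a b h → Potential a b g → ∀ v w → h v + g w ≡ g v + h w
potential-unique {a = a} {b} {h} {g} p q v w = rot-induction (λ v → h v + g w ≡ g v + h w) w (+-comm (h w) (g w)) step v
  where
  open ≡-Reasoning
  step : ∀ v → h v + g w ≡ g v + h w → h (rot v) + g w ≡ g (rot v) + h w
  step v e = +-cancelʳ-≡ (𝟙 (b v)) _ _ (begin
    h (rot v) + g w + 𝟙 (b v)   ≡⟨ +-shuffle (h (rot v)) (g w) (𝟙 (b v)) ⟩
    h (rot v) + 𝟙 (b v) + g w   ≡⟨ cong (_+ g w) (p v) ⟩
    h v + 𝟙 (a v) + g w         ≡⟨ +-shuffle (h v) (𝟙 (a v)) (g w) ⟩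
    h v + g w + 𝟙 (a v)         ≡⟨ cong (_+ 𝟙 (a v)) e ⟩
    g v + h w + 𝟙 (a v)         ≡⟨ +-shuffle (g v) (h w) (𝟙 (a v)) ⟩
    g v + 𝟙 (a v) + h w         ≡⟨ cong (_+ h w) (q v) ⟨
    g (rot v) + 𝟙 (b v) + h w   ≡⟨ +-shuffle (g (rot v)) (𝟙 (b v)) (h w) ⟩
    g (rot v) + h w + 𝟙 (b v)   ∎)

-- A word has letters U = (1,0), D = (0,1), and two flat letters (1,1) and (0,0).  Splitting each
-- letter into two half steps (the letter (0,0) dips down, (1,1) peaks), Hub v says that the
-- path attains its minimum at v.
Hub : ∀ {n} → (Fin n → Bool) → (Fin n → ℕ) → Fin n → Set
Hub a h v = ∀ j → h v < h j + 𝟙 (a j)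

hub : ∀ {n} → Sub n → Sub n → Fin n → Bool
hub {n} A B v = allB (λ j → pot A B v <ᵇ pot A B j + 𝟙 (lookup A j)) (allFin n)

hub⇒ : ∀ {k} (A B : Sub (suc k)) {h} → card A ≡ card B → Potential (lookup A) (lookup B) h → ∀ v → hub A B v ≡ true → Hub (lookup A) h v
hub⇒ A B {h} bal p v e j = +-cancelʳ-< (pot A B j) _ _ (begin-strict
    h v + pot A B j                    ≡⟨ potential-unique {a = lookup A} {lookup B} p (pot-potential A B bal) v j ⟩
    pot A B v + h j                    <⟨ +-monoˡ-< (h j) (<ᵇ⇒< (pot A B v) (pot A B j + 𝟙 (lookup A j))
        (≡⇒T (allB⇒ {p = λ j → pot A B v <ᵇ pot A B j + 𝟙 (lookup A j)} e (∈-allFin j)))) ⟩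
    pot A B j + 𝟙 (lookup A j) + h j   ≡⟨ trans (+-assoc (pot A B j) (𝟙 (lookup A j)) (h j))
        (trans (+-comm (pot A B j) _) (cong (_+ pot A B j) (+-comm (𝟙 (lookup A j)) (h j)))) ⟩
    h j + 𝟙 (lookup A j) + pot A B j   ∎)
  where open ≤-Reasoning

⇒hub : ∀ {k} (A B : Sub (suc k)) {h} → card A ≡ card B → Potential (lookup A) (lookup B) h → ∀ v → Hub (lookup A) h v → hub A B v ≡ true
⇒hub A B {h} bal p v H = ⇒allB (allFin _) λ j → T⇒≡ (<⇒<ᵇ (+-cancelʳ-< (h j) (pot A B v) (pot A B j + 𝟙 (lookup A j)) (begin-strict
    pot A B v + h j                    ≡⟨ potential-unique {a = lookup A} {lookup B} p (pot-potential A B bal) v j ⟨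
    h v + pot A B j                    <⟨ +-monoˡ-< (pot A B j) (H j) ⟩
    h j + 𝟙 (lookup A j) + pot A B j   ≡⟨ trans (+-assoc (h j) (𝟙 (lookup A j)) (pot A B j))
        (trans (+-comm (h j) _) (cong (_+ h j) (+-comm (𝟙 (lookup A j)) (pot A B j)))) ⟩
    pot A B j + 𝟙 (lookup A j) + h j   ∎)))
  where open ≤-Reasoning

argmin : ∀ {k} (f : Fin (suc k) → ℕ) → ∃ λ v → ∀ j → f v ≤ f j
argmin {zero} f = zero , λ { zero → ≤-refl }
argmin {suc k} f with argmin (f ∘ suc)
... | v , le with f zero ≤? f (suc v)
...   | yes p = zero , λ { zero → ≤-refl ; (suc j) → ≤-trans p (le j) }
...   | no p = suc v , λ { zero → <⇒≤ (≰⇒> p) ; (suc j) → le j }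

𝟙-true : ∀ {m b} → m < m + 𝟙 b → b ≡ true
𝟙-true {m} {true} p = refl
𝟙-true {m} {false} p = ⊥-elim (<-irrefl (sym (+-identityʳ m)) p)

-- Sums over words

Σ² : ∀ n → (Sub n → Sub n → ℤ) → ℤ
Σ² n f = ΣS n λ A → ΣS n λ B → f A B

Σ²-cong : ∀ n {f g : Sub n → Sub n → ℤ} → (∀ A B → f A B ≡ g A B) → Σ² n f ≡ Σ² n g
Σ²-cong n h = ΣS-cong n λ A → ΣS-cong n (h A)

Σ²-0 : ∀ n → Σ² n (λ _ _ → 0ℤ) ≡ 0ℤ
Σ²-0 n = trans (ΣS-cong n λ _ → ΣS-0 n) (ΣS-0 n)

ΣS-Σ²-comm : ∀ m n (f : Sub m → Sub n → Sub n → ℤ) → ΣS m (λ F → Σ² n (f F)) ≡ Σ² n (λ A B → ΣS m (λ F → f F A B))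
ΣS-Σ²-comm m n f = trans (ΣS-comm m n _) (ΣS-cong n λ A → ΣS-comm m n (λ F → f F A))

Σ²-comm : ∀ n (f : Sub n → Sub n → Sub n → Sub n → ℤ) → Σ² n (λ A B → Σ² n (f A B)) ≡ Σ² n (λ C D → Σ² n (λ A B → f A B C D))
Σ²-comm n f = trans (ΣS-cong n λ A → ΣS-Σ²-comm n n (f A)) (ΣS-Σ²-comm n n (λ A C D → ΣS n (λ B → f A B C D)))

Σ²-delta : ∀ {n} (A B : Sub n) (f : Sub n → Sub n → ℤ) → Σ² n (λ C D → ((A ==s C) ∧ (B ==s D)) ▸ f C D) ≡ f A B
Σ²-delta {n} A B f = trans (ΣS-cong n λ C → trans (ΣS-cong n λ D → ▸-∧ (A ==s C) (B ==s D) (f C D))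
    (trans (ΣS-▸ n (A ==s C) _) (cong ((A ==s C) ▸_) (ΣS-delta B (f C))))) (ΣS-delta A (λ C → f C B))

-- Both sides are expanded into double sums over pairs of words. On valid words the relation "the
-- second is the image of the first" is symmetric, so exchanging the sums suffices.
Σ²-involution : ∀ n (valid : Sub n → Sub n → Bool) (f g : Sub n → Sub n → ℤ) (α β : Sub n → Sub n → Sub n) →
  (∀ A B → valid A B ≡ true → valid (α A B) (β A B) ≡ true × α (α A B) (β A B) ≡ A × β (α A B) (β A B) ≡ B × f A B ≡ g (α A B) (β A B)) →
  Σ² n (λ A B → valid A B ▸ f A B) ≡ Σ² n (λ A B → valid A B ▸ g A B)
Σ²-involution n valid f g α β inv = begin
  Σ² n (λ A B → valid A B ▸ f A B)
    ≡⟨ Σ²-cong n (λ A B → sym (Σ²-delta (α A B) (β A B) (λ _ _ → valid A B ▸ f A B))) ⟩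
  Σ² n (λ A B → Σ² n (λ C D → ((α A B ==s C) ∧ (β A B ==s D)) ▸ valid A B ▸ f A B))
    ≡⟨ Σ²-comm n _ ⟩
  Σ² n (λ C D → Σ² n (λ A B → ((α A B ==s C) ∧ (β A B ==s D)) ▸ valid A B ▸ f A B))
    ≡⟨ Σ²-cong n (λ C D → Σ²-cong n (λ A B → flip A B C D)) ⟩
  Σ² n (λ C D → Σ² n (λ A B → ((α C D ==s A) ∧ (β C D ==s B)) ▸ valid C D ▸ g C D))
    ≡⟨ Σ²-cong n (λ C D → Σ²-delta (α C D) (β C D) (λ _ _ → valid C D ▸ g C D)) ⟩
  Σ² n (λ C D → valid C D ▸ g C D) ∎
  where
  open ≡-Reasoning
  flip : ∀ A B C D → ((α A B ==s C) ∧ (β A B ==s D)) ▸ valid A B ▸ f A B ≡ ((α C D ==s A) ∧ (β C D ==s B)) ▸ valid C D ▸ g C D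
  both : ∀ {x y} z → x ≡ true → y ≡ true → x ▸ y ▸ z ≡ z
  both z refl refl = refl
  flip A B C D with bool (((α A B ==s C) ∧ (β A B ==s D)) ∧ valid A B) | bool (((α C D ==s A) ∧ (β C D ==s B)) ∧ valid C D)
  ... | inj₁ p | _ = fwd (==s⇒≡ {A = α A B} {C} (∧-elimˡ (∧-elimˡ p))) (==s⇒≡ {A = β A B} {D} (∧-elimʳ {α A B ==s C} (∧-elimˡ p))) (inv A B v)
    where
    v = ∧-elimʳ {(α A B ==s C) ∧ (β A B ==s D)} p
    fwd : α A B ≡ C → β A B ≡ D → valid (α A B) (β A B) ≡ true × α (α A B) (β A B) ≡ A × β (α A B) (β A B) ≡ B × f A B ≡ g (α A B) (β A B) →
          ((α A B ==s C) ∧ (β A B ==s D)) ▸ valid A B ▸ f A B ≡ ((α C D ==s A) ∧ (β C D ==s B)) ▸ valid C D ▸ g C D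
    fwd refl refl (v' , e₁ , e₂ , e) = trans (both {(α A B ==s α A B) ∧ (β A B ==s β A B)} (f A B) (∧-elimˡ p) v)
        (trans e (sym (both (g (α A B) (β A B))
      (∧-intro (trans (cong (_==s A) e₁) (==s-refl A)) (trans (cong (_==s B) e₂) (==s-refl B))) v')))
  ... | inj₂ p | inj₁ q = ⊥-elim (bwd (==s⇒≡ {A = α C D} {A} (∧-elimˡ (∧-elimˡ q))) (==s⇒≡ {A = β C D} {B} (∧-elimʳ {α C D ==s A} (∧-elimˡ q)))
      (inv C D (∧-elimʳ {(α C D ==s A) ∧ (β C D ==s B)} q)) p)
    where
    bwd : α C D ≡ A → β C D ≡ B → valid (α C D) (β C D) ≡ true × α (α C D) (β C D) ≡ C × β (α C D) (β C D) ≡ D × f C D ≡ g (α C D) (β C D) →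
          ((α A B ==s C) ∧ (β A B ==s D)) ∧ valid A B ≡ false → ⊥
    bwd refl refl (v' , e₁ , e₂ , _) = true≢false (∧-intro (∧-intro (trans (cong (_==s C) e₁) (==s-refl C))
        (trans (cong (_==s D) e₂) (==s-refl D))) v')
  ... | inj₂ p | inj₂ q = trans (sym (▸-∧ ((α A B ==s C) ∧ (β A B ==s D)) (valid A B) (f A B))) (trans (cong (_▸ f A B) p)
    (trans (sym (cong (_▸ g C D) q)) (▸-∧ ((α C D ==s A) ∧ (β C D ==s B)) (valid C D) (g C D))))

▸▸-zero : ∀ x y {z} → (x ≡ true → y ≡ true → ⊥) → x ▸ y ▸ z ≡ 0ℤ
▸▸-zero true true h = ⊥-elim (h refl refl)
▸▸-zero true false h = refl
▸▸-zero false y h = refl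

shift-ΣS : ∀ d m (f : Sub m → ℕ → ℤ) i → shift d (λ i → ΣS m (λ A → f A i)) i ≡ ΣS m (λ A → shift d (f A) i)
shift-ΣS zero m f i = refl
shift-ΣS (suc d) m f zero = sym (ΣS-0 m)
shift-ΣS (suc d) m f (suc i) = shift-ΣS d m f i

shift-▸ : ∀ d c (f : ℕ → ℤ) i → shift d (λ i → c ▸ f i) i ≡ c ▸ shift d f i
shift-▸ d true f i = refl
shift-▸ zero false f i = refl
shift-▸ (suc d) false f zero = refl
shift-▸ (suc d) false f (suc i) = shift-▸ d false f i

ΣS-Σ²-shift : ∀ m n (w : Sub m → Bool) (d : Sub m → ℕ) (f : Sub m → Sub n → Sub n → ℕ → ℤ) i →
  ΣS m (λ F → w F ▸ shift (d F) (λ i → Σ² n (λ A B → f F A B i)) i) ≡ Σ² n (λ A B → ΣS m (λ F → w F ▸ shift (d F) (f F A B) i))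
ΣS-Σ²-shift m n w d f i = trans (ΣS-cong m λ F →
    trans (cong (w F ▸_) (trans (shift-ΣS (d F) n (λ A i → ΣS n (λ B → f F A B i)) i) (ΣS-cong n λ A → shift-ΣS (d F) n (f F A) i)))
      (trans (sym (ΣS-▸ n (w F) _)) (ΣS-cong n λ A → sym (ΣS-▸ n (w F) _))))
  (ΣS-Σ²-comm m n (λ F A B → w F ▸ shift (d F) (f F A B) i))

-- Makes the exponent independent of the flat: with `p` the rank of F and `q` that of G, the factor
-- t^(p - q) turns the statistic c - p into c - q. The indices below p - q contribute nothing
-- because `p ≤ c`.
shift-count : ∀ p q i c → q ≤ p → p ≤ c → shift (p ∸ q) (λ i → (c ≡ᵇ p + i) ▸ 1ℤ) i ≡ (c ≡ᵇ q + i) ▸ 1ℤ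
shift-count p q i c q≤p p≤c with p ∸ q ≤? i
... | yes le = trans (cong (shift (p ∸ q) (λ i → (c ≡ᵇ p + i) ▸ 1ℤ)) (sym (m+[n∸m]≡n le)))
        (trans (shift-+ (p ∸ q) (λ i → (c ≡ᵇ p + i) ▸ 1ℤ) (i ∸ (p ∸ q))) (cong (λ z → (c ≡ᵇ z) ▸ 1ℤ)
          (trans (cong (_+ (i ∸ (p ∸ q))) (sym (m+[n∸m]≡n q≤p))) (trans (+-assoc q (p ∸ q) (i ∸ (p ∸ q))) (cong (q +_) (m+[n∸m]≡n le))))))
... | no gt = trans (shift-< (p ∸ q) (λ i → (c ≡ᵇ p + i) ▸ 1ℤ) i (≰⇒> gt)) (sym (cong (_▸ 1ℤ) (¬true⇒false {c ≡ᵇ q + i} λ e →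
        <-irrefl refl (≤-trans (subst (q + i <_) (m+[n∸m]≡n q≤p) (+-monoʳ-< q (≰⇒> gt))) (≤-trans p≤c (≤-reflexive (≡ᵇ⇒≡ c (q + i) (≡⇒T e))))))))

-- The flat of a word, its rank and the degree bound

module WhirlWords (k : ℕ) (rot≢ : (v : Fin (suc k)) → v ≢ rot v) where

  open WhirlFlats k rot≢ public

  abstract
    Φ : Sub n → Sub n → Sub (n + n)
    Φ A B = mkSub (hub A B) (λ v → lookup A v ∧ lookup B v)

    Φ-sp : ∀ A B v → lookup (Φ A B) (sp v) ≡ hub A B v
    Φ-sp A B = lookup-sp (hub A B) (λ v → lookup A v ∧ lookup B v)

    Φ-rim : ∀ A B v → lookup (Φ A B) (rim v) ≡ lookup A v ∧ lookup B v
    Φ-rim A B = lookup-rim (hub A B) (λ v → lookup A v ∧ lookup B v)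

  module Word (A B : Sub n) (h : Fin n → ℕ) (bal : card A ≡ card B) (p : Potential (lookup A) (lookup B) h) where
    private
      a b : Fin n → Bool
      a = lookup A
      b = lookup B

    flatStep : ∀ v → a v ≡ true → b v ≡ true → h (rot v) ≡ h v
    flatStep v x y = +-cancelʳ-≡ 1 (h (rot v)) (h v) (subst₂ (λ x y → h (rot v) + 𝟙 y ≡ h v + 𝟙 x) x y (p v))

    hub⇒a : ∀ v → Hub a h v → a v ≡ true
    hub⇒a v H = 𝟙-true {h v} (H v)

    hub⇒b : ∀ v → Hub a h (rot v) → b v ≡ true
    hub⇒b v H = 𝟙-true {h (rot v)} (subst (h (rot v) <_) (sym (p v)) (H v))

    hub-rot : ∀ v → h (rot v) ≡ h v → Hub a h v → Hub a h (rot v)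
    hub-rot v e H j = subst (_< h j + 𝟙 (a j)) (sym e) (H j)

    hub-unrot : ∀ v → h (rot v) ≡ h v → Hub a h (rot v) → Hub a h v
    hub-unrot v e H j = subst (_< h j + 𝟙 (a j)) e (H j)

    sp⇒Hub : ∀ v → sp v ∈ Φ A B → Hub a h v
    sp⇒Hub v q = hub⇒ A B bal p v (trans (sym (Φ-sp A B v)) q)

    Hub⇒sp : ∀ v → Hub a h v → sp v ∈ Φ A B
    Hub⇒sp v H = trans (Φ-sp A B v) (⇒hub A B bal p v H)

    rim⇒a : ∀ v → rim v ∈ Φ A B → a v ≡ true
    rim⇒a v q = ∧-elimˡ (trans (sym (Φ-rim A B v)) q)

    rim⇒b : ∀ v → rim v ∈ Φ A B → b v ≡ true
    rim⇒b v q = ∧-elimʳ {a v} (trans (sym (Φ-rim A B v)) q)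

    Φ-closed : Closed (Φ A B)
    Φ-closed = record
      { fill = λ v x y → trans (Φ-rim A B v) (∧-intro (hub⇒a v (sp⇒Hub v x)) (hub⇒b v (sp⇒Hub (rot v) y)))
      ; right = λ v x y → Hub⇒sp (rot v) (hub-rot v (flatStep v (rim⇒a v x) (rim⇒b v x)) (sp⇒Hub v y))
      ; left = λ v x y → Hub⇒sp v (hub-unrot v (flatStep v (rim⇒a v x) (rim⇒b v x)) (sp⇒Hub (rot v) y))
      ; notRim = λ x y → true≢false (Hub⇒sp zero λ j → subst₂ (λ c d → h zero < c + 𝟙 d)
          (sym (rot-induction (λ j → h j ≡ h zero) zero refl (λ v e → trans (flatStep v (rim⇒a v (y v)) (rim⇒b v (y v))) e) j))
          (sym (rim⇒a j (y j))) (subst (h zero <_) (+-comm 1 (h zero)) ≤-refl)) (x zero)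
      }

    rankTerm≤ : ∀ v → rankTerm (Φ A B) v ≤ 𝟙 (a v)
    rankTerm≤ v with bool (lookup (Φ A B) (sp v))
    ... | inj₁ q rewrite q | hub⇒a v (sp⇒Hub v q) = ≤-refl
    ... | inj₂ q rewrite q = 𝟙-mono (rim⇒a v)

    letters≤ : ∀ v → 𝟙 (a v) + 𝟙 (b v) ≤ 1 + rankTerm (Φ A B) v
    letters≤ v rewrite Φ-rim A B v with bool (lookup (Φ A B) (sp v))
    ... | inj₁ q rewrite q = +-mono-≤ (𝟙≤1 (a v)) (𝟙≤1 (b v))
    ... | inj₂ q rewrite q with a v | b v
    ...   | true | true = ≤-refl
    ...   | true | false = ≤-refl
    ...   | false | true = ≤-refl
    ...   | false | false = z≤n

    Φ-flat : isFlat M (Φ A B) ≡ true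
    Φ-flat = Flat⇒isFlat (closed⇒flat (Φ A B) Φ-closed)

    rank-Φ : rank M (Φ A B) ≡ ∑ (rankTerm (Φ A B))
    rank-Φ = rank-right-closed (Φ A B) (Closed.right Φ-closed)

    rank-Φ≤ : rank M (Φ A B) ≤ card A
    rank-Φ≤ = subst₂ _≤_ (sym rank-Φ) (sym (card≡∑ A)) (∑-mono rankTerm≤)

    -- Every minimum of h is a hub, and hubs are followed by hubs.
    tight⇒hubs : (∀ v → 1 + rankTerm (Φ A B) v ≤ 𝟙 (a v) + 𝟙 (b v)) → ∀ v → Hub a h v
    tight⇒hubs tight = rot-induction (Hub a h) v₀ hub₀ (λ v H → hub-rot v (flatStep v (hub⇒a v H) (hub-b v H)) H)
      where
      v₀ = proj₁ (argmin h)
      hub-b : ∀ v → Hub a h v → b v ≡ true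
      hub-b v H with bool (b v)
      ... | inj₁ y = y
      ... | inj₂ y with tight v
      ...   | t rewrite Hub⇒sp v H | hub⇒a v H | y with () ← ≤-pred t
      down : ∀ v → a v ≡ false → b v ≡ true
      down v x with b v | tight v
      ... | true | _ = refl
      ... | false | t rewrite x with () ← t
      hub₀ : Hub a h v₀
      hub₀ j with bool (a j)
      ... | inj₁ x = subst (λ c → h v₀ < h j + 𝟙 c) (sym x) (subst (h v₀ <_) (+-comm 1 (h j)) (s≤s (proj₂ (argmin h) j)))
      ... | inj₂ x = ≤-trans (s≤s (proj₂ (argmin h) (rot j))) (≤-reflexive
          (trans (+-comm 1 (h (rot j))) (trans (cong (λ c → h (rot j) + 𝟙 c) (sym (down j x))) (p j))))

    -- Equality in every `letters≤` would make every vertex a hub and the flat everything. For a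
    -- balanced word this reads 2 (card A - rank) < n - rank, the required degree bound.
    letters< : rank M (Φ A B) < n → card A + card B < n + rank M (Φ A B)
    letters< lt = ≰⇒> λ q → <-irrefl (full (tight⇒hubs (∑-squeeze letters≤ (total q)))) lt
      where
      total : n + rank M (Φ A B) ≤ card A + card B → ∑ (λ v → 1 + rankTerm (Φ A B) v) ≤ ∑ (λ v → 𝟙 (a v) + 𝟙 (b v))
      total = subst₂ _≤_
        (trans (cong₂ _+_ (trans (sym (*-identityʳ n)) (sym (∑-const n 1))) rank-Φ) (sym (∑-+ (λ _ → 1) (rankTerm (Φ A B)))))
        (trans (cong₂ _+_ (card≡∑ A) (card≡∑ B)) (sym (∑-+ (𝟙 ∘ a) (𝟙 ∘ b))))
      full : (∀ v → Hub a h v) → rank M (Φ A B) ≡ n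
      full hubs = trans rank-Φ (trans (∑-cong λ v → cong (λ c → 𝟙 c + 𝟙 (not c ∧ lookup (Φ A B) (rim v))) (Hub⇒sp v (hubs v)))
          (trans (∑-const n 1) (*-identityʳ n)))

  balanced : Sub n → Sub n → Bool
  balanced A B = card A ≡ᵇ card B

  bal⇒ : ∀ A B → balanced A B ≡ true → card A ≡ card B
  bal⇒ A B e = ≡ᵇ⇒≡ (card A) (card B) (≡⇒T e)

  ⇒bal : ∀ A B → card A ≡ card B → balanced A B ≡ true
  ⇒bal A B e = T⇒≡ (≡⇒≡ᵇ (card A) (card B) e)

  module Canonical (A B : Sub n) (bal : balanced A B ≡ true) where
    open Word A B (pot A B) (bal⇒ A B bal) (pot-potential A B (bal⇒ A B bal)) public

  -- Subtracting the rank from `card A` discards the spokes, where `a` is forced, and the remaining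
  -- peaks; what is left are the letters U off the spokes.
  Q : Sub (n + n) → ℕ → ℤ
  Q F i = Σ² n λ A B → (balanced A B ∧ (Φ A B ==s F)) ▸ (card A ≡ᵇ rank M F + i) ▸ 1ℤ

  lowDegree : ∀ F → isFlat M F ≡ true → rank M F < rk M → ∀ i → rk M ≤ rank M F + 2 * i → Q F i ≡ 0ℤ
  lowDegree F _ lt i le = trans (Σ²-cong n zero-term) (Σ²-0 n)
    where
    zero-term : ∀ A B → (balanced A B ∧ (Φ A B ==s F)) ▸ (card A ≡ᵇ rank M F + i) ▸ 1ℤ ≡ 0ℤ
    zero-term A B = ▸▸-zero (balanced A B ∧ (Φ A B ==s F)) (card A ≡ᵇ rank M F + i) λ e e' → impossible A B e (≡ᵇ⇒≡ (card A) (rank M F + i) (≡⇒T e'))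
      where
      impossible : ∀ A B → balanced A B ∧ (Φ A B ==s F) ≡ true → card A ≡ rank M F + i → ⊥
      impossible A B e cardA = <-irrefl refl (begin-strict
          card A + card A          ≡⟨ cong (card A +_) (bal⇒ A B (∧-elimˡ e)) ⟩
          card A + card B          <⟨ subst (λ X → card A + card B < n + rank M X) Φ≡F
              (letters< (subst₂ (λ X r → rank M X < r) (sym Φ≡F) rk-whirl lt)) ⟩
          n + ρ                    ≡⟨ cong (_+ ρ) rk-whirl ⟨
          rk M + ρ                 ≤⟨ +-monoˡ-≤ ρ le ⟩
          ρ + 2 * i + ρ            ≡⟨ cong (λ z → ρ + (i + z) + ρ) (+-identityʳ i) ⟩
          ρ + (i + i) + ρ          ≡⟨ cong (_+ ρ) (+-assoc ρ i i) ⟨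
          ρ + i + i + ρ            ≡⟨ trans (+-assoc (ρ + i) i ρ) (cong (ρ + i +_) (+-comm i ρ)) ⟩
          ρ + i + (ρ + i)          ≡⟨ cong₂ _+_ cardA cardA ⟨
          card A + card A          ∎)
        where
        open ≤-Reasoning
        open Canonical A B (∧-elimˡ e)
        ρ = rank M F
        Φ≡F : Φ A B ≡ F
        Φ≡F = ==s⇒≡ (∧-elimʳ {balanced A B} e)

  Φ-fulls : Φ fulls fulls ≡ fulls
  Φ-fulls = ⊆-antisym ⊆full (mk⊆ (elements (λ v _ → allSp v) (λ v _ → allRim v)))
    where
    open Canonical fulls fulls (⇒bal fulls fulls refl)
    allRim : ∀ v → rim v ∈ Φ fulls fulls
    allRim v = trans (Φ-rim fulls fulls v) (∧-intro (x∈full v) (x∈full v))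
    allSp : ∀ v → sp v ∈ Φ fulls fulls
    allSp with search {P = λ v → sp v ∈ Φ fulls fulls} {Q = λ v → sp v ∉ Φ fulls fulls} (λ v → bool (lookup (Φ fulls fulls) (sp v)))
    ... | inj₂ none = ⊥-elim (Closed.notRim Φ-closed none allRim)
    ... | inj₁ (v , p) = rot-induction (λ v → sp v ∈ Φ fulls fulls) v p (λ v → Closed.right Φ-closed v (allRim v))

  -- A flat of full rank is the whole ground set; every rim edge must then carry a peak, which
  -- leaves a single word.
  topTerm : ∀ F → isFlat M F ≡ true → rank M F ≡ rk M → ∀ i → Q F i ≡ coeff (1ℤ ∷ []) i
  topTerm F fl e i = trans (Σ²-cong n term) (trans (Σ²-delta {n} fulls fulls (λ A B → (n ≡ᵇ n + i) ▸ 1ℤ)) (final i))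
    where
    F≡full : F ≡ fulls
    F≡full = ⊆-antisym ⊆full (mk⊆ go)
      where
      go : ∀ x → x ∈ fulls → x ∈ F
      go x _ with bool (lookup F x)
      ... | inj₁ q = q
      ... | inj₂ q = ⊥-elim (<-irrefl e (≤-trans (isFlat⇒Flat fl x q) (rank-mono ⊆full)))
    final : ∀ i → (n ≡ᵇ n + i) ▸ 1ℤ ≡ coeff (1ℤ ∷ []) i
    final zero rewrite T⇒≡ (≡⇒≡ᵇ n (n + 0) (sym (+-identityʳ n))) = refl
    final (suc i) rewrite ¬true⇒false {n ≡ᵇ n + suc i} (λ q → m≢1+m+n n (trans (≡ᵇ⇒≡ n (n + suc i) (≡⇒T q)) (+-suc n i))) = refl
    term : ∀ A B → (balanced A B ∧ (Φ A B ==s F)) ▸ (card A ≡ᵇ rank M F + i) ▸ 1ℤ ≡ ((fulls ==s A) ∧ (fulls ==s B)) ▸ (n ≡ᵇ n + i) ▸ 1ℤ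
    term A B = trans (cong (_▸ (card A ≡ᵇ rank M F + i) ▸ 1ℤ) (bool-ext to from)) (▸-cong ((fulls ==s A) ∧ (fulls ==s B)) λ q →
        cong₂ (λ c r → (c ≡ᵇ r + i) ▸ 1ℤ) (trans (cong card (sym (==s⇒≡ {A = fulls} {A} (∧-elimˡ q)))) (card-full {n})) (trans e rk-whirl))
      where
      to : balanced A B ∧ (Φ A B ==s F) ≡ true → (fulls ==s A) ∧ (fulls ==s B) ≡ true
      to q = ∧-intro (subst (λ X → fulls ==s X ≡ true) (sub-ext {A = fulls} {A} λ v → trans (x∈full v) (sym (rim⇒a v (inΦ v))))
          (==s-refl (fulls {n})))
                     (subst (λ X → fulls ==s X ≡ true) (sub-ext {A = fulls} {B} λ v → trans (x∈full v) (sym (rim⇒b v (inΦ v))))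
                         (==s-refl (fulls {n})))
        where
        open Canonical A B (∧-elimˡ q)
        inΦ : ∀ v → rim v ∈ Φ A B
        inΦ v = subst (rim v ∈_) (sym (trans (==s⇒≡ {A = Φ A B} {F} (∧-elimʳ {balanced A B} q)) F≡full)) (x∈full (rim v))
      from : (fulls ==s A) ∧ (fulls ==s B) ≡ true → balanced A B ∧ (Φ A B ==s F) ≡ true
      from q = subst₂ (λ X Y → balanced X Y ∧ (Φ X Y ==s F) ≡ true) (==s⇒≡ {A = fulls} {A} (∧-elimˡ q))
          (==s⇒≡ {A = fulls} {B} (∧-elimʳ {fulls ==s A} q))
        (∧-intro (⇒bal fulls fulls refl) (subst₂ (λ X Y → X ==s Y ≡ true) (sym Φ-fulls) (sym F≡full) (==s-refl (fulls {n + n}))))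

  Zwords : Sub (n + n) → ℕ → ℤ
  Zwords G i = Σ² n λ A B → (balanced A B ∧ (G ⊆b Φ A B)) ▸ (card A ≡ᵇ rank M G + i) ▸ 1ℤ

  -- Every balanced word belongs to exactly one flat, so summing over the flats above `G` collects
  -- all words above `G`.
  Zcoeff≡Zwords : ∀ G i → Zcoeff M Q G i ≡ Zwords G i
  Zcoeff≡Zwords G i = begin
    ΣS (n + n) (λ F → (isFlat M F ∧ (G ⊆b F)) ▸ shift (ρ F ∸ ρ G) (Q F) i)
      ≡⟨ ΣS-Σ²-shift (n + n) n (λ F → isFlat M F ∧ (G ⊆b F)) (λ F → ρ F ∸ ρ G)
          (λ F A B i → (balanced A B ∧ (Φ A B ==s F)) ▸ (card A ≡ᵇ ρ F + i) ▸ 1ℤ) i ⟩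
    Σ² n (λ A B → ΣS (n + n) (λ F → (isFlat M F ∧ (G ⊆b F)) ▸ shift (ρ F ∸ ρ G) (λ i → (balanced A B ∧ (Φ A B ==s F)) ▸ (card A ≡ᵇ ρ F + i) ▸ 1ℤ) i))
      ≡⟨ Σ²-cong n (λ A B → trans (ΣS-cong (n + n) (term A B)) (ΣS-delta (Φ A B) (λ F → (balanced A B ∧ (G ⊆b F)) ▸ (card A ≡ᵇ ρ G + i) ▸ 1ℤ))) ⟩
    Zwords G i ∎
    where
    open ≡-Reasoning
    ρ = rank M
    term : ∀ A B F → (isFlat M F ∧ (G ⊆b F)) ▸ shift (ρ F ∸ ρ G) (λ i → (balanced A B ∧ (Φ A B ==s F)) ▸ (card A ≡ᵇ ρ F + i) ▸ 1ℤ) i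
                     ≡ (Φ A B ==s F) ▸ (balanced A B ∧ (G ⊆b F)) ▸ (card A ≡ᵇ ρ G + i) ▸ 1ℤ
    term A B F = trans (cong ((isFlat M F ∧ (G ⊆b F)) ▸_) (shift-▸ (ρ F ∸ ρ G) (balanced A B ∧ (Φ A B ==s F))
        (λ i → (card A ≡ᵇ ρ F + i) ▸ 1ℤ) i)) (cases (bool (balanced A B)) (bool (Φ A B ==s F)) (bool (G ⊆b F)))
      where
      S = shift (ρ F ∸ ρ G) (λ i → (card A ≡ᵇ ρ F + i) ▸ 1ℤ) i
      dead : ∀ {c} z → c ≡ false → c ▸ z ≡ 0ℤ
      dead z refl = refl
      ∧-false : ∀ {c} d → d ≡ false → c ∧ d ≡ false
      ∧-false {true} d e = e
      ∧-false {false} d e = refl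
      ▸0 : ∀ c → c ▸ 0ℤ ≡ 0ℤ
      ▸0 true = refl
      ▸0 false = refl
      cases : (balanced A B ≡ true) ⊎ (balanced A B ≡ false) → (Φ A B ==s F ≡ true) ⊎ (Φ A B ==s F ≡ false) → (G ⊆b F ≡ true) ⊎ (G ⊆b F ≡ false) →
              (isFlat M F ∧ (G ⊆b F)) ▸ (balanced A B ∧ (Φ A B ==s F)) ▸ S ≡ (Φ A B ==s F) ▸ (balanced A B ∧ (G ⊆b F)) ▸ (card A ≡ᵇ ρ G + i) ▸ 1ℤ
      cases (inj₂ e) _ _ = trans (cong ((isFlat M F ∧ (G ⊆b F)) ▸_) (dead S (cong (_∧ (Φ A B ==s F)) e))) (trans (▸0 (isFlat M F ∧ (G ⊆b F)))
        (sym (trans (cong ((Φ A B ==s F) ▸_) (dead ((card A ≡ᵇ ρ G + i) ▸ 1ℤ) (cong (_∧ (G ⊆b F)) e))) (▸0 (Φ A B ==s F)))))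
      cases (inj₁ _) (inj₂ e) _ = trans (cong ((isFlat M F ∧ (G ⊆b F)) ▸_) (dead S (∧-false {balanced A B} (Φ A B ==s F) e)))
          (trans (▸0 (isFlat M F ∧ (G ⊆b F))) (sym (dead _ e)))
      cases (inj₁ _) (inj₁ _) (inj₂ e) = trans (dead ((balanced A B ∧ (Φ A B ==s F)) ▸ S) (∧-false {isFlat M F} (G ⊆b F) e))
          (sym (trans (cong ((Φ A B ==s F) ▸_) (dead ((card A ≡ᵇ ρ G + i) ▸ 1ℤ) (∧-false {balanced A B} (G ⊆b F) e))) (▸0 (Φ A B ==s F))))
      cases (inj₁ bal) (inj₁ eq) (inj₁ sub) = trans (cong₂ (λ c d → c ▸ d ▸ S) (∧-intro flat sub) (∧-intro bal eq))
          (trans count (sym (cong₂ (λ c d → c ▸ d ▸ (card A ≡ᵇ ρ G + i) ▸ 1ℤ) eq (∧-intro bal sub))))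
        where
        open Canonical A B bal
        Φ≡F : Φ A B ≡ F
        Φ≡F = ==s⇒≡ {A = Φ A B} {F} eq
        flat : isFlat M F ≡ true
        flat = subst (λ X → isFlat M X ≡ true) Φ≡F Φ-flat
        G≤F : ρ G ≤ ρ F
        G≤F = rank-mono (⊆b⇒⊆ G F sub)
        F≤A : ρ F ≤ card A
        F≤A = subst (λ X → ρ X ≤ card A) Φ≡F rank-Φ≤
        count : S ≡ (card A ≡ᵇ ρ G + i) ▸ 1ℤ
        count = shift-count (ρ F) (ρ G) i (card A) G≤F F≤A

-- The involution on words above a flat

𝟙-not : ∀ x → 𝟙 x + 𝟙 (not x) ≡ 1
𝟙-not true = refl
𝟙-not false = refl

if-true : ∀ {X : Set} {c} {x y : X} → c ≡ true → (if c then x else y) ≡ x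
if-true refl = refl

if-false : ∀ {X : Set} {c} {x y : X} → c ≡ false → (if c then x else y) ≡ y
if-false refl = refl

-- s₀ and r₀ are the spokes and rim edges of the flat.  A block is a maximal run of rim edges in r₀;
-- the involution exchanges, at every block without spokes, the half step entering it (read off
-- from b) with the half step leaving it (read off from a).
module Involution {k : ℕ} (s₀ r₀ : Fin (suc k) → Bool) (blockwise : ∀ v → r₀ v ≡ true → s₀ (rot v) ≡ s₀ v)
  (e : Fin (suc k)) (cut : r₀ e ≡ false) where

  private n = suc k

  abstract
    -- The second half of the last letter before the block of the given vertex; `leaving` is the
    -- first half of the letter after it. A vertex on no edge of `r₀` is a block by itself.
    entering : (Fin n → Bool) → Fin n → Bool
    entering b = CyclicRecursion.cycRec rot rot⁻¹ rot⁻¹-rot rot-induction false (λ v y → if r₀ v then y else b v) e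
      (λ y y' → trans (if-false cut) (sym (if-false cut)))

    entering-step : ∀ b v → entering b (rot v) ≡ (if r₀ v then entering b v else b v)
    entering-step b = CyclicRecursion.cycRec-step rot rot⁻¹ rot⁻¹-rot rot-induction false (λ v y → if r₀ v then y else b v) e
      (λ y y' → trans (if-false cut) (sym (if-false cut)))

    leaving : (Fin n → Bool) → Fin n → Bool
    leaving a = CyclicRecursion.cycRec rot⁻¹ rot rot-rot⁻¹ rot⁻¹-induction false (λ w y → if r₀ (rot⁻¹ w) then y else a (rot⁻¹ w)) (rot e)
      (λ y y' → trans (if-false cut') (sym (if-false cut')))
      where
      cut' : r₀ (rot⁻¹ (rot e)) ≡ false
      cut' = trans (cong r₀ (rot⁻¹-rot e)) cut

    leaving-step : ∀ a v → leaving a v ≡ (if r₀ v then leaving a (rot v) else a v)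
    leaving-step a v = subst (λ w → leaving a w ≡ (if r₀ w then leaving a (rot v) else a w)) (rot⁻¹-rot v)
      (CyclicRecursion.cycRec-step rot⁻¹ rot rot-rot⁻¹ rot⁻¹-induction false (λ w y → if r₀ (rot⁻¹ w) then y else a (rot⁻¹ w)) (rot e)
        (λ y y' → trans (if-false cut') (sym (if-false cut'))) (rot v))
      where
      cut' : r₀ (rot⁻¹ (rot e)) ≡ false
      cut' = trans (cong r₀ (rot⁻¹-rot e)) cut

  entering-cut : ∀ b v → r₀ v ≡ false → entering b (rot v) ≡ b v
  entering-cut b v q = trans (entering-step b v) (if-false q)

  entering-run : ∀ b v → r₀ v ≡ true → entering b (rot v) ≡ entering b v
  entering-run b v q = trans (entering-step b v) (if-true q)

  leaving-cut : ∀ a v → r₀ v ≡ false → leaving a v ≡ a v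
  leaving-cut a v q = trans (leaving-step a v) (if-false q)

  leaving-run : ∀ a v → r₀ v ≡ true → leaving a v ≡ leaving a (rot v)
  leaving-run a v q = trans (leaving-step a v) (if-true q)

  -- The complement occurs because `a = true` is an upward half step but `b = true` a downward one.
  -- A block with spokes is kept: the path descends into it and leaves upwards, and an exchange
  -- would destroy the minimum.
  swapA swapB : (a b : Fin n → Bool) → Fin n → Bool
  swapA a b v = if r₀ v then true else (if s₀ v then a v else not (entering b v))
  swapB a b v = if r₀ v then true else (if s₀ (rot v) then b v else not (leaving a (rot v)))

  swapA-n : ∀ a b v → r₀ v ≡ false → s₀ v ≡ false → swapA a b v ≡ not (entering b v)
  swapA-n a b v q z = trans (if-false q) (if-false z)

  swapB-n : ∀ a b v → r₀ v ≡ false → s₀ (rot v) ≡ false → swapB a b v ≡ not (leaving a (rot v))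
  swapB-n a b v q z = trans (if-false q) (if-false z)

  module _ (a b a₁ b₁ : Fin n → Bool) (a₁≡ : ∀ v → a₁ v ≡ swapA a b v) (b₁≡ : ∀ v → b₁ v ≡ swapB a b v)
    (ra : ∀ v → r₀ v ≡ true → a v ≡ true) (rb : ∀ v → r₀ v ≡ true → b v ≡ true) where

    private
      entering₁ : ∀ v → s₀ v ≡ false → entering b₁ v ≡ not (leaving a v)
      entering₁ = rot-induction (λ v → s₀ v ≡ false → entering b₁ v ≡ not (leaving a v)) (rot e) (atCut e cut) step
        where
        atCut : ∀ v → r₀ v ≡ false → s₀ (rot v) ≡ false → entering b₁ (rot v) ≡ not (leaving a (rot v))
        atCut v q z = trans (entering-cut b₁ v q) (trans (b₁≡ v) (swapB-n a b v q z))
        step : ∀ v → (s₀ v ≡ false → entering b₁ v ≡ not (leaving a v)) → s₀ (rot v) ≡ false → entering b₁ (rot v) ≡ not (leaving a (rot v))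
        step v ih z with bool (r₀ v)
        ... | inj₂ q = atCut v q z
        ... | inj₁ q = trans (entering-run b₁ v q) (trans (ih (trans (sym (blockwise v q)) z)) (cong not (leaving-run a v q)))

      leaving₁ : ∀ v → s₀ v ≡ false → leaving a₁ v ≡ not (entering b v)
      leaving₁ = rot⁻¹-induction (λ v → s₀ v ≡ false → leaving a₁ v ≡ not (entering b v)) e (atCut e cut)
          (λ v ih → step (rot⁻¹ v) (subst (λ w → s₀ w ≡ false → leaving a₁ w ≡ not (entering b w)) (sym (rot-rot⁻¹ v)) ih))
        where
        atCut : ∀ v → r₀ v ≡ false → s₀ v ≡ false → leaving a₁ v ≡ not (entering b v)
        atCut v q z = trans (leaving-cut a₁ v q) (trans (a₁≡ v) (swapA-n a b v q z))
        step : ∀ v → (s₀ (rot v) ≡ false → leaving a₁ (rot v) ≡ not (entering b (rot v))) → s₀ v ≡ false → leaving a₁ v ≡ not (entering b v)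
        step v ih z with bool (r₀ v)
        ... | inj₂ q = atCut v q z
        ... | inj₁ q = trans (leaving-run a₁ v q) (trans (ih (trans (blockwise v q) z)) (cong not (entering-run b v q)))

    swapA-involutive : ∀ v → swapA a₁ b₁ v ≡ a v
    swapA-involutive v with bool (r₀ v) | bool (s₀ v)
    ... | inj₁ q | _ = trans (if-true q) (sym (ra v q))
    ... | inj₂ q | inj₁ z = trans (if-false q) (trans (if-true z) (trans (a₁≡ v) (trans (if-false q) (if-true z))))
    ... | inj₂ q | inj₂ z = trans (swapA-n a₁ b₁ v q z) (trans (cong not (entering₁ v z)) (trans (not-involutive (leaving a v)) (leaving-cut a v q)))

    swapB-involutive : ∀ v → swapB a₁ b₁ v ≡ b v
    swapB-involutive v with bool (r₀ v) | bool (s₀ (rot v))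
    ... | inj₁ q | _ = trans (if-true q) (sym (rb v q))
    ... | inj₂ q | inj₁ z = trans (if-false q) (trans (if-true z) (trans (b₁≡ v) (trans (if-false q) (if-true z))))
    ... | inj₂ q | inj₂ z = trans (swapB-n a₁ b₁ v q z) (trans (cong not (leaving₁ (rot v) z))
        (trans (not-involutive (entering b (rot v))) (entering-cut b v q)))

  module _ (a b : Fin n → Bool) (h : Fin n → ℕ) (p : Potential a b h)
    (ra : ∀ v → r₀ v ≡ true → a v ≡ true) (rb : ∀ v → r₀ v ≡ true → b v ≡ true) (hubs : ∀ v → s₀ v ≡ true → Hub a h v) where

    -- The midpoint before a block has height h + b - 1/2, for `b` the entering half step. Leaving
    -- it with the half step `a` puts the block at h + a + b - 1. All heights are raised by one to
    -- stay in ℕ; blocks with spokes do not move otherwise.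
    swapPot : Fin n → ℕ
    swapPot v = if s₀ v then suc (h v) else h v + 𝟙 (entering b v) + 𝟙 (leaving a v)

    private
      a' = swapA a b
      b' = swapB a b

      flat : ∀ v → r₀ v ≡ true → h (rot v) ≡ h v
      flat v q = +-cancelʳ-≡ 1 (h (rot v)) (h v) (subst₂ (λ x y → h (rot v) + 𝟙 y ≡ h v + 𝟙 x) (ra v q) (rb v q) (p v))

      +-last : ∀ x y z → x + y + 𝟙 z + 𝟙 (not z) ≡ suc (x + y)
      +-last x y z = trans (+-assoc (x + y) (𝟙 z) (𝟙 (not z))) (trans (cong (x + y +_) (𝟙-not z)) (+-comm (x + y) 1))

      -- The midpoint of a letter outside the flat keeps its height up to the global shift; `onLeft`
      -- computes the same midpoint from the other side.
      onRight : ∀ v → r₀ v ≡ false → swapPot v + 𝟙 (a' v) ≡ suc (h v + 𝟙 (a v))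
      onRight v q with bool (s₀ v)
      ... | inj₁ z = cong₂ (λ x y → x + 𝟙 y) (if-true z) (trans (if-false q) (if-true z))
      ... | inj₂ z = trans (cong₂ (λ x y → x + 𝟙 y) (if-false z) (swapA-n a b v q z))
          (trans (cong (_+ 𝟙 (not (entering b v))) (+-shuffle (h v) (𝟙 (entering b v)) (𝟙 (leaving a v))))
              (trans (+-last (h v) (𝟙 (leaving a v)) (entering b v)) (cong (λ x → suc (h v + 𝟙 x)) (leaving-cut a v q))))

      onLeft : ∀ v → r₀ v ≡ false → swapPot (rot v) + 𝟙 (b' v) ≡ suc (h (rot v) + 𝟙 (b v))
      onLeft v q with bool (s₀ (rot v))
      ... | inj₁ z = cong₂ (λ x y → x + 𝟙 y) (if-true z) (trans (if-false q) (if-true z))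
      ... | inj₂ z = trans (cong₂ (λ x y → x + 𝟙 y) (if-false z) (swapB-n a b v q z))
              (trans (+-last (h (rot v)) (𝟙 (entering b (rot v))) (leaving a (rot v))) (cong (λ x → suc (h (rot v) + 𝟙 x)) (entering-cut b v q)))

    swap-potential : Potential a' b' swapPot
    swap-potential v with bool (r₀ v)
    ... | inj₂ q = trans (onLeft v q) (trans (cong suc (p v)) (sym (onRight v q)))
    ... | inj₁ q = cong₂ _+_ (trans (cong (λ c → if c then suc (h (rot v)) else h (rot v) + 𝟙 (entering b (rot v)) + 𝟙 (leaving a (rot v)))
        (blockwise v q))
            (cong₂ (λ (x : ℕ) (y : ℕ) → if s₀ v then x else y) (cong suc (flat v q))
                (cong₂ _+_ (cong₂ (λ x y → x + 𝟙 y) (flat v q) (entering-run b v q)) (cong 𝟙 (sym (leaving-run a v q))))))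
            (cong 𝟙 (trans (if-true q) (sym (if-true q))))

    swap-hub : ∀ v → s₀ v ≡ true → Hub a' swapPot v
    swap-hub v z j = subst (_< swapPot j + 𝟙 (a' j)) (sym (if-true z)) (go j)
      where
      H = hubs v z
      -- The midpoint through which the path enters the block of `j` also lies above the minimum
      -- `v`.
      above : ∀ j → h v < h j + 𝟙 (entering b j)
      above = rot-induction (λ j → h v < h j + 𝟙 (entering b j)) (rot e) (atCut e cut) step
        where
        atCut : ∀ j → r₀ j ≡ false → h v < h (rot j) + 𝟙 (entering b (rot j))
        atCut j q = subst (h v <_) (trans (sym (p j)) (cong (λ x → h (rot j) + 𝟙 x) (sym (entering-cut b j q)))) (H j)
        step : ∀ j → h v < h j + 𝟙 (entering b j) → h v < h (rot j) + 𝟙 (entering b (rot j))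
        step j lt with bool (r₀ j)
        ... | inj₂ q = atCut j q
        ... | inj₁ q = subst (h v <_) (cong₂ (λ x y → x + 𝟙 y) (sym (flat j q)) (sym (entering-run b j q))) lt
      go : ∀ j → suc (h v) < swapPot j + 𝟙 (a' j)
      go j with bool (r₀ j) | bool (s₀ j)
      ... | inj₂ q | _ = subst (suc (h v) <_) (sym (onRight j q)) (s≤s (H j))
      ... | inj₁ q | inj₁ y = subst (suc (h v) <_) (sym (cong₂ (λ x c → x + 𝟙 c) (if-true y) (trans (if-true q) (sym (ra j q))))) (s≤s (H j))
      ... | inj₁ q | inj₂ y = subst (suc (h v) <_) (sym (trans (cong₂ (λ x c → x + 𝟙 c) (if-false y) (if-true q)) (+-comm _ 1)))
          (s≤s (≤-trans (above j) (m≤m+n _ _)))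

    -- The new `a` is compared with the old `b`, whose size is that of the old `a`. Off the flat,
    -- the new `a` complements the half step entering its block, which is a letter of `b` further
    -- back; `t` carries that letter along the block and cancels around the cycle.
    swap-count : ∑ (𝟙 ∘ a') + ∑ (𝟙 ∘ b) ≡ n + ∑ (λ v → 𝟙 (s₀ v) + 𝟙 (not (s₀ v) ∧ r₀ v))
    swap-count = +-cancelʳ-≡ (∑ t) _ _ (begin
      ∑ (𝟙 ∘ a') + ∑ (𝟙 ∘ b) + ∑ t                 ≡⟨ cong (_+ ∑ t) (∑-+ (𝟙 ∘ a') (𝟙 ∘ b)) ⟨
      ∑ (λ v → 𝟙 (a' v) + 𝟙 (b v)) + ∑ t           ≡⟨ ∑-+ (λ v → 𝟙 (a' v) + 𝟙 (b v)) t ⟨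
      ∑ (λ v → 𝟙 (a' v) + 𝟙 (b v) + t v)           ≡⟨ ∑-cong pointwise ⟩
      ∑ (λ v → 1 + ρ v + t (rot v))                ≡⟨ ∑-+ (λ v → 1 + ρ v) (t ∘ rot) ⟩
      ∑ (λ v → 1 + ρ v) + ∑ (t ∘ rot)              ≡⟨ cong₂ _+_ (trans (∑-+ (λ _ → 1) ρ)
          (cong (_+ ∑ ρ) (trans (∑-const n 1) (*-identityʳ n)))) (∑-rot t) ⟩
      n + ∑ ρ + ∑ t                                ∎)
      where
      open ≡-Reasoning
      ρ t : Fin n → ℕ
      ρ v = 𝟙 (s₀ v) + 𝟙 (not (s₀ v) ∧ r₀ v)
      t v = if s₀ v then 1 else 𝟙 (entering b v)
      t-cut : ∀ v → r₀ v ≡ false → t (rot v) ≡ 𝟙 (b v)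
      t-cut v q with bool (s₀ (rot v))
      ... | inj₁ z = trans (if-true z) (cong 𝟙 (sym (𝟙-true {h (rot v)} (subst (h (rot v) <_) (sym (p v)) (hubs (rot v) z v)))))
      ... | inj₂ z = trans (if-false z) (cong 𝟙 (entering-cut b v q))
      t-run : ∀ v → r₀ v ≡ true → t (rot v) ≡ t v
      t-run v q = cong₂ (λ c x → if c then 1 else 𝟙 x) (blockwise v q) (entering-run b v q)
      pointwise : ∀ v → 𝟙 (a' v) + 𝟙 (b v) + t v ≡ 1 + ρ v + t (rot v)
      pointwise v with bool (r₀ v) | bool (s₀ v)
      ... | inj₁ q | inj₁ z = cong₂ _+_ (trans (cong₂ (λ x y → 𝟙 x + 𝟙 y) (if-true q) (rb v q))
          (sym (cong (λ c → 1 + (𝟙 c + 𝟙 (not c ∧ r₀ v))) z))) (sym (t-run v q))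
      ... | inj₁ q | inj₂ z = cong₂ _+_ (trans (cong₂ (λ x y → 𝟙 x + 𝟙 y) (if-true q) (rb v q))
          (sym (cong₂ (λ c d → 1 + (𝟙 c + 𝟙 (not c ∧ d))) z q))) (sym (t-run v q))
      ... | inj₂ q | inj₁ z = trans (+-shuffle (𝟙 (a' v)) (𝟙 (b v)) (t v)) (cong₂ _+_
              (trans (cong₂ (λ x y → 𝟙 x + y) (trans (trans (if-false q) (if-true z)) (𝟙-true {h v} (hubs v z v))) (if-true z))
                  (sym (cong (λ c → 1 + (𝟙 c + 𝟙 (not c ∧ r₀ v))) z))) (sym (t-cut v q)))
      ... | inj₂ q | inj₂ z = trans (+-shuffle (𝟙 (a' v)) (𝟙 (b v)) (t v)) (cong₂ _+_
              (trans (cong₂ (λ x y → 𝟙 x + y) (swapA-n a b v q z) (if-false z))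
                  (trans (+-comm (𝟙 (not (entering b v))) (𝟙 (entering b v)))
                  (trans (𝟙-not (entering b v)) (sym (cong₂ (λ c d → 1 + (𝟙 c + 𝟙 (not c ∧ d))) z q))))) (sym (t-cut v q)))

complementary : ∀ c c' x y → c + c' ≡ x + y → (c ≡ᵇ x) ≡ (c' ≡ᵇ y)
complementary c c' x y s = bool-ext
  (λ e → T⇒≡ (≡⇒≡ᵇ c' y (+-cancelˡ-≡ x c' y (trans (cong (_+ c') (sym (≡ᵇ⇒≡ c x (≡⇒T e)))) s))))
  (λ e → T⇒≡ (≡⇒≡ᵇ c x (+-cancelʳ-≡ y c x (trans (cong (c +_) (sym (≡ᵇ⇒≡ c' y (≡⇒T e)))) s))))

Potential-cong : ∀ {k} {a b a₁ b₁ : Fin (suc k) → Bool} {h} → (∀ v → a₁ v ≡ a v) → (∀ v → b₁ v ≡ b v) → Potential a b h → Potential a₁ b₁ h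
Potential-cong ea eb p v = trans (cong (λ x → _ + 𝟙 x) (eb v)) (trans (p v) (cong (λ x → _ + 𝟙 x) (sym (ea v))))

-- Palindromicity and the Kazhdan-Lusztig polynomial of a whirl

module WhirlKL (k : ℕ) (rot≢ : (v : Fin (suc k)) → v ≢ rot v) where

  open WhirlWords k rot≢ public

  count : ℕ → Sub n → Sub n → ℤ
  count c A B = (card A ≡ᵇ c) ▸ 1ℤ

  above : Sub (n + n) → Sub n → Sub n → Bool
  above G A B = balanced A B ∧ (G ⊆b Φ A B)

  module Above (G : Sub (n + n)) (closed : Closed G) where
    open Closed closed

    s₀ r₀ : Fin n → Bool
    s₀ v = lookup G (sp v)
    r₀ v = lookup G (rim v)

    blockwise : ∀ v → r₀ v ≡ true → s₀ (rot v) ≡ s₀ v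
    blockwise v q = bool-ext (left v q) (right v q)

    module Swap (e : Fin n) (cut : r₀ e ≡ false) where
      open Involution s₀ r₀ blockwise e cut public

      α β : Sub n → Sub n → Sub n
      α A B = tabulate (swapA (lookup A) (lookup B))
      β A B = tabulate (swapB (lookup A) (lookup B))

      module _ (A B : Sub n) (valid : above G A B ≡ true) where
        private
          a = lookup A
          b = lookup B
          h = pot A B
          bal : card A ≡ card B
          bal = bal⇒ A B (∧-elimˡ valid)
          p : Potential a b h
          p = pot-potential A B bal
          G⊆Φ : G ⊆ Φ A B
          G⊆Φ = ⊆b⇒⊆ G (Φ A B) (∧-elimʳ {balanced A B} valid)
          module Wd = Word A B h bal p
          ra : ∀ v → r₀ v ≡ true → a v ≡ true
          ra v q = Wd.rim⇒a v (G⊆Φ .at (rim v) q)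
          rb : ∀ v → r₀ v ≡ true → b v ≡ true
          rb v q = Wd.rim⇒b v (G⊆Φ .at (rim v) q)
          hubs : ∀ v → s₀ v ≡ true → Hub a h v
          hubs v z = Wd.sp⇒Hub v (G⊆Φ .at (sp v) z)
          α≡ : ∀ v → lookup (α A B) v ≡ swapA a b v
          α≡ = lookup∘tabulate (swapA a b)
          β≡ : ∀ v → lookup (β A B) v ≡ swapB a b v
          β≡ = lookup∘tabulate (swapB a b)
          h' = swapPot a b h p ra rb hubs
          p₀ : Potential (swapA a b) (swapB a b) h'
          p₀ = swap-potential a b h p ra rb hubs
          p' : Potential (lookup (α A B)) (lookup (β A B)) h'
          p' = Potential-cong α≡ β≡ p₀
          bal' : card (α A B) ≡ card (β A B)
          bal' = trans (card-tabulate (swapA a b)) (trans (potential-balanced {a = swapA a b} {swapB a b} p₀) (sym (card-tabulate (swapB a b))))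
          module Wd' = Word (α A B) (β A B) h' bal' p'

        swap-above : above G (α A B) (β A B) ≡ true
        swap-above = ∧-intro (⇒bal (α A B) (β A B) bal') (⊆⇒⊆b {A = G} {Φ (α A B) (β A B)} (mk⊆ (elements
          (λ v z → Wd'.Hub⇒sp v (λ j → subst (λ c → h' v < h' j + 𝟙 c) (sym (α≡ j)) (swap-hub a b h p ra rb hubs v z j)))
          (λ v q → trans (Φ-rim (α A B) (β A B) v) (∧-intro (trans (α≡ v) (if-true q)) (trans (β≡ v) (if-true q)))))))

        α-involutive : α (α A B) (β A B) ≡ A
        α-involutive = sub-ext λ v → trans (lookup∘tabulate (swapA (lookup (α A B)) (lookup (β A B))) v)
          (swapA-involutive a b (lookup (α A B)) (lookup (β A B)) α≡ β≡ ra rb v)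

        β-involutive : β (α A B) (β A B) ≡ B
        β-involutive = sub-ext λ v → trans (lookup∘tabulate (swapB (lookup (α A B)) (lookup (β A B))) v)
          (swapB-involutive a b (lookup (α A B)) (lookup (β A B)) α≡ β≡ ra rb v)

        card-swap : card A + card (α A B) ≡ n + ∑ (rankTerm G)
        card-swap = trans (+-comm (card A) (card (α A B))) (trans (cong₂ _+_ (card-tabulate (swapA a b)) (trans bal (card≡∑ B)))
          (swap-count a b h p ra rb hubs))

    palindrome : ∀ c c' → c + c' ≡ n + ∑ (rankTerm G) →
                 Σ² n (λ A B → above G A B ▸ count c A B) ≡ Σ² n (λ A B → above G A B ▸ count c' A B)
    palindrome c c' e with search {P = λ v → r₀ v ≡ false} {Q = λ v → r₀ v ≡ true} (λ v → Data.Sum.swap (bool (r₀ v)))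
    ... | inj₁ (v , cut) = Σ²-involution n (above G) (count c) (count c') α β λ A B valid →
            swap-above A B valid , α-involutive A B valid , β-involutive A B valid ,
            cong (_▸ 1ℤ) (complementary (card A) (card (α A B)) c c' (trans (card-swap A B valid) (sym e)))
      where open Swap v cut
    -- When the whole rim lies in `G` there is no edge at which to cut, but then every letter of a
    -- word above `G` is (1,1).
    ... | inj₂ full = Σ²-cong n λ A B → ▸-cong (above G A B) {count c A B} {count c' A B} λ valid → cong (_▸ 1ℤ) (complementary (card A) (card A) c c'
            (trans (cong₂ _+_ (cardA A B valid) (cardA A B valid)) (trans (cong (n +_) (sym total)) (sym e))))
      where
      total : ∑ (rankTerm G) ≡ n
      total = trans (∑-cong λ v → trans (cong (λ c → 𝟙 (s₀ v) + 𝟙 (not (s₀ v) ∧ c)) (full v)) (one (s₀ v))) (trans (∑-const n 1) (*-identityʳ n))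
        where
        one : ∀ x → 𝟙 x + 𝟙 (not x ∧ true) ≡ 1
        one true = refl
        one false = refl
      cardA : ∀ A B → above G A B ≡ true → card A ≡ n
      cardA A B valid = trans (card≡∑ A) (trans (∑-cong λ v → cong 𝟙 (Word.rim⇒a A B (pot A B) bal (pot-potential A B bal) v
          (⊆b⇒⊆ G (Φ A B) (∧-elimʳ {balanced A B} valid) .at (rim v) (full v)))) (trans (∑-const n 1) (*-identityʳ n)))
        where
        bal : card A ≡ card B
        bal = bal⇒ A B (∧-elimˡ valid)

  symmetric : ∀ G → isFlat M G ≡ true → ∀ i → Zcoeff M Q G i ≡ reverse (rk M ∸ rank M G) (Zcoeff M Q G) i
  symmetric G flat i = trans (Zcoeff≡Zwords G i) (trans (split (i ≤? d))
      (sym (cong ((i ≤ᵇ rk M ∸ rank M G) ▸_) (Zcoeff≡Zwords G (rk M ∸ rank M G ∸ i)))))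
    where
    closed = flat⇒closed G (isFlat⇒Flat flat)
    ρ = rank M G
    d = rk M ∸ ρ
    ρ≡ : ρ ≡ ∑ (rankTerm G)
    ρ≡ = rank-right-closed G (Closed.right closed)
    n≡ : n ≡ ρ + d
    n≡ = trans (sym rk-whirl) (sym (m+[n∸m]≡n (rank-mono {G} ⊆full)))
    split : Dec (i ≤ d) → Zwords G i ≡ reverse d (Zwords G) i
    split (yes le) = trans (Above.palindrome G closed (ρ + i) (ρ + (d ∸ i)) (begin
        ρ + i + (ρ + (d ∸ i))      ≡⟨ cong (ρ + i +_) (+-comm ρ (d ∸ i)) ⟩
        ρ + i + ((d ∸ i) + ρ)      ≡⟨ +-assoc (ρ + i) (d ∸ i) ρ ⟨
        ρ + i + (d ∸ i) + ρ        ≡⟨ cong (_+ ρ) (trans (+-assoc ρ i (d ∸ i)) (cong (ρ +_) (m+[n∸m]≡n le))) ⟩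
        ρ + d + ρ                  ≡⟨ cong₂ _+_ (sym n≡) ρ≡ ⟩
        n + ∑ (rankTerm G)         ∎)) (sym (reverse-≤ (Zwords G) le))
      where open ≡-Reasoning
    split (no gt) = trans (trans (Σ²-cong n λ A B → ▸▸-zero (above G A B) (card A ≡ᵇ ρ + i) {1ℤ} λ _ e →
        <-irrefl refl (≤-trans (subst (_< ρ + i) (sym n≡) (+-monoʳ-< ρ (≰⇒> gt))) (subst (_≤ n) (≡ᵇ⇒≡ (card A) (ρ + i) (≡⇒T e)) (card≤ A)))) (Σ²-0 n))
        (sym (reverse-> (Zwords G) (≰⇒> gt)))

  palindromic : Palindromic M Q
  palindromic = record { matroid = whirl-isMatroid ; noLoops = whirl-loopless ; top = topTerm ; lowDeg = lowDegree ; symm = symmetric }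

  bottom : Sub n → Sub n → Bool
  bottom A B = balanced A B ∧ (Φ A B ==s ∅s)

  kl-whirl : ∀ P → IsKL P → ∀ i → coeff (P M) i ≡ Σ² n (λ A B → bottom A B ▸ count i A B)
  kl-whirl P isKL i = trans (KL.kl-unique P isKL M Q palindromic i)
    (Σ²-cong n λ A B → cong (λ r → bottom A B ▸ count (r + i) A B) rank-∅)

-- Words as lattice paths

-- ends≥0 h l: the path starting at height h stays nonnegative, ends at height l, and has no letter (1,1).
ends≥0 : ∀ {m} → ℕ → ℕ → Sub m → Sub m → Bool
ends≥0 h l [] [] = h ≡ᵇ l
ends≥0 h l (true ∷ A) (true ∷ B) = false
ends≥0 h l (true ∷ A) (false ∷ B) = ends≥0 (suc h) l A B
ends≥0 h l (false ∷ A) (false ∷ B) = ends≥0 h l A B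
ends≥0 zero l (false ∷ A) (true ∷ B) = false
ends≥0 (suc h) l (false ∷ A) (true ∷ B) = ends≥0 h l A B

-- Moreover some letter (0,0) occurs at height 0.
touches : ∀ {m} → ℕ → ℕ → Sub m → Sub m → Bool
touches h l [] [] = false
touches h l (true ∷ A) (true ∷ B) = false
touches h l (true ∷ A) (false ∷ B) = touches (suc h) l A B
touches zero l (false ∷ A) (false ∷ B) = ends≥0 zero l A B
touches (suc h) l (false ∷ A) (false ∷ B) = touches (suc h) l A B
touches zero l (false ∷ A) (true ∷ B) = false
touches (suc h) l (false ∷ A) (true ∷ B) = touches h l A B

-- The height before letter `i` is `h + pot A B i - card B`, and the final height is
-- `h + card A - card B`.
record Ends (h l : ℕ) {m} (A B : Sub m) : Set where
  constructor mkEnds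
  field
    disjoint : ∀ i → i ∈ A → i ∈ B → ⊥
    stays    : ∀ i → card B ≤ h + pot A B i
    end      : card B + l ≡ h + card A
open Ends

Floor : ℕ → ∀ {m} → Sub m → Sub m → Set
Floor h {m} A B = ∃ λ (j : Fin m) → j ∉ A × j ∉ B × card B ≡ h + pot A B j

step+ : ∀ {a b h h'} → h' + 𝟙 b ≡ h + 𝟙 a → ∀ x → 𝟙 b + (h' + x) ≡ h + (𝟙 a + x)
step+ {a} {b} {h} {h'} e x = trans (sym (+-assoc (𝟙 b) h' x)) (trans (cong (_+ x) (trans (+-comm (𝟙 b) h') e)) (+-assoc h (𝟙 a) x))

module _ {m} {a b : Bool} {h h' l : ℕ} (A B : Sub m) (e : h' + 𝟙 b ≡ h + 𝟙 a) where

  ends-cons : (a ≡ true → b ≡ true → ⊥) → Ends h' l A B → Ends h l (a ∷ A) (b ∷ B)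
  ends-cons ne (mkEnds d s t) = mkEnds
    (λ { zero → ne ; (suc i) → d i })
    (λ { zero → m≤n+m _ h ; (suc i) → subst₂ _≤_ (sym (card-∷ b B)) (step+ {a} {b} e (pot A B i)) (+-monoʳ-≤ (𝟙 b) (s i)) })
    (trans (cong (_+ l) (card-∷ b B)) (trans (+-assoc (𝟙 b) (card B) l)
        (trans (cong (𝟙 b +_) t) (trans (step+ {a} {b} e (card A)) (cong (h +_) (sym (card-∷ a A)))))))

  ends-uncons : Ends h l (a ∷ A) (b ∷ B) → Ends h' l A B
  ends-uncons (mkEnds d s t) = mkEnds (d ∘ suc)
    (λ i → +-cancelˡ-≤ (𝟙 b) _ _ (subst₂ _≤_ (card-∷ b B) (sym (step+ {a} {b} e (pot A B i))) (s (suc i))))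
    (+-cancelˡ-≡ (𝟙 b) _ _ (trans (sym (+-assoc (𝟙 b) (card B) l)) (trans (cong (_+ l) (sym (card-∷ b B)))
        (trans t (trans (cong (h +_) (card-∷ a A)) (sym (step+ {a} {b} e (card A))))))))

module _ {m} {a b : Bool} {h h' : ℕ} (A B : Sub m) (e : h' + 𝟙 b ≡ h + 𝟙 a) where

  floor-cons : Floor h' A B → Floor h (a ∷ A) (b ∷ B)
  floor-cons (j , x , y , z) = suc j , x , y , trans (card-∷ b B) (trans (cong (𝟙 b +_) z) (step+ {a} {b} e (pot A B j)))

  floor-uncons : (a ≡ false → b ≡ false → h ≡ 0 → ⊥) → Floor h (a ∷ A) (b ∷ B) → Floor h' A B
  floor-uncons ne (zero , x , y , z) = ⊥-elim (ne x y (+-cancelʳ-≡ (card (b ∷ B)) h 0 (sym z)))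
  floor-uncons ne (suc j , x , y , z) = j , x , y , +-cancelˡ-≡ (𝟙 b) _ _ (trans (sym (card-∷ b B)) (trans z (sym (step+ {a} {b} e (pot A B j)))))

noDown : ∀ {m l} (A B : Sub m) → Ends 0 l (false ∷ A) (true ∷ B) → ⊥
noDown [] [] (mkEnds _ _ ())
noDown (a ∷ A) (b ∷ B) (mkEnds _ s _) = <-irrefl refl (s (suc zero))

ends≥0⇒ : ∀ {m} h l (A B : Sub m) → ends≥0 h l A B ≡ true → Ends h l A B
ends≥0⇒ h l [] [] p = mkEnds (λ ()) (λ ()) (trans (sym (≡ᵇ⇒≡ h l (≡⇒T p))) (sym (+-identityʳ h)))
ends≥0⇒ h l (true ∷ A) (false ∷ B) p = ends-cons A B (trans (+-identityʳ (suc h)) (+-comm 1 h)) (λ _ ()) (ends≥0⇒ (suc h) l A B p)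
ends≥0⇒ h l (false ∷ A) (false ∷ B) p = ends-cons A B refl (λ ()) (ends≥0⇒ h l A B p)
ends≥0⇒ (suc h) l (false ∷ A) (true ∷ B) p = ends-cons A B (trans (+-comm h 1) (sym (+-identityʳ (suc h)))) (λ ()) (ends≥0⇒ h l A B p)

⇒ends≥0 : ∀ {m} h l (A B : Sub m) → Ends h l A B → ends≥0 h l A B ≡ true
⇒ends≥0 h l [] [] E = T⇒≡ (≡⇒≡ᵇ h l (trans (sym (+-identityʳ h)) (sym (end E))))
⇒ends≥0 h l (true ∷ A) (true ∷ B) E = ⊥-elim (disjoint E zero refl refl)
⇒ends≥0 h l (true ∷ A) (false ∷ B) E = ⇒ends≥0 (suc h) l A B (ends-uncons A B (trans (+-identityʳ (suc h)) (+-comm 1 h)) E)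
⇒ends≥0 h l (false ∷ A) (false ∷ B) E = ⇒ends≥0 h l A B (ends-uncons A B refl E)
⇒ends≥0 zero l (false ∷ A) (true ∷ B) E = ⊥-elim (noDown A B E)
⇒ends≥0 (suc h) l (false ∷ A) (true ∷ B) E = ⇒ends≥0 h l A B (ends-uncons A B (trans (+-comm h 1) (sym (+-identityʳ (suc h)))) E)

touches⇒ : ∀ {m} h l (A B : Sub m) → touches h l A B ≡ true → Ends h l A B × Floor h A B
touches⇒ h l [] [] ()
touches⇒ h l (true ∷ A) (false ∷ B) p with touches⇒ (suc h) l A B p
... | E , F = ends-cons A B (trans (+-identityʳ (suc h)) (+-comm 1 h)) (λ _ ()) E , floor-cons A B (trans (+-identityʳ (suc h)) (+-comm 1 h)) F
touches⇒ zero l (false ∷ A) (false ∷ B) p = ends-cons A B refl (λ ()) (ends≥0⇒ zero l A B p) , (zero , refl , refl , refl)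
touches⇒ (suc h) l (false ∷ A) (false ∷ B) p with touches⇒ (suc h) l A B p
... | E , F = ends-cons A B refl (λ ()) E , floor-cons A B refl F
touches⇒ (suc h) l (false ∷ A) (true ∷ B) p with touches⇒ h l A B p
... | E , F = ends-cons A B (trans (+-comm h 1) (sym (+-identityʳ (suc h)))) (λ ()) E , floor-cons A B
    (trans (+-comm h 1) (sym (+-identityʳ (suc h)))) F

⇒touches : ∀ {m} h l (A B : Sub m) → Ends h l A B → Floor h A B → touches h l A B ≡ true
⇒touches h l [] [] E (() , _)
⇒touches h l (true ∷ A) (true ∷ B) E F = ⊥-elim (disjoint E zero refl refl)
⇒touches h l (true ∷ A) (false ∷ B) E F = ⇒touches (suc h) l A B (ends-uncons A B up E) (floor-uncons A B up (λ ()) F)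
  where up = trans (+-identityʳ (suc h)) (+-comm 1 h)
⇒touches zero l (false ∷ A) (false ∷ B) E F = ⇒ends≥0 zero l A B (ends-uncons A B refl E)
⇒touches (suc h) l (false ∷ A) (false ∷ B) E F = ⇒touches (suc h) l A B (ends-uncons A B refl E) (floor-uncons A B refl (λ _ _ ()) F)
⇒touches zero l (false ∷ A) (true ∷ B) E F = ⊥-elim (noDown A B E)
⇒touches (suc h) l (false ∷ A) (true ∷ B) E F = ⇒touches h l A B (ends-uncons A B dn E) (floor-uncons A B dn (λ _ ()) F)
  where dn = trans (+-comm h 1) (sym (+-identityʳ (suc h)))

-- The path stays nonnegative and reaches 0, so its starting height is the depth of its lowest
-- point, which depends on the word alone.
touches-unique : ∀ {m} h h' (A B : Sub m) → touches h h A B ≡ true → touches h' h' A B ≡ true → h ≡ h'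
touches-unique h h' A B p q with touches⇒ h h A B p | touches⇒ h' h' A B q
... | E , (j , _ , _ , z) | E' , (j' , _ , _ , z') = +-cancelʳ-≡ (pot A B j) h h' (trans (sym z) (trans z' (cong (h' +_) same)))
  where
  same : pot A B j' ≡ pot A B j
  same = ≤-antisym (+-cancelˡ-≤ h' _ _ (≤-trans (≤-reflexive (sym z')) (stays E' j))) (+-cancelˡ-≤ h _ _ (≤-trans (≤-reflexive (sym z)) (stays E j')))

-- Path counts, as coefficient functions in t

weight : ∀ {m} → Sub m → ℕ → ℤ
weight A i = (card A ≡ᵇ i) ▸ 1ℤ

paths : ℕ → ℕ → ℕ → ℕ → ℤ
paths l m h i = Σ² m λ A B → ends≥0 h l A B ▸ weight A i

touching : ℕ → ℕ → ℕ → ℕ → ℤ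
touching l m h i = Σ² m λ A B → touches h l A B ▸ weight A i

Σ²-suc : ∀ m (f : Sub (suc m) → Sub (suc m) → ℤ) → Σ² (suc m) f ≡
  (Σ² m (λ A B → f (false ∷ A) (false ∷ B)) +ℤ Σ² m (λ A B → f (false ∷ A) (true ∷ B))) +ℤ
  (Σ² m (λ A B → f (true ∷ A) (false ∷ B)) +ℤ Σ² m (λ A B → f (true ∷ A) (true ∷ B)))
Σ²-suc m f = cong₂ _+ℤ_
  (ΣS-+ m (λ A → ΣS m (λ B → f (false ∷ A) (false ∷ B))) (λ A → ΣS m (λ B → f (false ∷ A) (true ∷ B))))
  (ΣS-+ m (λ A → ΣS m (λ B → f (true ∷ A) (false ∷ B))) (λ A → ΣS m (λ B → f (true ∷ A) (true ∷ B))))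

▸0 : ∀ c → c ▸ 0ℤ ≡ 0ℤ
▸0 true = refl
▸0 false = refl

raised : ∀ m (c : Sub m → Sub m → Bool) i → Σ² m (λ A B → c A B ▸ weight (true ∷ A) i) ≡ shift 1 (λ i → Σ² m (λ A B → c A B ▸ weight A i)) i
raised m c zero = trans (Σ²-cong m λ A B → ▸0 (c A B)) (Σ²-0 m)
raised m c (suc i) = refl

prevℤ : (ℕ → ℕ → ℤ) → ℕ → ℕ → ℤ
prevℤ x zero i = 0ℤ
prevℤ x (suc h) i = x h i

private
  arrange : ∀ x y z → (x +ℤ y) +ℤ (z +ℤ 0ℤ) ≡ (z +ℤ x) +ℤ y
  arrange x y z = trans (cong ((x +ℤ y) +ℤ_) (ℤ.+-identityʳ z)) (trans (ℤ.+-comm (x +ℤ y) z) (sym (ℤ.+-assoc z x y)))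

paths-suc : ∀ l m h i → paths l (suc m) h i ≡ (shift 1 (paths l m (suc h)) i +ℤ paths l m h i) +ℤ prevℤ (paths l m) h i
paths-suc l m zero i = trans (Σ²-suc m (λ A B → ends≥0 0 l A B ▸ weight A i))
    (trans (cong₂ _+ℤ_ (cong (paths l m 0 i +ℤ_) (Σ²-0 m)) (cong₂ _+ℤ_ (raised m (ends≥0 1 l) i) (Σ²-0 m)))
  (arrange (paths l m 0 i) 0ℤ (shift 1 (paths l m 1) i)))
paths-suc l m (suc h) i = trans (Σ²-suc m (λ A B → ends≥0 (suc h) l A B ▸ weight A i))
    (trans (cong ((paths l m (suc h) i +ℤ paths l m h i) +ℤ_) (cong₂ _+ℤ_ (raised m (ends≥0 (suc (suc h)) l) i) (Σ²-0 m)))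
  (arrange (paths l m (suc h) i) (paths l m h i) (shift 1 (paths l m (suc (suc h))) i)))

touching-suc-zero : ∀ l m i → touching l (suc m) 0 i ≡ paths l m 0 i +ℤ shift 1 (touching l m 1) i
touching-suc-zero l m i = trans (Σ²-suc m (λ A B → touches 0 l A B ▸ weight A i))
    (trans (cong₂ _+ℤ_ (cong (paths l m 0 i +ℤ_) (Σ²-0 m)) (cong₂ _+ℤ_ (raised m (touches 1 l) i) (Σ²-0 m)))
  (cong₂ _+ℤ_ (ℤ.+-identityʳ (paths l m 0 i)) (ℤ.+-identityʳ (shift 1 (touching l m 1) i))))

touching-suc-suc : ∀ l m h i → touching l (suc m) (suc h) i ≡ (shift 1 (touching l m (suc (suc h))) i +ℤ touching l m (suc h) i) +ℤ touching l m h i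
touching-suc-suc l m h i = trans (Σ²-suc m (λ A B → touches (suc h) l A B ▸ weight A i))
    (trans (cong ((touching l m (suc h) i +ℤ touching l m h i) +ℤ_) (cong₂ _+ℤ_ (raised m (touches (suc (suc h)) l) i) (Σ²-0 m)))
  (arrange (touching l m (suc h) i) (touching l m h i) (shift 1 (touching l m (suc (suc h))) i)))

sumTo : ℕ → (ℕ → ℤ) → ℤ
sumTo zero f = f 0
sumTo (suc N) f = sumTo N f +ℤ f (suc N)

sumTo-cong : ∀ N {f g} → (∀ j → f j ≡ g j) → sumTo N f ≡ sumTo N g
sumTo-cong zero h = h 0
sumTo-cong (suc N) h = cong₂ _+ℤ_ (sumTo-cong N h) (h (suc N))

sumTo-Σ² : ∀ N m (f : ℕ → Sub m → Sub m → ℤ) → Σ² m (λ A B → sumTo N (λ j → f j A B)) ≡ sumTo N (λ j → Σ² m (f j))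
sumTo-Σ² zero m f = refl
sumTo-Σ² (suc N) m f = trans (ΣS-cong m λ A → ΣS-+ m (λ B → sumTo N (λ j → f j A B)) (f (suc N) A))
  (trans (ΣS-+ m (λ A → ΣS m (λ B → sumTo N (λ j → f j A B))) (λ A → ΣS m (f (suc N) A))) (cong (_+ℤ Σ² m (f (suc N))) (sumTo-Σ² N m f)))

sumTo-zero : ∀ N {f} → (∀ j → j ≤ N → f j ≡ 0ℤ) → sumTo N f ≡ 0ℤ
sumTo-zero zero h = h 0 z≤n
sumTo-zero (suc N) h = trans (cong₂ _+ℤ_ (sumTo-zero N λ j le → h j (m≤n⇒m≤1+n le)) (h (suc N) ≤-refl)) refl

sumTo-single : ∀ N {f : ℕ → ℤ} {x} j₀ → j₀ ≤ N → f j₀ ≡ x → (∀ j → j ≢ j₀ → f j ≡ 0ℤ) → sumTo N f ≡ x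
sumTo-single zero .0 z≤n e z = e
sumTo-single (suc N) {f} {x} j₀ le e z with m≤n⇒m<n∨m≡n le
... | inj₁ lt = trans (cong₂ _+ℤ_ (sumTo-single N j₀ (≤-pred lt) e z) (z (suc N) (λ q → <-irrefl (sym q) lt))) (ℤ.+-identityʳ x)
... | inj₂ refl = trans (cong₂ _+ℤ_ (sumTo-zero N λ j le' → z j (λ q → <-irrefl q (s≤s le'))) e) (ℤ.+-identityˡ x)

-- From cyclic words without flat to walks on the half line

module BottomPaths (k : ℕ) (rot≢ : (v : Fin (suc k)) → v ≢ rot v) where
  open WhirlKL k rot≢

  pot₀ : ∀ (A B : Sub n) → pot A B zero ≡ card B
  pot₀ (a ∷ A) (b ∷ B) = refl

  -- The word is read from vertex zero, with its minimum moved to height 0. The lowest vertex `v₀`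
  -- is not a hub, so the midpoint of some letter lies below it; such a letter must be (0,0) at the
  -- floor.
  bottom⇒touches : ∀ A B → bottom A B ≡ true → ∃ λ j → j ≤ n × touches j j A B ≡ true
  bottom⇒touches A B bot = level , ≤-trans (m∸n≤m (card B) low) (card≤ B) , ⇒touches level level A B
      (mkEnds disj (λ i → subst (_≤ level + pot A B i) level+ (+-monoʳ-≤ level (proj₂ (argmin (pot A B)) i)))
        (trans (cong (_+ level) (sym bal)) (+-comm (card A) level)))
      (floor (search {P = λ j → pot A B j + 𝟙 (lookup A j) ≤ low} {Q = λ j → low < pot A B j + 𝟙 (lookup A j)}
          (λ j → choose j (pot A B j + 𝟙 (lookup A j) ≤? low))))
    where
    bal : card A ≡ card B
    bal = bal⇒ A B (∧-elimˡ bot)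
    p : Potential (lookup A) (lookup B) (pot A B)
    p = pot-potential A B bal
    module Wd = Word A B (pot A B) bal p
    empty : Φ A B ≡ ∅s
    empty = ==s⇒≡ (∧-elimʳ {balanced A B} bot)
    v₀ = proj₁ (argmin (pot A B))
    low = pot A B v₀
    -- Vertex zero has potential `card B`, so this is its height above the minimum.
    level = card B ∸ low
    level+ : level + low ≡ card B
    level+ = m∸n+n≡m (subst (low ≤_) (pot₀ A B) (proj₂ (argmin (pot A B)) zero))
    disj : ∀ i → i ∈ A → i ∈ B → ⊥
    disj i x y = true≢false (trans (Φ-rim A B i) (∧-intro x y)) (subst (rim i ∉_) (sym empty) (x∉∅ (rim i)))
    choose : ∀ j → Dec (pot A B j + 𝟙 (lookup A j) ≤ low) → (pot A B j + 𝟙 (lookup A j) ≤ low) ⊎ (low < pot A B j + 𝟙 (lookup A j))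
    choose j (yes q) = inj₁ q
    choose j (no q) = inj₂ (≰⇒> q)
    floor : (∃ λ j → pot A B j + 𝟙 (lookup A j) ≤ low) ⊎ (∀ j → low < pot A B j + 𝟙 (lookup A j)) → Floor level A B
    floor (inj₂ H) = ⊥-elim (true≢false (Wd.Hub⇒sp v₀ H) (subst (sp v₀ ∉_) (sym empty) (x∉∅ (sp v₀))))
    floor (inj₁ (j , le)) = j , aj , bj , trans (sym level+) (cong (level +_) (≤-antisym (proj₂ (argmin (pot A B)) j) (≤-trans (m≤m+n _ _) le)))
      where
      aj : j ∉ A
      aj = ¬true⇒false λ x → <-irrefl refl (≤-trans (≤-trans (s≤s (proj₂ (argmin (pot A B)) j))
          (≤-reflexive (trans (+-comm 1 (pot A B j)) (cong (λ c → pot A B j + 𝟙 c) (sym x))))) le)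
      bj : j ∉ B
      bj = ¬true⇒false λ y → <-irrefl refl (≤-trans (≤-trans (s≤s (proj₂ (argmin (pot A B)) (rot j)))
             (≤-reflexive (trans (+-comm 1 (pot A B (rot j))) (trans (cong (λ c → pot A B (rot j) + 𝟙 c) (sym y)) (p j))))) le)

  -- The dip at the floor lies below every vertex and so excludes all hubs; disjointness of the two
  -- sets excludes all peaks.
  touches⇒bottom : ∀ j A B → touches j j A B ≡ true → bottom A B ≡ true
  touches⇒bottom j A B q with touches⇒ j j A B q
  ... | E , (i , x , y , z) = ∧-intro (⇒bal A B bal) (subst (λ X → Φ A B ==s X ≡ true) empty (==s-refl (Φ A B)))
    where
    bal : card A ≡ card B
    bal = sym (+-cancelʳ-≡ j (card B) (card A) (trans (end E) (+-comm j (card A))))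
    module Wd = Word A B (pot A B) bal (pot-potential A B bal)
    empty : Φ A B ≡ ∅s
    empty = ⊆-antisym (mk⊆ (elements {X = λ e → e ∈ Φ A B → e ∈ ∅s}
      (λ v s → ⊥-elim (<-irrefl refl (≤-trans (Wd.sp⇒Hub v s i) (≤-trans (≤-reflexive (trans (cong (λ c → pot A B i + 𝟙 c) x) (+-identityʳ _)))
        (+-cancelˡ-≤ j _ _ (≤-trans (≤-reflexive (sym z)) (stays E v)))))))
      (λ v s → ⊥-elim (disjoint E v (Wd.rim⇒a v s) (Wd.rim⇒b v s))))) ∅⊆

  kl-paths : ∀ P → IsKL P → ∀ i → coeff (P M) i ≡ sumTo n (λ j → touching j n j i)
  kl-paths P isKL i = trans (kl-whirl P isKL i) (trans (Σ²-cong n pointwise) (sumTo-Σ² n n (λ j A B → touches j j A B ▸ weight A i)))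
    where
    pointwise : ∀ A B → bottom A B ▸ count i A B ≡ sumTo n (λ j → touches j j A B ▸ weight A i)
    pointwise A B = cases (bool (bottom A B))
      where
      off : ∀ {c} z → c ≡ false → c ▸ z ≡ 0ℤ
      off z refl = refl
      cases : (bottom A B ≡ true) ⊎ (bottom A B ≡ false) → bottom A B ▸ count i A B ≡ sumTo n (λ j → touches j j A B ▸ weight A i)
      cases (inj₂ e) = trans (off (count i A B) e) (sym (sumTo-zero n λ j _ → off (weight A i)
          (¬true⇒false λ q → true≢false (touches⇒bottom j A B q) e)))
      cases (inj₁ e) with bottom⇒touches A B e
      ... | j₀ , le , q = trans (cong (_▸ count i A B) e) (sym (sumTo-single n j₀ le (cong (_▸ weight A i) q)
              λ j ne → off (weight A i) (¬true⇒false λ q' → ne (touches-unique j j₀ A B q' q))))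

-- Formal power series

-- Instantiated twice: over ℤ with variable t, and over the result with variable u. A polynomial in
-- t is thus viewed as a power series.
module PowerSeries (C : CommutativeRing 0ℓ 0ℓ) where
  private
    module C = CommutativeRing C
    open C using (Carrier; _≈_; 0#; 1#) renaming (_+_ to _⊕_; _*_ to _⊗_; -_ to ⊖_)
    module S = SetoidReasoning C.setoid
    module Sv = SemiringSolver C.commutativeSemiring

  PS : Set
  PS = ℕ → Carrier

  tail : PS → PS
  tail f n = f (suc n)

  infix 4 _≋_
  _≋_ : PS → PS → Set
  f ≋ g = ∀ n → f n ≈ g n

  infixl 7 _⊛_
  _⊛_ : PS → PS → PS
  (f ⊛ g) zero = f zero ⊗ g zero
  (f ⊛ g) (suc n) = f zero ⊗ g (suc n) ⊕ (tail f ⊛ g) n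

  infixl 6 _⊞_
  _⊞_ : PS → PS → PS
  (f ⊞ g) n = f n ⊕ g n

  const : Carrier → PS
  const c zero = c
  const c (suc _) = 0#

  X : PS
  X (suc zero) = 1#
  X _ = 0#

  ⊛-cong : ∀ {f f' g g'} → f ≋ f' → g ≋ g' → f ⊛ g ≋ f' ⊛ g'
  ⊛-cong p q zero = C.*-cong (p 0) (q 0)
  ⊛-cong p q (suc n) = C.+-cong (C.*-cong (p 0) (q (suc n))) (⊛-cong (p ∘ suc) q n)

  -- The product is defined by peeling off the first term; peeling off the last one instead yields
  -- commutativity.
  ⊛-last : ∀ f g n → (f ⊛ g) (suc n) ≈ (f ⊛ tail g) n ⊕ f (suc n) ⊗ g 0
  ⊛-last f g zero = C.refl
  ⊛-last f g (suc n) = C.trans (C.+-congˡ (⊛-last (tail f) g n)) (C.sym (C.+-assoc _ _ _))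

  ⊛-comm : ∀ f g → f ⊛ g ≋ g ⊛ f
  ⊛-comm f g zero = C.*-comm _ _
  ⊛-comm f g (suc n) = S.begin
    f 0 ⊗ g (suc n) ⊕ (tail f ⊛ g) n  S.≈⟨ C.+-cong (C.*-comm _ _) (⊛-comm (tail f) g n) ⟩
    g (suc n) ⊗ f 0 ⊕ (g ⊛ tail f) n  S.≈⟨ C.+-comm _ _ ⟩
    (g ⊛ tail f) n ⊕ g (suc n) ⊗ f 0  S.≈⟨ ⊛-last g f n ⟨
    (g ⊛ f) (suc n)                   S.∎

  ⊛-distribʳ : ∀ h f g → (f ⊞ g) ⊛ h ≋ f ⊛ h ⊞ g ⊛ h
  ⊛-distribʳ h f g zero = C.distribʳ _ _ _
  ⊛-distribʳ h f g (suc n) = C.trans (C.+-cong (C.distribʳ _ _ _) (⊛-distribʳ h (tail f) (tail g) n))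
    (Sv.solve 4 (λ a b c d → (a Sv.:+ b) Sv.:+ (c Sv.:+ d) Sv.:= (a Sv.:+ c) Sv.:+ (b Sv.:+ d)) C.refl _ _ _ _)

  ⊛-scale : ∀ c f g n → ((λ i → c ⊗ f i) ⊛ g) n ≈ c ⊗ (f ⊛ g) n
  ⊛-scale c f g zero = C.*-assoc _ _ _
  ⊛-scale c f g (suc n) = C.trans (C.+-cong (C.*-assoc _ _ _) (⊛-scale c (tail f) g n)) (C.sym (C.distribˡ _ _ _))

  ⊛-assoc : ∀ f g h → (f ⊛ g) ⊛ h ≋ f ⊛ (g ⊛ h)
  ⊛-assoc f g h zero = C.*-assoc _ _ _
  ⊛-assoc f g h (suc n) = S.begin
    f 0 ⊗ g 0 ⊗ h (suc n) ⊕ (((λ i → f 0 ⊗ tail g i) ⊞ tail f ⊛ g) ⊛ h) n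
      S.≈⟨ C.+-congˡ (C.trans (⊛-distribʳ h (λ i → f 0 ⊗ tail g i) (tail f ⊛ g) n) (C.+-cong (⊛-scale (f 0) (tail g) h n) (⊛-assoc (tail f) g h n))) ⟩
    f 0 ⊗ g 0 ⊗ h (suc n) ⊕ (f 0 ⊗ (tail g ⊛ h) n ⊕ (tail f ⊛ (g ⊛ h)) n)
      S.≈⟨ Sv.solve 5 (λ a b c d e → a Sv.:* b Sv.:* c Sv.:+ (a Sv.:* d Sv.:+ e) Sv.:= a Sv.:* (b Sv.:* c Sv.:+ d) Sv.:+ e) C.refl (f 0)
          (g 0) (h (suc n)) _ _ ⟩
    f 0 ⊗ (g 0 ⊗ h (suc n) ⊕ (tail g ⊛ h) n) ⊕ (tail f ⊛ (g ⊛ h)) n S.∎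

  zero-⊛ : ∀ f g → (∀ n → f n ≈ 0#) → ∀ n → (f ⊛ g) n ≈ 0#
  zero-⊛ f g z zero = C.trans (C.*-congʳ (z 0)) (C.zeroˡ _)
  zero-⊛ f g z (suc n) = C.trans (C.+-cong (C.trans (C.*-congʳ (z 0)) (C.zeroˡ _)) (zero-⊛ (tail f) g (z ∘ suc) n)) (C.+-identityˡ _)

  const-⊛ : ∀ c g n → (const c ⊛ g) n ≈ c ⊗ g n
  const-⊛ c g zero = C.refl
  const-⊛ c g (suc n) = C.trans (C.+-congˡ (zero-⊛ (tail (const c)) g (λ _ → C.refl) n)) (C.+-identityʳ _)

  X-⊛-suc : ∀ g n → (X ⊛ g) (suc n) ≈ g n
  X-⊛-suc g n = C.trans (C.+-cong (C.zeroˡ _) (C.trans (⊛-cong tailX (λ _ → C.refl) n) (const-⊛ 1# g n)))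
      (C.trans (C.+-identityˡ _) (C.*-identityˡ _))
    where
    tailX : tail X ≋ const 1#
    tailX zero = C.refl
    tailX (suc _) = C.refl

  X-⊛-zero : ∀ g → (X ⊛ g) 0 ≈ 0#
  X-⊛-zero g = C.zeroˡ _

  psRing : CommutativeRing 0ℓ 0ℓ
  psRing = record
    { Carrier = PS ; _≈_ = _≋_ ; _+_ = _⊞_ ; _*_ = _⊛_ ; -_ = λ f n → ⊖ f n ; 0# = λ _ → 0# ; 1# = const 1#
    ; isCommutativeRing = record
      { isRing = record
        { +-isAbelianGroup = record
          { isGroup = record
            { isMonoid = record
              { isSemigroup = record
                { isMagma = record
                  { isEquivalence = record { refl = λ _ → C.refl ; sym = λ p n → C.sym (p n) ; trans = λ p q n → C.trans (p n) (q n) }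
                  ; ∙-cong = λ p q n → C.+-cong (p n) (q n) }
                ; assoc = λ f g h n → C.+-assoc _ _ _ }
              ; identity = (λ f n → C.+-identityˡ _) , (λ f n → C.+-identityʳ _) }
            ; inverse = (λ f n → C.-‿inverseˡ _) , (λ f n → C.-‿inverseʳ _)
            ; ⁻¹-cong = λ p n → C.-‿cong (p n) }
          ; comm = λ f g n → C.+-comm _ _ }
        ; *-cong = ⊛-cong
        ; *-assoc = ⊛-assoc
        ; *-identity = (λ f n → C.trans (const-⊛ 1# f n) (C.*-identityˡ _)) ,
            (λ f n → C.trans (⊛-comm f (const 1#) n) (C.trans (const-⊛ 1# f n) (C.*-identityˡ _)))
        ; distrib = (λ f g h n → C.trans (⊛-comm f (g ⊞ h) n) (C.trans (⊛-distribʳ f g h n) (C.+-cong (⊛-comm g f n) (⊛-comm h f n)))) , ⊛-distribʳ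
        }
      ; *-comm = ⊛-comm
      }
    }

  lower-zero : ∀ g z n → (∀ m → m ≤ n → z m ≈ 0#) → (g ⊛ z) n ≈ 0#
  lower-zero g z zero h = C.trans (C.*-congˡ (h 0 z≤n)) (C.zeroʳ _)
  lower-zero g z (suc n) h = C.trans (C.+-cong (C.trans (C.*-congˡ (h (suc n) ≤-refl)) (C.zeroʳ _))
      (lower-zero (tail g) z n (λ m le → h m (m≤n⇒m≤1+n le)))) (C.+-identityˡ _)

  -- Regularity of the constant term is asked for instead of invertibility, as the constant term in
  -- question is 2.
  cancel-⊛ : ∀ w z → (∀ c → w 0 ⊗ c ≈ 0# → c ≈ 0#) → (∀ n → (w ⊛ z) n ≈ 0#) → ∀ n → z n ≈ 0#
  cancel-⊛ w z reg h n = below n n ≤-refl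
    where
    below : ∀ n m → m ≤ n → z m ≈ 0#
    below zero zero z≤n = reg (z 0) (h 0)
    below (suc n) m le with m≤n⇒m<n∨m≡n le
    ... | inj₁ lt = below n m (≤-pred lt)
    ... | inj₂ refl = reg (z (suc n)) (C.trans (C.sym (C.trans (C.+-congˡ (lower-zero (tail w) z n (below n))) (C.+-identityʳ _))) (h (suc n)))

  ⊛-congʳ-≤ : ∀ g x y n → (∀ m → m ≤ n → x m ≈ y m) → (g ⊛ x) n ≈ (g ⊛ y) n
  ⊛-congʳ-≤ g x y zero h = C.*-congˡ (h 0 z≤n)
  ⊛-congʳ-≤ g x y (suc n) h = C.+-cong (C.*-congˡ (h (suc n) ≤-refl)) (⊛-congʳ-≤ (tail g) x y n (λ m le → h m (m≤n⇒m≤1+n le)))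

  -- Injectivity of multiplication by 1 - p, written without subtraction: the nth coefficient of
  -- `p ⊛ x` depends on earlier coefficients of `x` only.
  contraction-cancels : ∀ p → p 0 ≈ 0# → ∀ x y → x ⊞ p ⊛ y ≋ y ⊞ p ⊛ x → x ≋ y
  contraction-cancels p p₀ x y e n = below n n ≤-refl
    where
    open GroupProperties C.+-group using (∙-cancelʳ)
    same : ∀ n → (∀ m → m < n → x m ≈ y m) → (p ⊛ y) n ≈ (p ⊛ x) n
    same zero h = C.trans (C.trans (C.*-congʳ p₀) (C.zeroˡ _)) (C.sym (C.trans (C.*-congʳ p₀) (C.zeroˡ _)))
    same (suc n) h = C.+-cong (C.trans (C.trans (C.*-congʳ p₀) (C.zeroˡ _)) (C.sym (C.trans (C.*-congʳ p₀) (C.zeroˡ _))))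
      (⊛-congʳ-≤ (tail p) y x n (λ m le → C.sym (h m (s≤s le))))
    at-n : ∀ n → (∀ m → m < n → x m ≈ y m) → x n ≈ y n
    at-n n h = ∙-cancelʳ ((p ⊛ x) n) (x n) (y n) (C.trans (C.+-congˡ (C.sym (same n h))) (e n))
    below : ∀ n m → m ≤ n → x m ≈ y m
    below zero zero z≤n = at-n 0 λ _ ()
    below (suc n) m le with m≤n⇒m<n∨m≡n le
    ... | inj₁ lt = below n m (≤-pred lt)
    ... | inj₂ refl = at-n (suc n) λ m lt → below n m (≤-pred lt)

-- All identities are stated without subtraction, since the solver works over commutative semirings.

module WhirlIdentity (S : CommutativeRing 0ℓ 0ℓ) where
  private
    module S = CommutativeRing S
  open S using (Carrier; _≈_; 0#; 1#) renaming (_+_ to _⊹_; _*_ to _∙_)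
  open SetoidReasoning S.setoid
  open SemiringSolver S.commutativeSemiring
  open GroupProperties S.+-group using () renaming (∙-cancelʳ to +-cancelʳ)

  Cancels : Carrier → Set
  Cancels p = ∀ x y → x ⊹ p ∙ y ≈ y ⊹ p ∙ x → x ≈ y

  two four : Carrier
  two = 1# ⊹ 1#
  four = two ⊹ two

  -- Horner form in `u`, from which coefficients can be read off one at a time; likewise for the
  -- next two identities.
  factor-u : ∀ u t → two ∙ u ⊹ four ∙ (t ∙ (u ∙ u)) ≈ u ∙ (two ⊹ u ∙ (t ⊹ t ⊹ t ⊹ t))
  factor-u u t = solve 2 (λ u t → con 2 :* u :+ (con 2 :+ con 2) :* (t :* (u :* u)) := u :* (con 2 :+ u :* (t :+ t :+ t :+ t))) S.refl u t

  square-u : ∀ u → 1# ⊹ u ∙ u ≈ 1# ⊹ u ∙ (u ∙ 1#)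
  square-u u = solve 1 (λ u → con 1 :+ u :* u := con 1 :+ u :* (u :* con 1)) S.refl u

  double-tu : ∀ u t → two ⊹ two ∙ (t ∙ u) ≈ two ⊹ u ∙ (t ⊹ t)
  double-tu u t = solve 2 (λ u t → con 2 :+ con 2 :* (t :* u) := con 2 :+ u :* (t :+ t)) S.refl u t

  -- With `z = R - r` and `y = r` this is (R + r)(R - r) = 0 for two square roots of the same
  -- series.
  squares-factor : ∀ z y → (z ⊹ y) ∙ (z ⊹ y) ≈ y ∙ y → (z ⊹ (y ⊹ y)) ∙ z ≈ 0#
  squares-factor z y e = +-cancelʳ (y ∙ y) _ _ (begin
    (z ⊹ (y ⊹ y)) ∙ z ⊹ y ∙ y   ≈⟨ solve 2 (λ z y → (z :+ (y :+ y)) :* z :+ y :* y := (z :+ y) :* (z :+ y)) S.refl z y ⟩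
    (z ⊹ y) ∙ (z ⊹ y)           ≈⟨ e ⟩
    y ∙ y                       ≈⟨ S.+-identityˡ _ ⟨
    0# ⊹ y ∙ y                  ∎)

  module _ (u t f : Carrier) (f-eq : f ≈ u ∙ (1# ⊹ f ⊹ t ∙ (f ∙ f))) where

    -- 1 - c is the root of the discriminant of the quadratic equation for `f`.
    c : Carrier
    c = u ⊹ two ∙ (u ∙ (t ∙ f))

    discriminant : ∀ r D → r ⊹ c ≈ 1# → D ⊹ (two ∙ u ⊹ four ∙ (t ∙ (u ∙ u))) ≈ 1# ⊹ u ∙ u → r ∙ r ≈ D
    discriminant r D r-eq D-eq = +-cancelʳ (two ∙ u ⊹ four ∙ (t ∙ (u ∙ u)) ⊹ two ∙ c) (r ∙ r) D (begin
      r ∙ r ⊹ (two ∙ u ⊹ four ∙ (t ∙ (u ∙ u)) ⊹ two ∙ c)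
        ≈⟨ solve 3 (λ r c x → r :* r :+ (x :+ (con 2 :* c)) := (r :* r :+ con 2 :* c) :+ x) S.refl r c (two ∙ u ⊹ four ∙ (t ∙ (u ∙ u))) ⟩
      (r ∙ r ⊹ two ∙ c) ⊹ (two ∙ u ⊹ four ∙ (t ∙ (u ∙ u)))
        ≈⟨ S.+-congʳ rr ⟩
      (1# ⊹ c ∙ c) ⊹ (two ∙ u ⊹ four ∙ (t ∙ (u ∙ u)))
        ≈⟨ cc ⟩
      (1# ⊹ u ∙ u) ⊹ two ∙ c
        ≈⟨ S.+-congʳ D-eq ⟨
      (D ⊹ (two ∙ u ⊹ four ∙ (t ∙ (u ∙ u)))) ⊹ two ∙ c
        ≈⟨ S.+-assoc _ _ _ ⟩
      D ⊹ (two ∙ u ⊹ four ∙ (t ∙ (u ∙ u)) ⊹ two ∙ c) ∎)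
      where
      rr : r ∙ r ⊹ two ∙ c ≈ 1# ⊹ c ∙ c
      rr = begin
        r ∙ r ⊹ two ∙ c                    ≈⟨ solve 2 (λ r c → r :* r :+ con 2 :* c := r :* r :+ c :* con 1 :+ c) S.refl r c ⟩
        r ∙ r ⊹ c ∙ 1# ⊹ c                 ≈⟨ S.+-congʳ (S.+-congˡ (S.*-congˡ r-eq)) ⟨
        r ∙ r ⊹ c ∙ (r ⊹ c) ⊹ c            ≈⟨ solve 2 (λ r c → r :* r :+ c :* (r :+ c) :+ c := r :* (r :+ c) :+ c :+ c :* c) S.refl r c ⟩
        r ∙ (r ⊹ c) ⊹ c ⊹ c ∙ c            ≈⟨ S.+-congʳ (S.+-congʳ (S.trans (S.*-congˡ r-eq) (S.*-identityʳ r))) ⟩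
        r ⊹ c ⊹ c ∙ c                      ≈⟨ S.+-congʳ r-eq ⟩
        1# ⊹ c ∙ c                         ∎
      cc : (1# ⊹ c ∙ c) ⊹ (two ∙ u ⊹ four ∙ (t ∙ (u ∙ u))) ≈ (1# ⊹ u ∙ u) ⊹ two ∙ c
      cc = begin
        (1# ⊹ c ∙ c) ⊹ (two ∙ u ⊹ four ∙ (t ∙ (u ∙ u)))
          ≈⟨ solve 3 (λ u t f → let c = u :+ con 2 :* (u :* (t :* f)) in (con 1 :+ c :* c) :+ (con 2 :* u :+ (con 2 :+ con 2) :* (t :* (u :* u)))
               := (con 1 :+ u :* u) :+ (con 2 :* u :+ (con 2 :+ con 2) :* (u :* (t :* (u :* (con 1 :+ f :+ t :* (f :* f))))))) S.refl u t f ⟩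
        (1# ⊹ u ∙ u) ⊹ (two ∙ u ⊹ four ∙ (u ∙ (t ∙ (u ∙ (1# ⊹ f ⊹ t ∙ (f ∙ f))))))
          ≈⟨ S.+-congˡ (S.+-congˡ (S.*-congˡ (S.*-congˡ (S.*-congˡ f-eq)))) ⟨
        (1# ⊹ u ∙ u) ⊹ (two ∙ u ⊹ four ∙ (u ∙ (t ∙ f)))
          ≈⟨ solve 3 (λ u t f → (con 1 :+ u :* u) :+ (con 2 :* u :+ (con 2 :+ con 2) :* (u :* (t :* f))) := (con 1 :+ u :* u) :+ con 2 :*
              (u :+ con 2 :* (u :* (t :* f)))) S.refl u t f ⟩
        (1# ⊹ u ∙ u) ⊹ two ∙ c ∎

    module _ (M' K R : Carrier) (M'-eq : M' ≈ 1# ⊹ u ∙ (t ∙ f) ∙ M') (K-eq : K ≈ f ∙ M' ⊹ t ∙ (f ∙ f) ∙ K) (R-eq : R ⊹ c ≈ 1#)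
      (cancel₁ : Cancels (t ∙ (f ∙ f))) (cancel₂ : Cancels (u ∙ (t ∙ f))) where

      private
        p = t ∙ (f ∙ f)
        q = u ∙ (t ∙ f)
        v = 1# ⊹ t ∙ u
        Y = u ∙ (1# ⊹ t ∙ f)
        Z₀ = v ∙ R ∙ f

      -- This is Z₀ = (1 - p)(1 - q) Y multiplied out. The factors 1 - q and 1 - p are the
      -- denominators of `M'` and `K`; `claimA` and `RK` divide by them in turn.
      claimB : Z₀ ⊹ p ∙ Y ⊹ q ∙ Y ≈ Y ⊹ q ∙ (p ∙ Y)
      -- The first summand added to both sides completes `R` to `R + c`. The second allows one use
      -- of the quadratic equation, with cofactor 1 + t²f²u.
      claimB = +-cancelʳ (v ∙ f ∙ c ⊹ f ∙ (1# ⊹ t ∙ t ∙ (f ∙ f) ∙ u)) _ _ (begin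
        (Z₀ ⊹ p ∙ Y ⊹ q ∙ Y) ⊹ (v ∙ f ∙ c ⊹ f ∙ (1# ⊹ t ∙ t ∙ (f ∙ f) ∙ u))
          ≈⟨ solve 5 (λ u t f R c → let p = t :* (f :* f); q = u :* (t :* f); v = con 1 :+ t :* u; Y = u :* (con 1 :+ t :* f) in
               (v :* R :* f :+ p :* Y :+ q :* Y) :+ (v :* f :* c :+ f :* (con 1 :+ t :* t :* (f :* f) :* u))
               := v :* f :* (R :+ c) :+ (p :* Y :+ q :* Y) :+ f :* (con 1 :+ t :* t :* (f :* f) :* u)) S.refl u t f R c ⟩
        v ∙ f ∙ (R ⊹ c) ⊹ (p ∙ Y ⊹ q ∙ Y) ⊹ f ∙ (1# ⊹ t ∙ t ∙ (f ∙ f) ∙ u)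
          ≈⟨ S.+-cong (S.+-congʳ (S.*-congˡ R-eq)) (S.*-congʳ f-eq) ⟩
        v ∙ f ∙ 1# ⊹ (p ∙ Y ⊹ q ∙ Y) ⊹ u ∙ (1# ⊹ f ⊹ t ∙ (f ∙ f)) ∙ (1# ⊹ t ∙ t ∙ (f ∙ f) ∙ u)
          ≈⟨ solve 3 (λ u t f → let p = t :* (f :* f); q = u :* (t :* f); v = con 1 :+ t :* u; Y = u :* (con 1 :+ t :* f); c = u :+ con 2 :* (u :* (t :* f)) in
               v :* f :* con 1 :+ (p :* Y :+ q :* Y) :+ u :* (con 1 :+ f :+ t :* (f :* f)) :* (con 1 :+ t :* t :* (f :* f) :* u)
               := (Y :+ q :* (p :* Y)) :+ (v :* f :* c :+ f :* (con 1 :+ t :* t :* (f :* f) :* u))) S.refl u t f ⟩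
        (Y ⊹ q ∙ (p ∙ Y)) ⊹ (v ∙ f ∙ c ⊹ f ∙ (1# ⊹ t ∙ t ∙ (f ∙ f) ∙ u)) ∎)

      claimA : Z₀ ∙ M' ⊹ p ∙ Y ≈ Y
      claimA = cancel₂ _ _ (begin
        (Z₀ ∙ M' ⊹ p ∙ Y) ⊹ q ∙ Y
          ≈⟨ S.+-congʳ (S.+-congʳ (S.*-congˡ M'-eq)) ⟩
        (Z₀ ∙ (1# ⊹ q ∙ M') ⊹ p ∙ Y) ⊹ q ∙ Y
          ≈⟨ solve 5 (λ z m p q y → (z :* (con 1 :+ q :* m) :+ p :* y) :+ q :* y := (z :+ p :* y :+ q :* y) :+ q :* (z :* m)) S.refl Z₀ M' p q Y ⟩
        (Z₀ ⊹ p ∙ Y ⊹ q ∙ Y) ⊹ q ∙ (Z₀ ∙ M')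
          ≈⟨ S.+-congʳ claimB ⟩
        (Y ⊹ q ∙ (p ∙ Y)) ⊹ q ∙ (Z₀ ∙ M')
          ≈⟨ solve 5 (λ z m p q y → (y :+ q :* (p :* y)) :+ q :* (z :* m) := y :+ q :* (z :* m :+ p :* y)) S.refl Z₀ M' p q Y ⟩
        Y ⊹ q ∙ (Z₀ ∙ M' ⊹ p ∙ Y) ∎)

      RK : v ∙ R ∙ K ≈ Y
      RK = cancel₁ _ _ (begin
        v ∙ R ∙ K ⊹ p ∙ Y
          ≈⟨ S.+-congʳ (S.*-congˡ K-eq) ⟩
        v ∙ R ∙ (f ∙ M' ⊹ p ∙ K) ⊹ p ∙ Y
          ≈⟨ solve 6 (λ x f m p k y → x :* (f :* m :+ p :* k) :+ p :* y := (x :* f :* m :+ p :* y) :+ p :* (x :* k)) S.refl (v ∙ R) f M' p K Y ⟩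
        (Z₀ ∙ M' ⊹ p ∙ Y) ⊹ p ∙ (v ∙ R ∙ K)
          ≈⟨ S.+-congʳ claimA ⟩
        Y ⊹ p ∙ (v ∙ R ∙ K) ∎)

      generating : (two ⊹ two ∙ (t ∙ u)) ∙ R ∙ K ⊹ R ≈ 1# ⊹ u
      generating = begin
        (two ⊹ two ∙ (t ∙ u)) ∙ R ∙ K ⊹ R
          ≈⟨ solve 4 (λ t u r k → (con 2 :+ con 2 :* (t :* u)) :* r :* k :+ r := con 2 :* ((con 1 :+ t :* u) :* r :* k) :+ r) S.refl t u R K ⟩
        two ∙ (v ∙ R ∙ K) ⊹ R
          ≈⟨ S.+-congʳ (S.*-congˡ RK) ⟩
        two ∙ Y ⊹ R
          ≈⟨ solve 4 (λ u t f r → con 2 :* (u :* (con 1 :+ t :* f)) :+ r := u :+ (r :+ (u :+ con 2 :* (u :* (t :* f))))) S.refl u t f R ⟩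
        u ⊹ (R ⊹ c)
          ≈⟨ S.+-congˡ R-eq ⟩
        u ⊹ 1#
          ≈⟨ S.+-comm u 1# ⟩
        1# ⊹ u ∎

-- Generating functions of walks on the half line

module Walks (S : CommutativeRing 0ℓ 0ℓ) (u t : CommutativeRing.Carrier S) where
  private
    module S = CommutativeRing S
  open S using (Carrier; _≈_; 0#; 1#) renaming (_+_ to _⊹_; _*_ to _∙_)
  open SetoidReasoning S.setoid
  open SemiringSolver S.commutativeSemiring

  δ : ℕ → Carrier
  δ zero = 1#
  δ (suc _) = 0#

  prev : (ℕ → Carrier) → ℕ → Carrier
  prev x zero = 0#
  prev x (suc h) = x h

  -- First-step operators on series indexed by the starting height; a step up carries the weight t.
  -- `wall` omits the flat step at height 0.
  walk wall : (ℕ → Carrier) → ℕ → Carrier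
  walk x h = t ∙ x (suc h) ⊹ x h ⊹ prev x h
  wall x zero = t ∙ x 1
  wall x (suc h) = walk x (suc h)

  Solves : ((ℕ → Carrier) → ℕ → Carrier) → (ℕ → Carrier) → (ℕ → Carrier) → Set
  Solves ψ s x = ∀ h → x h ≈ s h ⊹ u ∙ ψ x h

  -- Holds for power series in `u`. Closed forms are then obtained by exhibiting two solutions of
  -- one system, with no combinatorial decomposition of walks.
  Unique : ((ℕ → Carrier) → ℕ → Carrier) → Set
  Unique ψ = ∀ s x y → Solves ψ s x → Solves ψ s y → ∀ h → x h ≈ y h

  walk-scale : ∀ c x h → c ∙ walk x h ≈ walk (λ j → c ∙ x j) h
  walk-scale c x zero = solve 4 (λ c t y z → c :* (t :* y :+ z :+ con 0) := t :* (c :* y) :+ c :* z :+ con 0) S.refl c t (x 1) (x 0)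
  walk-scale c x (suc h) = solve 5 (λ c t y z w → c :* (t :* y :+ z :+ w) := t :* (c :* y) :+ c :* z :+ c :* w) S.refl c t (x (suc (suc h)))
      (x (suc h)) (x h)

  wall-scale : ∀ c x h → c ∙ wall x h ≈ wall (λ j → c ∙ x j) h
  wall-scale c x zero = solve 3 (λ c t y → c :* (t :* y) := t :* (c :* y)) S.refl c t (x 1)
  wall-scale c x (suc h) = walk-scale c x (suc h)

  walk-+ : ∀ x y h → walk x h ⊹ walk y h ≈ walk (λ j → x j ⊹ y j) h
  walk-+ x y zero = solve 5 (λ t a b c d → (t :* a :+ b :+ con 0) :+ (t :* c :+ d :+ con 0) := t :* (a :+ c) :+ (b :+ d) :+ con 0) S.refl t
      (x 1) (x 0) (y 1) (y 0)
  walk-+ x y (suc h) = solve 7 (λ t a b c d e f → (t :* a :+ b :+ c) :+ (t :* d :+ e :+ f) := t :* (a :+ d) :+ (b :+ e) :+ (c :+ f)) S.refl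
    t (x (suc (suc h))) (x (suc h)) (x h) (y (suc (suc h))) (y (suc h)) (y h)

  Solves-scale : ∀ (ψ : (ℕ → Carrier) → ℕ → Carrier) → (∀ c x h → c ∙ ψ x h ≈ ψ (λ j → c ∙ x j) h) →
                 ∀ c {s x} → Solves ψ s x → Solves ψ (λ h → c ∙ s h) (λ h → c ∙ x h)
  Solves-scale ψ lin c {s} {x} sol h = begin
    c ∙ x h                                 ≈⟨ S.*-congˡ (sol h) ⟩
    c ∙ (s h ⊹ u ∙ ψ x h)                  ≈⟨ solve 4 (λ c s u o → c :* (s :+ u :* o) := c :* s :+ u :* (c :* o)) S.refl c (s h) u (ψ x h) ⟩
    c ∙ s h ⊹ u ∙ (c ∙ ψ x h)              ≈⟨ S.+-congˡ (S.*-congˡ (lin c x h)) ⟩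
    c ∙ s h ⊹ u ∙ ψ (λ j → c ∙ x j) h      ∎

  Solves-+ : ∀ {s s' x x'} → Solves walk s x → Solves walk s' x' → Solves walk (λ h → s h ⊹ s' h) (λ h → x h ⊹ x' h)
  Solves-+ {s} {s'} {x} {x'} p q h = begin
    x h ⊹ x' h                                            ≈⟨ S.+-cong (p h) (q h) ⟩
    (s h ⊹ u ∙ walk x h) ⊹ (s' h ⊹ u ∙ walk x' h)          ≈⟨ solve 5 (λ a u b c d → (a :+ u :* b) :+ (c :+ u :* d) := (a :+ c) :+ u :*
        (b :+ d)) S.refl (s h) u (walk x h) (s' h) (walk x' h) ⟩
    (s h ⊹ s' h) ⊹ u ∙ (walk x h ⊹ walk x' h)              ≈⟨ S.+-congˡ (S.*-congˡ (walk-+ x x' h)) ⟩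
    (s h ⊹ s' h) ⊹ u ∙ walk (λ j → x j ⊹ x' j) h           ∎

  -- Shifting the heights by one turns the bottom value into a source.
  Solves-shift : ∀ {x} → (∀ h → x (suc h) ≈ u ∙ walk x (suc h)) → Solves walk (λ h → (u ∙ x 0) ∙ δ h) (λ h → x (suc h))
  Solves-shift {x} p zero = S.trans (p 0)
    (solve 5 (λ u t a b c → u :* (t :* a :+ b :+ c) := (u :* c) :* con 1 :+ u :* (t :* a :+ b :+ con 0)) S.refl u t (x 2) (x 1) (x 0))
  Solves-shift {x} p (suc h) = S.trans (p (suc h)) (solve 3 (λ a u w → u :* w := a :* con 0 :+ u :* w) S.refl (u ∙ x 0) u
      (walk (λ j → x (suc j)) (suc h)))

  module _ (uniqueWalk : Unique walk) (uniqueWall : Unique wall)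
    (α : ℕ → Carrier) (α-solves : Solves walk δ α) (α' : ℕ → Carrier) (α'-solves : Solves wall δ α')
    (Δ : ℕ → Carrier) (Δ-solves : Solves walk α' Δ) where

    -- `f` is the first passage one level down: a return to the starting level, never going below
    -- it, followed by a down step. `M'` counts returns to the floor without a flat step there.
    f M' : Carrier
    f = u ∙ α 0
    M' = α' 0

    private
      α-suc : ∀ h → α (suc h) ≈ f ∙ α h
      α-suc = uniqueWalk (λ h → f ∙ δ h) (λ h → α (suc h)) (λ h → f ∙ α h)
        (Solves-shift λ h → S.trans (α-solves (suc h)) (S.+-identityˡ _))
        (Solves-scale walk walk-scale f α-solves)

    f-eq : f ≈ u ∙ (1# ⊹ f ⊹ t ∙ (f ∙ f))
    f-eq = begin
      u ∙ α 0                                        ≈⟨ S.*-congˡ (α-solves 0) ⟩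
      u ∙ (1# ⊹ u ∙ (t ∙ α 1 ⊹ α 0 ⊹ 0#))            ≈⟨ S.*-congˡ (S.+-congˡ (S.*-congˡ (S.+-congʳ (S.+-congʳ (S.*-congˡ (α-suc 0)))))) ⟩
      u ∙ (1# ⊹ u ∙ (t ∙ (u ∙ α 0 ∙ α 0) ⊹ α 0 ⊹ 0#))  ≈⟨ solve 3 (λ u t a → u :* (con 1 :+ u :* (t :* (u :* a :* a) :+ a :+ con 0)) := u :*
          (con 1 :+ u :* a :+ t :* ((u :* a) :* (u :* a)))) S.refl u t (α 0) ⟩
      u ∙ (1# ⊹ f ⊹ t ∙ (f ∙ f))                     ∎

    pow : ℕ → Carrier
    pow zero = 1#
    pow (suc h) = f ∙ pow h

    private
      pow-solves : Solves walk (λ h → u ∙ δ h) (λ h → pow (suc h))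
      pow-solves zero = S.trans (S.*-congʳ f-eq) (solve 3 (λ u t f → u :* (con 1 :+ f :+ t :* (f :* f)) :* con 1 := u :* con 1 :+ u :*
          (t :* (f :* (f :* con 1)) :+ f :* con 1 :+ con 0)) S.refl u t f)
      pow-solves (suc h) = S.trans (S.*-congʳ f-eq) (solve 4 (λ u t f p → u :* (con 1 :+ f :+ t :* (f :* f)) :* (f :* p) := u :* con 0 :+ u
          :* (t :* (f :* (f :* (f :* p))) :+ f :* (f :* p) :+ f :* p)) S.refl u t f (pow h))

      α'-suc : ∀ h → α' (suc h) ≈ M' ∙ pow (suc h)
      α'-suc = uniqueWalk (λ h → (u ∙ M') ∙ δ h) (λ h → α' (suc h)) (λ h → M' ∙ pow (suc h))
        (Solves-shift λ h → S.trans (α'-solves (suc h)) (S.+-identityˡ _))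
        (λ h → S.trans (Solves-scale walk walk-scale M' pow-solves h) (S.+-congʳ
            (solve 3 (λ m u d → m :* (u :* d) := u :* m :* d) S.refl M' u (δ h))))

    α'-pow : ∀ h → α' h ≈ M' ∙ pow h
    α'-pow zero = S.sym (S.*-identityʳ M')
    α'-pow (suc h) = α'-suc h

    M'-eq : M' ≈ 1# ⊹ u ∙ (t ∙ f) ∙ M'
    M'-eq = begin
      α' 0                          ≈⟨ α'-solves 0 ⟩
      1# ⊹ u ∙ (t ∙ α' 1)           ≈⟨ S.+-congˡ (S.*-congˡ (S.*-congˡ (α'-pow 1))) ⟩
      1# ⊹ u ∙ (t ∙ (M' ∙ (f ∙ 1#)))  ≈⟨ solve 4 (λ u t f m → con 1 :+ u :* (t :* (m :* (f :* con 1))) := con 1 :+ u :* (t :* f) :* m)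
          S.refl u t f M' ⟩
      1# ⊹ u ∙ (t ∙ f) ∙ M'         ∎

    private
      C : Carrier
      C = M' ∙ α 0

      num : ℕ → Carrier
      num zero = 0#
      num (suc h) = 1# ⊹ num h

      -- Away from the floor f^h solves the homogeneous equation, and the source α' h = M' f^h is
      -- proportional to it, hence the linear factor h + 1. The source obtained is 1 - p times the
      -- required one.
      Y : ℕ → Carrier
      Y h = num (suc h) ∙ (pow h ∙ C)

      p = t ∙ (f ∙ f)

      bottomC : C ⊹ p ∙ M' ≈ M' ⊹ u ∙ ((t ∙ f ⊹ t ∙ f ⊹ 1#) ∙ C)
      bottomC = begin
        M' ∙ α 0 ⊹ p ∙ M'
          ≈⟨ S.+-congʳ (S.*-congˡ (S.trans (α-solves 0) (S.+-congˡ (S.*-congˡ (S.+-congʳ (S.+-congʳ (S.*-congˡ (α-suc 0)))))))) ⟩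
        M' ∙ (1# ⊹ u ∙ (t ∙ (u ∙ α 0 ∙ α 0) ⊹ α 0 ⊹ 0#)) ⊹ p ∙ M'
          ≈⟨ solve 4 (λ m u t a → let f = u :* a in m :* (con 1 :+ u :* (t :* (u :* a :* a) :+ a :+ con 0)) :+ t :* (f :* f) :* m
               := m :+ u :* ((t :* f :+ t :* f :+ con 1) :* (m :* a))) S.refl M' u t (α 0) ⟩
        M' ⊹ u ∙ ((t ∙ f ⊹ t ∙ f ⊹ 1#) ∙ C) ∎

      Y-solves : ∀ h → Y h ⊹ p ∙ α' h ≈ α' h ⊹ u ∙ walk Y h
      Y-solves zero = begin
        (1# ⊹ 0#) ∙ (1# ∙ C) ⊹ p ∙ M'
          ≈⟨ solve 3 (λ c p m → (con 1 :+ con 0) :* (con 1 :* c) :+ p :* m := c :+ p :* m) S.refl C p M' ⟩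
        C ⊹ p ∙ M'
          ≈⟨ bottomC ⟩
        M' ⊹ u ∙ ((t ∙ f ⊹ t ∙ f ⊹ 1#) ∙ C)
          ≈⟨ solve 5 (λ m u t f c → m :+ u :* ((t :* f :+ t :* f :+ con 1) :* c)
               := m :+ u :* (t :* ((con 1 :+ (con 1 :+ con 0)) :* (f :* con 1 :* c)) :+ (con 1 :+ con 0) :* (con 1 :* c) :+ con 0)) S.refl
                   M' u t f C ⟩
        M' ⊹ u ∙ walk Y 0 ∎
      Y-solves (suc h) = begin
        (1# ⊹ N) ∙ (f ∙ w ∙ C) ⊹ p ∙ α' (suc h)
          ≈⟨ S.+-congˡ (S.*-congˡ (α'-pow (suc h))) ⟩
        (1# ⊹ N) ∙ (f ∙ w ∙ C) ⊹ p ∙ (M' ∙ (f ∙ w))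
          ≈⟨ solve 6 (λ N f w c p m → (con 1 :+ N) :* (f :* w :* c) :+ p :* (m :* (f :* w)) := N :* (f :* (w :* c)) :+ f :* w :*
              (c :+ p :* m)) S.refl N f w C p M' ⟩
        N ∙ (f ∙ (w ∙ C)) ⊹ f ∙ w ∙ (C ⊹ p ∙ M')
          ≈⟨ S.+-cong (S.*-congˡ (S.*-congʳ f-eq)) (S.*-congˡ bottomC) ⟩
        N ∙ (u ∙ (1# ⊹ f ⊹ t ∙ (f ∙ f)) ∙ (w ∙ C)) ⊹ f ∙ w ∙ (M' ⊹ u ∙ ((t ∙ f ⊹ t ∙ f ⊹ 1#) ∙ C))
          ≈⟨ solve 7 (λ N u t f w c m → N :* (u :* (con 1 :+ f :+ t :* (f :* f)) :* (w :* c)) :+ f :* w :*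
              (m :+ u :* ((t :* f :+ t :* f :+ con 1) :* c))
               := m :* (f :* w) :+ u :* (t :* ((con 1 :+ (con 1 :+ N)) :* (f :* (f :* w) :* c)) :+ (con 1 :+ N) :* (f :* w :* c) :+ N :*
                   (w :* c))) S.refl N u t f w C M' ⟩
        M' ∙ (f ∙ w) ⊹ u ∙ walk Y (suc h)
          ≈⟨ S.+-congʳ (α'-pow (suc h)) ⟨
        α' (suc h) ⊹ u ∙ walk Y (suc h) ∎
        where
        N = num (suc h)
        w = pow h

      -- both sides solve the equation of Δ, by the resonant ansatz Y
      Δ-eq : ∀ h → Δ h ≈ Y h ⊹ p ∙ Δ h
      Δ-eq = uniqueWalk α' Δ (λ h → Y h ⊹ p ∙ Δ h) Δ-solves λ h → begin
        Y h ⊹ p ∙ Δ h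
          ≈⟨ S.+-congˡ (Solves-scale walk walk-scale p Δ-solves h) ⟩
        Y h ⊹ (p ∙ α' h ⊹ u ∙ walk (λ j → p ∙ Δ j) h)
          ≈⟨ S.+-assoc _ _ _ ⟨
        (Y h ⊹ p ∙ α' h) ⊹ u ∙ walk (λ j → p ∙ Δ j) h
          ≈⟨ S.+-congʳ (Y-solves h) ⟩
        (α' h ⊹ u ∙ walk Y h) ⊹ u ∙ walk (λ j → p ∙ Δ j) h
          ≈⟨ solve 4 (λ a u x y → (a :+ u :* x) :+ u :* y := a :+ u :* (x :+ y)) S.refl (α' h) u (walk Y h) (walk (λ j → p ∙ Δ j) h) ⟩
        α' h ⊹ u ∙ (walk Y h ⊹ walk (λ j → p ∙ Δ j) h)
          ≈⟨ S.+-congˡ (S.*-congˡ (walk-+ Y (λ j → p ∙ Δ j) h)) ⟩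
        α' h ⊹ u ∙ walk (λ j → Y j ⊹ p ∙ Δ j) h ∎

    K-eq : u ∙ Δ 0 ≈ f ∙ M' ⊹ t ∙ (f ∙ f) ∙ (u ∙ Δ 0)
    K-eq = begin
      u ∙ Δ 0                                            ≈⟨ S.*-congˡ (Δ-eq 0) ⟩
      u ∙ ((1# ⊹ 0#) ∙ (1# ∙ (M' ∙ α 0)) ⊹ p ∙ Δ 0)       ≈⟨ solve 5 (λ u m a p d → u :* ((con 1 :+ con 0) :* (con 1 :* (m :* a)) :+ p :* d)
          := u :* a :* m :+ p :* (u :* d)) S.refl u M' (α 0) p (Δ 0) ⟩
      f ∙ M' ⊹ p ∙ (u ∙ Δ 0)                             ∎

    -- Cuts at the first dip: `α' h` counts what precedes it, `u` the dip itself and `E₀` the walks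
    -- from the floor that follow.
    touching-eq : ∀ E₀ Γ → Solves wall (λ h → (u ∙ E₀) ∙ δ h) Γ → ∀ h → Γ h ≈ u ∙ (α' h ∙ E₀)
    touching-eq E₀ Γ sol = uniqueWall (λ h → (u ∙ E₀) ∙ δ h) Γ (λ h → u ∙ (α' h ∙ E₀)) sol λ h →
      S.trans (rearr (α' h)) (S.trans (Solves-scale wall wall-scale (u ∙ E₀) α'-solves h) (S.+-congˡ (S.*-congˡ (wall-cong h))))
      where
      rearr : ∀ x → u ∙ (x ∙ E₀) ≈ (u ∙ E₀) ∙ x
      rearr x = solve 3 (λ u x e → u :* (x :* e) := u :* e :* x) S.refl u x E₀
      wall-cong : ∀ h → wall (λ j → (u ∙ E₀) ∙ α' j) h ≈ wall (λ j → u ∙ (α' j ∙ E₀)) h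
      wall-cong zero = S.*-congˡ (S.sym (rearr (α' 1)))
      wall-cong (suc h) = S.+-cong (S.+-cong (S.*-congˡ (S.sym (rearr (α' (suc (suc h)))))) (S.sym (rearr (α' (suc h))))) (S.sym (rearr (α' h)))

-- The generating function of the whirls

module PT = PowerSeries ℤ.+-*-commutativeRing
module PU = PowerSeries PT.psRing

tU uU : PU.PS
tU = PU.const PT.X
uU = PU.X

open Walks PU.psRing uU tU

module U = CommutativeRing PU.psRing
open U using () renaming (_≈_ to _≈U_; _+_ to _+U_; _*_ to _*U_; -_ to -U_; 1# to 1U; 0# to 0U)

X-shift : ∀ q i → (PT.X PT.⊛ q) i ≡ shift 1 q i
X-shift q zero = PT.X-⊛-zero q
X-shift q (suc i) = PT.X-⊛-suc q i

t-shift : ∀ y n i → (tU *U y) n i ≡ shift 1 (y n) i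
t-shift y n i = trans (PU.const-⊛ PT.X y n i) (X-shift (y n) i)

walkℤ wallℤ : (ℕ → ℕ → ℤ) → ℕ → ℕ → ℤ
walkℤ x h i = (shift 1 (x (suc h)) i +ℤ x h i) +ℤ prevℤ x h i
wallℤ x zero i = shift 1 (x 1) i
wallℤ x (suc h) i = walkℤ x (suc h) i

walk-coeff : ∀ x h n i → walk x h n i ≡ walkℤ (λ j → x j n) h i
walk-coeff x zero n i = cong (λ z → (z +ℤ x 0 n i) +ℤ 0ℤ) (t-shift (x 1) n i)
walk-coeff x (suc h) n i = cong (λ z → (z +ℤ x (suc h) n i) +ℤ x h n i) (t-shift (x (suc (suc h))) n i)

wall-coeff : ∀ x h n i → wall x h n i ≡ wallℤ (λ j → x j n) h i
wall-coeff x zero n i = t-shift (x 1) n i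
wall-coeff x (suc h) n i = walk-coeff x (suc h) n i

walkℤ-cong : ∀ x y → (∀ h i → x h i ≡ y h i) → ∀ h i → walkℤ x h i ≡ walkℤ y h i
walkℤ-cong x y e zero i = cong₂ _+ℤ_ (cong₂ _+ℤ_ (shift-cong 1 (e 1) i) (e 0 i)) refl
walkℤ-cong x y e (suc h) i = cong₂ _+ℤ_ (cong₂ _+ℤ_ (shift-cong 1 (e (suc (suc h))) i) (e (suc h) i)) (e h i)

wallℤ-cong : ∀ x y → (∀ h i → x h i ≡ y h i) → ∀ h i → wallℤ x h i ≡ wallℤ y h i
wallℤ-cong x y e zero i = shift-cong 1 (e 1) i
wallℤ-cong x y e (suc h) i = walkℤ-cong x y e (suc h) i

module Coefficientwise (ψ : (ℕ → PU.PS) → ℕ → PU.PS) (ψℤ : (ℕ → ℕ → ℤ) → ℕ → ℕ → ℤ)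
  (ψ-coeff : ∀ x h n i → ψ x h n i ≡ ψℤ (λ j → x j n) h i)
  (ψℤ-cong : ∀ x y → (∀ h i → x h i ≡ y h i) → ∀ h i → ψℤ x h i ≡ ψℤ y h i) where

  solves : ∀ s x → (∀ h i → x h 0 i ≡ s h 0 i) → (∀ n h i → x h (suc n) i ≡ s h (suc n) i +ℤ ψℤ (λ j → x j n) h i) → Solves ψ s x
  solves s x z st h zero i = trans (z h i) (sym (trans (cong (s h 0 i +ℤ_) (PU.X-⊛-zero (ψ x h) i)) (ℤ.+-identityʳ (s h 0 i))))
  solves s x z st h (suc n) i = trans (st n h i) (cong (s h (suc n) i +ℤ_) (sym (trans (PU.X-⊛-suc (ψ x h) n i) (ψ-coeff x h n i))))

  coeffs₀ : ∀ s x → Solves ψ s x → ∀ h i → x h 0 i ≡ s h 0 i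
  coeffs₀ s x sol h i = trans (sol h 0 i) (trans (cong (s h 0 i +ℤ_) (PU.X-⊛-zero (ψ x h) i)) (ℤ.+-identityʳ (s h 0 i)))

  coeffs : ∀ s x → Solves ψ s x → ∀ n h i → x h (suc n) i ≡ s h (suc n) i +ℤ ψℤ (λ j → x j n) h i
  coeffs s x sol n h i = trans (sol h (suc n) i) (cong (s h (suc n) i +ℤ_) (trans (PU.X-⊛-suc (ψ x h) n i) (ψ-coeff x h n i)))

  -- The coefficients up to u^n depend on the source only up to u^n. This truncated form of
  -- uniqueness is required for the finite sums `ΣU`, whose source is correct only up to the
  -- truncation.
  agree : ∀ s s' x y → Solves ψ s x → Solves ψ s' y → ∀ n → (∀ m → m ≤ n → ∀ h i → s h m i ≡ s' h m i) → ∀ h i → x h n i ≡ y h n i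
  agree s s' x y p q zero e h i = trans (coeffs₀ s x p h i) (trans (e 0 z≤n h i) (sym (coeffs₀ s' y q h i)))
  agree s s' x y p q (suc n) e h i = trans (coeffs s x p n h i) (trans (cong₂ _+ℤ_ (e (suc n) ≤-refl h i)
    (ψℤ-cong (λ j → x j n) (λ j → y j n) (agree s s' x y p q n (λ m le → e m (m≤n⇒m≤1+n le))) h i)) (sym (coeffs s' y q n h i)))

  unique : Unique ψ
  unique s x y p q h n i = agree s s x y p q n (λ _ _ _ _ → refl) h i

module CWalk = Coefficientwise walk walkℤ walk-coeff walkℤ-cong
module CWall = Coefficientwise wall wallℤ wall-coeff wallℤ-cong

pathGF touchGF : ℕ → ℕ → PU.PS
pathGF l h n = paths l n h
touchGF l h n = touching l n h

source : ℕ → ℕ → PU.PS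
source l h zero = paths l 0 h
source l h (suc n) i = 0ℤ

paths-solve : ∀ l → Solves walk (source l) (pathGF l)
paths-solve l = CWalk.solves (source l) (pathGF l) (λ _ _ → refl) λ n h i →
  trans (paths-suc l n h i) (sym (ℤ.+-identityˡ (walkℤ (paths l n) h i)))

source≈ : ∀ l h → (h ≡ l → source l h ≈U 1U) × (h ≢ l → source l h ≈U 0U)
source≈ l h = (λ { refl → same h }) , λ ne → λ { zero i → cong (_▸ weight {0} [] i) (¬true⇒false {h ≡ᵇ l} λ q → ne (≡ᵇ⇒≡ h l (≡⇒T q))) ;
    (suc n) i → refl }
  where
  same : ∀ h → source h h ≈U 1U
  same h zero zero = cong (_▸ 1ℤ) (T⇒≡ (≡⇒≡ᵇ h h refl))
  same h zero (suc i) = cong (_▸ 0ℤ) (T⇒≡ (≡⇒≡ᵇ h h refl))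
  same h (suc n) i = refl

α : ℕ → PU.PS
α = pathGF 0

α-solves : Solves walk δ α
α-solves h = U.trans {α h} {source 0 h +U uU *U walk α h} {δ h +U uU *U walk α h} (paths-solve 0 h)
    (U.+-congʳ {uU *U walk α h} {source 0 h} {δ h} (src h))
  where
  src : ∀ h → source 0 h ≈U δ h
  src zero = proj₁ (source≈ 0 0) refl
  src (suc h) = proj₂ (source≈ 0 (suc h)) λ ()

-- Walks of `n` steps from height `h` to 0 without a flat step at the floor.
avoid : ℕ → ℕ → ℕ → ℤ
avoid zero h = δ h 0
avoid (suc n) h = wallℤ (avoid n) h

α' : ℕ → PU.PS
α' h n = avoid n h

α'-solves : Solves wall δ α'
α'-solves = CWall.solves δ α' (λ _ _ → refl) λ n h i → trans (sym (ℤ.+-identityˡ (wallℤ (avoid n) h i)))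
    (cong (_+ℤ wallℤ (avoid n) h i) (sym (δ-suc h n i)))
  where
  δ-suc : ∀ h n i → δ h (suc n) i ≡ 0ℤ
  δ-suc zero n i = refl
  δ-suc (suc h) n i = refl

-- Descending from `h` takes at least `h` steps, so only finitely many levels matter for each
-- coefficient.
avoid-low : ∀ n h → n < h → ∀ i → avoid n h i ≡ 0ℤ
avoid-low zero (suc h) lt i = refl
avoid-low (suc n) (suc h) (s≤s lt) i = cong₂ _+ℤ_ (cong₂ _+ℤ_ (trans (shift-cong 1 (avoid-low n (suc (suc h)) (m≤n⇒m≤1+n (m≤n⇒m≤1+n lt))) i)
    (shift-0 i)) (avoid-low n (suc h) (m≤n⇒m≤1+n lt) i)) (avoid-low n h lt i)
  where
  shift-0 : ∀ i → shift 1 (λ _ → 0ℤ) i ≡ 0ℤ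
  shift-0 zero = refl
  shift-0 (suc i) = refl

-- A walk from `h` to any level `l`, followed by an `avoid` walk from `l` to the floor, summed over
-- `l`; the source `avoid` is the case of an empty first part.
split : ℕ → ℕ → ℕ → ℤ
split zero h = avoid 0 h
split (suc n) h i = avoid (suc n) h i +ℤ walkℤ (split n) h i

Δ : ℕ → PU.PS
Δ h n = split n h

Δ-solves : Solves walk α' Δ
Δ-solves = CWalk.solves α' Δ (λ _ _ → refl) (λ _ _ _ → refl)

fU M'U KU : PU.PS
fU = uU *U α 0
M'U = α' 0
KU = uU *U Δ 0

touch-solves : ∀ l → Solves wall (λ h → (uU *U pathGF l 0) *U δ h) (touchGF l)
touch-solves l = CWall.solves (λ h → (uU *U pathGF l 0) *U δ h) (touchGF l)
    (λ { zero i → sym (trans (U.*-identityʳ (uU *U pathGF l 0) 0 i) (PU.X-⊛-zero (pathGF l 0) i)) ; (suc h) i → sym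
        (U.zeroʳ (uU *U pathGF l 0) 0 i) })
    (λ { n zero i → trans (touching-suc-zero l n i) (cong (_+ℤ shift 1 (touching l n 1) i)
        (sym (trans (U.*-identityʳ (uU *U pathGF l 0) (suc n) i) (PU.X-⊛-suc (pathGF l 0) n i))))
       ; n (suc h) i → trans (touching-suc-suc l n h i) (trans (sym (ℤ.+-identityˡ (walkℤ (touching l n) (suc h) i)))
           (cong (_+ℤ walkℤ (touching l n) (suc h) i) (sym (U.zeroʳ (uU *U pathGF l 0) (suc n) i)))) })

touchGF≈ : ∀ l h → touchGF l h ≈U uU *U (α' h *U pathGF l 0)
touchGF≈ l = touching-eq CWalk.unique CWall.unique α α-solves α' α'-solves Δ Δ-solves (pathGF l 0) (touchGF l) (touch-solves l)

ΣU : ℕ → (ℕ → PU.PS) → PU.PS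
ΣU zero x = x 0
ΣU (suc N) x = ΣU N x +U x (suc N)

ΣU-coeff : ∀ N x n i → ΣU N x n i ≡ sumTo N (λ l → x l n i)
ΣU-coeff zero x n i = refl
ΣU-coeff (suc N) x n i = cong (_+ℤ x (suc N) n i) (ΣU-coeff N x n i)

ΣU-solves : ∀ N → Solves walk (λ h → ΣU N (λ l → α' l *U source l h)) (λ h → ΣU N (λ l → α' l *U pathGF l h))
ΣU-solves zero = Solves-scale walk walk-scale (α' 0) {source 0} {pathGF 0} (paths-solve 0)
ΣU-solves (suc N) = Solves-+ {λ h → ΣU N (λ l → α' l *U source l h)} {λ h → α' (suc N) *U source (suc N) h}
    {λ h → ΣU N (λ l → α' l *U pathGF l h)} {λ h → α' (suc N) *U pathGF (suc N) h}
  (ΣU-solves N) (Solves-scale walk walk-scale (α' (suc N)) {source (suc N)} {pathGF (suc N)} (paths-solve (suc N)))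

ΣU-source : ∀ N m → m ≤ N → ∀ h i → ΣU N (λ l → α' l *U source l h) m i ≡ α' h m i
ΣU-source N m le h i = trans (ΣU-coeff N (λ l → α' l *U source l h) m i) (cases (h ≤? N))
  where
  on : (α' h *U source h h) m i ≡ α' h m i
  on = trans (U.*-congˡ {α' h} {source h h} {1U} (proj₁ (source≈ h h) refl) m i) (U.*-identityʳ (α' h) m i)
  off : ∀ l → l ≢ h → (α' l *U source l h) m i ≡ 0ℤ
  off l ne = trans (U.*-congˡ {α' l} {source l h} {0U} (proj₂ (source≈ l h) (ne ∘ sym)) m i) (U.zeroʳ (α' l) m i)
  cases : Dec (h ≤ N) → sumTo N (λ l → (α' l *U source l h) m i) ≡ α' h m i
  cases (yes h≤N) = sumTo-single N h h≤N on off
  cases (no h≰N) = trans (sumTo-zero N λ l l≤N → off l λ { refl → h≰N l≤N }) (sym (avoid-low m h (≤-<-trans le (≰⇒> h≰N)) i))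

-- By `touchGF≈`, level `j` contributes a walk from 0 to `j` and a dip-free descent from `j`. The
-- sum over `j` satisfies the system of `Δ` up to the truncation, and the dip supplies the index
-- shift.
touching-sum : ∀ n i → sumTo (suc n) (λ j → touching j (suc n) j i) ≡ Δ 0 n i
touching-sum n i = begin
  sumTo (suc n) (λ j → touching j (suc n) j i)
    ≡⟨ sumTo-cong (suc n) (λ j → trans (touchGF≈ j j (suc n) i) (PU.X-⊛-suc (α' j *U pathGF j 0) n i)) ⟩
  sumTo (suc n) (λ j → (α' j *U pathGF j 0) n i)
    ≡⟨ ΣU-coeff (suc n) (λ j → α' j *U pathGF j 0) n i ⟨
  ΣU (suc n) (λ j → α' j *U pathGF j 0) n i
    ≡⟨ CWalk.agree _ α' (λ h → ΣU (suc n) (λ j → α' j *U pathGF j h)) Δ (ΣU-solves (suc n)) Δ-solves n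
        (λ m le → ΣU-source (suc n) m (m≤n⇒m≤1+n le)) 0 i ⟩
  Δ 0 n i ∎
  where open ≡-Reasoning

-- Translation of the series of the statement

hat : Series → PU.PS
hat F n = coeff (F n)

coeff-*P : ∀ p q j → coeff (p *P q) j ≡ (coeff p PT.⊛ coeff q) j
coeff-*P [] q j = sym (PT.zero-⊛ (coeff []) (coeff q) (λ _ → refl) j)
coeff-*P (a ∷ p) q zero = trans (coeff-*P-∷ a p q 0) (ℤ.+-identityʳ (a *ℤ coeff q 0))
coeff-*P (a ∷ p) q (suc j) = trans (coeff-*P-∷ a p q (suc j)) (cong (a *ℤ coeff q (suc j) +ℤ_) (coeff-*P p q j))

hat-*S : ∀ F G → hat (F *S G) ≈U hat F *U hat G
hat-*S F G n j = trans (coeff-sumP (λ i → F i *P G (n ∸ i)) (upTo (suc n)) j) (trans (sumUp (suc n) id) (go n F))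
  where
  Σ< : ℕ → (ℕ → ℤ) → ℤ
  Σ< zero f = 0ℤ
  Σ< (suc m) f = f 0 +ℤ Σ< m (f ∘ suc)
  sumUp : ∀ m g → sumL (λ i → coeff (F i *P G (n ∸ i)) j) (applyUpTo g m) ≡ Σ< m (λ i → coeff (F (g i) *P G (n ∸ g i)) j)
  sumUp zero g = refl
  sumUp (suc m) g = cong (coeff (F (g 0) *P G (n ∸ g 0)) j +ℤ_) (sumUp m (g ∘ suc))
  go : ∀ n (F : Series) → Σ< (suc n) (λ i → coeff (F i *P G (n ∸ i)) j) ≡ (hat F *U hat G) n j
  go zero F = trans (ℤ.+-identityʳ (coeff (F 0 *P G 0) j)) (coeff-*P (F 0) (G 0) j)
  go (suc n) F = cong₂ _+ℤ_ (coeff-*P (F 0) (G (suc n)) j) (go n (F ∘ suc))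

-- Treated by hand: a cycle with a single vertex violates `rot≢`, and `W 1` is not of the form
-- `whirl k`.
W₁-palindromic : Palindromic (W 1) (λ _ → coeff (1ℤ ∷ []))
W₁-palindromic = record
  { matroid = record { I1 = tt ; I2 = λ _ _ _ _ → tt ; I3 = aug }
  ; noLoops = λ _ → tt
  ; top = λ _ _ _ _ → refl
  ; lowDeg = low
  ; symm = symm
  }
  where
  aug : ∀ A B → _ → _ → card A < card B → ∃ λ x → T (lookup B x) × T (not (lookup A x)) × _
  aug (false ∷ []) (true ∷ []) _ _ _ = zero , tt , tt , tt
  aug (true ∷ []) (true ∷ []) _ _ (s≤s ())
  aug (true ∷ []) (false ∷ []) _ _ ()
  aug (false ∷ []) (false ∷ []) _ _ ()
  low : ∀ F → isFlat (W 1) F ≡ true → rank (W 1) F < rk (W 1) → ∀ i → rk (W 1) ≤ rank (W 1) F + 2 * i → coeff (1ℤ ∷ []) i ≡ 0ℤ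
  low (true ∷ []) _ (s≤s ())
  low (false ∷ []) _ _ zero ()
  low (false ∷ []) _ _ (suc i) _ = refl
  symm : ∀ G → isFlat (W 1) G ≡ true → ∀ i → Zcoeff (W 1) (λ _ → coeff (1ℤ ∷ [])) G i ≡ reverse (rk (W 1) ∸ rank (W 1) G)
      (Zcoeff (W 1) (λ _ → coeff (1ℤ ∷ [])) G) i
  symm (true ∷ []) _ zero = refl
  symm (true ∷ []) _ (suc i) = refl
  symm (false ∷ []) _ zero = refl
  symm (false ∷ []) _ (suc zero) = refl
  symm (false ∷ []) _ (suc (suc i)) = refl

hat-klGen : ∀ P → IsKL P → hat (klGen P) ≈U KU
hat-klGen P isKL zero i = sym (PU.X-⊛-zero (Δ 0) i)
hat-klGen P isKL (suc zero) i = trans (KL.kl-unique P isKL (W 1) _ W₁-palindromic i) (trans (one i) (sym (PU.X-⊛-suc (Δ 0) 0 i)))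
  where
  one : ∀ i → coeff (1ℤ ∷ []) i ≡ Δ 0 0 i
  one zero = refl
  one (suc i) = refl
hat-klGen P isKL (suc (suc k)) i = trans (BottomPaths.kl-paths (suc k) rot≢ P isKL i)
    (trans (touching-sum (suc k) i) (sym (PU.X-⊛-suc (Δ 0) (suc k) i)))

open WhirlIdentity PU.psRing

f-equation : fU ≈U uU *U (1U +U fU +U tU *U (fU *U fU))
f-equation = f-eq CWalk.unique CWall.unique α α-solves α' α'-solves Δ Δ-solves

fU₀ : ∀ i → fU 0 i ≡ 0ℤ
fU₀ = PU.X-⊛-zero (α 0)

cU : PU.PS
cU = c uU tU fU f-equation

c₀ : ∀ i → cU 0 i ≡ 0ℤ
c₀ i = trans (ℤ.+-identityˡ _) (trans (PT.⊛-cong {two 0} {two 0} {(uU *U (tU *U fU)) 0} {λ _ → 0ℤ} (λ _ → refl) (PU.X-⊛-zero (tU *U fU)) i)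
  (CommutativeRing.zeroʳ PT.psRing (two 0) i))

discr-equation : hat discr +U (two *U uU +U four *U (tU *U (uU *U uU))) ≈U 1U +U uU *U uU
discr-equation n i = trans (cong (hat discr n i +ℤ_) (factor-u uU tU n i)) (trans (table n i) (sym (square-u uU n i)))
  where
  fours Y : PU.PS
  fours = tU +U tU +U tU +U tU
  Y = two +U uU *U fours
  table : ∀ n i → hat discr n i +ℤ (uU *U Y) n i ≡ (1U +U uU *U (uU *U 1U)) n i
  table zero i = trans (cong (hat discr 0 i +ℤ_) (PU.X-⊛-zero Y i)) (trans (lem i) (cong (1U 0 i +ℤ_) (sym (PU.X-⊛-zero (uU *U 1U) i))))
    where
    lem : ∀ i → hat discr 0 i +ℤ 0ℤ ≡ 1U 0 i +ℤ 0ℤ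
    lem zero = refl
    lem (suc i) = refl
  table (suc zero) i = trans (cong (hat discr 1 i +ℤ_) (trans (PU.X-⊛-suc Y 0 i) (cong (two 0 i +ℤ_) (PU.X-⊛-zero fours i))))
      (trans (lem i) (cong (0ℤ +ℤ_) (sym (trans (PU.X-⊛-suc (uU *U 1U) 0 i) (PU.X-⊛-zero 1U i)))))
    where
    lem : ∀ i → hat discr 1 i +ℤ (two 0 i +ℤ 0ℤ) ≡ 0ℤ
    lem zero = refl
    lem (suc i) = refl
  table (suc (suc zero)) i = trans (cong (hat discr 2 i +ℤ_) (trans (PU.X-⊛-suc Y 1 i) (cong (two 1 i +ℤ_) (PU.X-⊛-suc fours 0 i))))
      (trans (lem i) (cong (0ℤ +ℤ_) (sym (trans (PU.X-⊛-suc (uU *U 1U) 1 i) (PU.X-⊛-suc 1U 0 i)))))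
    where
    lem : ∀ i → hat discr 2 i +ℤ (two 1 i +ℤ fours 0 i) ≡ 0ℤ +ℤ 1U 0 i
    lem zero = refl
    lem (suc zero) = refl
    lem (suc (suc i)) = refl
  table (suc (suc (suc n))) i = trans (cong (0ℤ +ℤ_) (trans (PU.X-⊛-suc Y (suc (suc n)) i) (cong (0ℤ +ℤ_) (PU.X-⊛-suc fours (suc n) i))))
      (cong (0ℤ +ℤ_) (sym (trans (PU.X-⊛-suc (uU *U 1U) (suc (suc n)) i) (PU.X-⊛-suc 1U (suc n) i))))

-- Identification of the square root

module _ (R : Series) (R₀ : R 0 ≈P (1ℤ ∷ [])) (R² : (R *S R) ≈S discr) where

  private
    r z w : PU.PS
    r = 1U +U (-U cU)
    z = hat R +U (-U r)
    w = z +U (r +U r)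

    r-eq : r +U cU ≈U 1U
    r-eq = U.trans {r +U cU} {1U +U ((-U cU) +U cU)} {1U} (U.+-assoc 1U (-U cU) cU)
        (U.trans {1U +U ((-U cU) +U cU)} {1U +U 0U} {1U} (U.+-congˡ {1U} (U.-‿inverseˡ cU)) (U.+-identityʳ 1U))

    z-eq : z +U r ≈U hat R
    z-eq = U.trans {z +U r} {hat R +U ((-U r) +U r)} {hat R} (U.+-assoc (hat R) (-U r) r)
        (U.trans {hat R +U ((-U r) +U r)} {hat R +U 0U} {hat R} (U.+-congˡ {hat R} (U.-‿inverseˡ r)) (U.+-identityʳ (hat R)))

    same-square : (z +U r) *U (z +U r) ≈U r *U r
    same-square n i = begin
      ((z +U r) *U (z +U r)) n i  ≡⟨ U.*-cong {z +U r} {hat R} {z +U r} {hat R} z-eq z-eq n i ⟩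
      (hat R *U hat R) n i        ≡⟨ hat-*S R R n i ⟨
      hat (R *S R) n i            ≡⟨ R² n i ⟩
      hat discr n i               ≡⟨ discriminant uU tU fU f-equation r (hat discr) r-eq discr-equation n i ⟨
      (r *U r) n i                ∎
      where open ≡-Reasoning

    r₀ : ∀ i → r 0 i ≡ 1U 0 i
    r₀ i = trans (cong (λ y → 1U 0 i +ℤ (- y)) (c₀ i)) (ℤ.+-identityʳ (1U 0 i))

    w₀ : ∀ i → w 0 i ≡ PT.const (1ℤ +ℤ 1ℤ) i
    w₀ zero = cong₂ _+ℤ_ (cong₂ (λ x y → x +ℤ (- y)) (R₀ 0) (r₀ 0)) (cong₂ _+ℤ_ (r₀ 0) (r₀ 0))
    w₀ (suc i) = cong₂ _+ℤ_ (cong₂ (λ x y → x +ℤ (- y)) (R₀ (suc i)) (r₀ (suc i))) (cong₂ _+ℤ_ (r₀ (suc i)) (r₀ (suc i)))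

    w-regular : ∀ y → (∀ i → (w 0 PT.⊛ y) i ≡ 0ℤ) → ∀ i → y i ≡ 0ℤ
    w-regular y e i with ℤ.i*j≡0⇒i≡0∨j≡0 (1ℤ +ℤ 1ℤ) (trans (sym (PT.const-⊛ (1ℤ +ℤ 1ℤ) y i))
        (trans (sym (PT.⊛-cong {w 0} {PT.const (1ℤ +ℤ 1ℤ)} {y} {y} w₀ (λ _ → refl) i)) (e i)))
    ... | inj₁ ()
    ... | inj₂ q = q

    -- The product of R - r and R + r vanishes, and R + r has constant term 2. This is where the
    -- choice of the root with constant term 1 enters.
    z≈0 : z ≈U 0U
    z≈0 = PU.cancel-⊛ w z w-regular (squares-factor z r same-square)

  R-equation : hat R +U cU ≈U 1U
  R-equation n i = trans (cong (_+ℤ cU n i) (trans (sym (z-eq n i)) (trans (cong (_+ℤ r n i) (z≈0 n i)) (ℤ.+-identityˡ (r n i))))) (r-eq n i)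

twoTu1-equation : hat twoTu1 ≈U two +U two *U (tU *U uU)
twoTu1-equation n i = trans (table n i) (sym (double-tu uU tU n i))
  where
  table : ∀ n i → hat twoTu1 n i ≡ (two +U uU *U (tU +U tU)) n i
  table zero i = trans (lem i) (cong (two 0 i +ℤ_) (sym (PU.X-⊛-zero (tU +U tU) i)))
    where
    lem : ∀ i → hat twoTu1 0 i ≡ two 0 i +ℤ 0ℤ
    lem zero = refl
    lem (suc i) = refl
  table (suc zero) i = trans (lem i) (cong (0ℤ +ℤ_) (sym (PU.X-⊛-suc (tU +U tU) 0 i)))
    where
    lem : ∀ i → hat twoTu1 1 i ≡ 0ℤ +ℤ (PT.X i +ℤ PT.X i)
    lem zero = refl
    lem (suc zero) = refl
    lem (suc (suc i)) = refl
  table (suc (suc n)) i = cong (0ℤ +ℤ_) (sym (PU.X-⊛-suc (tU +U tU) (suc n) i))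

u1-equation : hat u1 ≈U 1U +U uU
u1-equation zero zero = refl
u1-equation zero (suc i) = refl
u1-equation (suc zero) zero = refl
u1-equation (suc zero) (suc i) = refl
u1-equation (suc (suc n)) i = refl

-- The identity with its denominator 2(tu + 1)R cleared. In u this denominator has constant term 2,
-- so it is not a zero divisor and nothing is lost.
theorem4p12 : (P : RawMatroid → Poly) → IsKL P →
    (R : Series) → R 0 ≈P (1ℤ ∷ []) → (R *S R) ≈S discr →
    ((twoTu1 *S R) *S klGen P) ≈S (u1 -S R)
theorem4p12 P isKL R R₀ R² n i = begin
  hat ((twoTu1 *S R) *S klGen P) n i
    ≡⟨ hat-*S (twoTu1 *S R) (klGen P) n i ⟩
  (hat (twoTu1 *S R) *U hat (klGen P)) n i
    ≡⟨ U.*-cong {hat (twoTu1 *S R)} {(two +U two *U (tU *U uU)) *U hat R} {hat (klGen P)} {KU}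
         (U.trans {hat (twoTu1 *S R)} {hat twoTu1 *U hat R} {(two +U two *U (tU *U uU)) *U hat R} (hat-*S twoTu1 R)
           (U.*-congʳ {hat R} {hat twoTu1} {two +U two *U (tU *U uU)} twoTu1-equation))
         (hat-klGen P isKL) n i ⟩
  L
    ≡⟨ add-sub L ρ ⟨
  (L +ℤ ρ) +ℤ (- ρ)
    ≡⟨ cong (_+ℤ (- ρ)) (generating uU tU fU f-equation M'U KU (hat R) M'-equation K-equation (R-equation R R₀ R²) cancel₁ cancel₂ n i) ⟩
  (1U +U uU) n i +ℤ (- ρ)
    ≡⟨ cong₂ _+ℤ_ (u1-equation n i) (trans (coeff-scaleP (- 1ℤ) (R n) i) (ℤ.-1*i≡-i ρ)) ⟨
  coeff (u1 n) i +ℤ coeff (scaleP (- 1ℤ) (R n)) i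
    ≡⟨ coeff-+P (u1 n) (scaleP (- 1ℤ) (R n)) i ⟨
  coeff ((u1 -S R) n) i ∎
  where
  open ≡-Reasoning
  L ρ : ℤ
  L = ((two +U two *U (tU *U uU)) *U hat R *U KU) n i
  ρ = hat R n i
  add-sub : ∀ x y → (x +ℤ y) +ℤ (- y) ≡ x
  add-sub x y = trans (ℤ.+-assoc x y (- y)) (trans (cong (x +ℤ_) (ℤ.+-inverseʳ y)) (ℤ.+-identityʳ x))
  M'-equation : M'U ≈U 1U +U uU *U (tU *U fU) *U M'U
  M'-equation = M'-eq CWalk.unique CWall.unique α α-solves α' α'-solves Δ Δ-solves
  K-equation : KU ≈U fU *U M'U +U tU *U (fU *U fU) *U KU
  K-equation = K-eq CWalk.unique CWall.unique α α-solves α' α'-solves Δ Δ-solves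
  module T = CommutativeRing PT.psRing
  cancel₁ : Cancels (tU *U (fU *U fU))
  cancel₁ = PU.contraction-cancels (tU *U (fU *U fU)) (T.trans {(tU *U (fU *U fU)) 0} {tU 0 PT.⊛ (λ _ → 0ℤ)} {λ _ → 0ℤ}
    (T.*-congˡ {tU 0} {(fU *U fU) 0} {λ _ → 0ℤ} (T.trans {(fU *U fU) 0} {fU 0 PT.⊛ (λ _ → 0ℤ)} {λ _ → 0ℤ}
        (T.*-congˡ {fU 0} {fU 0} {λ _ → 0ℤ} fU₀) (T.zeroʳ (fU 0)))) (T.zeroʳ (tU 0)))
  cancel₂ : Cancels (uU *U (tU *U fU))
  cancel₂ = PU.contraction-cancels (uU *U (tU *U fU)) (PU.X-⊛-zero (tU *U fU))
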